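{- Let $t\geq 5$ be an integer and let $G_t$ be any graph constructed as described in the context. Then $G_t$ is $C_{2t-2}$-free, i.e. $G_t$ has no induced subgraph isomorphic to the cycle on $2t-2$ vertices.
   Context: Graphs are finite and simple; path length = number of edges. Territories. A territory is a pair $(T,B)$ where $T$ is a graph and $B$ an induced cycle in $T$; its perimeter is the length of $B$. Expansion (w.r.t. $t$): given a territory $(T',B')$, choose for some $k\geq0$ a stable set $\{x_1,\dots,x_k\}$ of $B'$, let $x_i^-,x_i^+$ be the neighbours of $x_i$ in $B'$, and choose $I\subseteq\{1,\dots,k\}$. Build $T$ from $T'$: for each $i$ add a new path $P_i$ of length $2t-6$ with ends $y_i^-,y_i^+$ and middle vertex $y_i$, and edges $x_i^-y_i^-,x_iy_i,x_i^+y_i^+$; for each $i\in I$, with $v_i^-,v_i^+$ the neighbours of $y_i$ in $P_i$ ($v_i^-$ on the side of $y_i^-$), add a new path $Q_i$ of length $t-4$ with ends $z_i^-,z_i^+$ and edges $v_i^-z_i^-,v_i^+z_i^+$ (all new vertices distinct). For $i\notin I$, $R_i=x_i^-\text{ - }y_i^-\text{ - }P_i\text{ - }y_i^+\text{ - }x_i^+$; for $i\in I$, $R_i$ goes $x_i^-,y_i^-$, along $P_i$ to $v_i^-$, $z_i^-$, along $Q_i$ to $z_i^+$, $v_i^+$, along $P_i$ to $y_i^+$, $x_i^+$. Set $B=(B'\setminus\{x_1,\dots,x_k\})\cup\bigcup_iR_i$; $(T,B)$ is an expansion of $(T',B')$. The territories $(T_m,B_m)$: $T_0=B_0$ is a $t$-cycle;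 for $m\ge1$, with $N=t(t-3)^{m-1}$ and $B_{m-1}=x_1\text{ - }\cdots\text{ - }x_N\text{ - }x_1$, $T_m$ is obtained from $T_{m-1}$ by adding a new cycle $B_m$, the $(t-4)$-subdivision of an $N$-cycle $x_1'\text{ - }\cdots\text{ - }x_N'\text{ - }x_1'$ (each edge replaced by a path of length $t-3$), and the edges $x_ix_i'$. A territory $(T,B)$ is canonical if for some $m\ge0$ there is an expansion $(T',B')$ of $(T_m,B_m)$ and an isomorphism $T\to T'$ mapping $B$ isomorphically onto $B'$. Construction. Let $g=t^{5t}$ and let $\Gamma$ be a $3$-regular graph of girth at least $g$ with a Hamiltonian cycle $\Omega$. Let $(M_1,M_2)$ be a partition of $E(\Omega)$ into two perfect matchings of $\Gamma$ and $M_3=E(\Gamma)\setminus E(\Omega)$. For $i\in\{1,2,3\}$ let $\mathcal{K}_i$ be the set of components (cycles) of the spanning subgraph of $\Gamma$ with edge set $E(\Gamma)\setminus M_i$, and $\mathcal{K}=\mathcal{K}_1\cup\mathcal{K}_2\cup\mathcal{K}_3$. For each $K\in\mathcal{K}$ let $T_K$ be a graph such that $(T_K,K)$ is a canonical territory (of perimeter equal to the length of $K$), with $V(T_K)\cap V(\Gamma)=V(K)$, and such that $V(T_K)\cap V(T_{K'})=V(K)\cap V(K')$ for all distinct $K,K'\in\mathcal{K}$. Define $G_t=\Gamma\cup\bigcup_{K\in\mathcal{K}}T_K$ (union of vertex sets and of edge sets). -}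

module Defs where

open import Data.Nat using (ℕ; zero; suc; _+_; _*_; _∸_; _^_; _≤_; _<_)
open import Data.Bool using (Bool; true; false)
open import Data.Fin using (Fin; toℕ)
open import Data.Product using (Σ; _×_; _,_)
open import Data.Sum using (_⊎_)
open import Data.Empty using (⊥)
open import Data.Unit using (⊤)
open import Relation.Nullary using (¬_)
open import Relation.Binary.PropositionalEquality using (_≡_; _≢_)
open import Function.Bundles using (_↔_; Inverse)
open import Relation.Binary.Construct.Closure.ReflexiveTransitive using (Star)

Iff : Set → Set → Set
Iff A B = (A → B) × (B → A)

Inj : {A B : Set} → (A → B) → Set
Inj f = ∀ {a b} → f a ≡ f b → a ≡ b

Sym : {V : Set} → (V → V → Set) → V → V → Set
Sym R x y = R x y ⊎ R y x

CycArc : ℕ → ℕ → ℕ → Set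
CycArc L p q = suc p ≡ q ⊎ (suc p ≡ L × q ≡ 0)

CycAdjF : (k : ℕ) → Fin k → Fin k → Set
CycAdjF k = Sym (λ a b → CycArc k (toℕ a) (toℕ b))

-- The territories (T_m , B_m).
-- Layer ℓ (0 ≤ ℓ ≤ m) is the cycle B_ℓ of length t(t-3)^ℓ, positions 0..L-1
-- in cyclic order.  Position i of layer ℓ is joined to position i(t-3) of
-- layer ℓ+1 (the branch vertex x_i' of the (t-4)-subdivision).

Lsz : ℕ → ℕ → ℕ
Lsz t ℓ = t * (t ∸ 3) ^ ℓ

record TmV (t m : ℕ) : Set where
  constructor tv
  field
    lay   : ℕ
    .lay≤ : lay ≤ m
    pos   : ℕ
    .pos< : pos < Lsz t lay
open TmV public

TmArc : (t m : ℕ) → TmV t m → TmV t m → Set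
TmArc t m u w =
  (lay u ≡ lay w × CycArc (Lsz t (lay u)) (pos u) (pos w))
  ⊎ (suc (lay u) ≡ lay w × pos w ≡ pos u * (t ∸ 3))

TmAdj : (t m : ℕ) → TmV t m → TmV t m → Set
TmAdj t m = Sym (TmArc t m)

TmB : (t m : ℕ) → TmV t m → Set
TmB t m u = lay u ≡ m

-- Expansions of (T_m , B_m) w.r.t. t.
-- S = the stable set {x_i} of B_m (given by positions), J ⊆ S = the set I.
-- For p ∈ S: path P_p with vertices (pv p a), 0 ≤ a ≤ 2t-6, y⁻ = a=0,
--   y = a=t-3, y⁺ = a=2t-6, v⁻ = a=t-4, v⁺ = a=t-2.
-- For p ∈ J: path Q_p with vertices (qv p b), 0 ≤ b ≤ t-4, z⁻ = b=0, z⁺ = b=t-4.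
-- x⁻ = position p-1, x⁺ = position p+1 (cyclically) on B_m.

data ExpV (t m : ℕ) (S J : ℕ → Bool) : Set where
  old : TmV t m → ExpV t m S J
  pv  : (p : ℕ) → .(p < Lsz t m) → .(S p ≡ true) → (a : ℕ) → .(a ≤ 2 * t ∸ 6) → ExpV t m S J
  qv  : (p : ℕ) → .(p < Lsz t m) → .(J p ≡ true) → (b : ℕ) → .(b ≤ t ∸ 4) → ExpV t m S J

ExpArc : (t m : ℕ) (S J : ℕ → Bool) → ExpV t m S J → ExpV t m S J → Set
ExpArc t m S J (old u) (old w) = TmArc t m u w
ExpArc t m S J (old u) (pv p _ _ a _) =
  lay u ≡ m × ((CycArc (Lsz t m) (pos u) p × a ≡ 0) ⊎ (pos u ≡ p × a ≡ t ∸ 3))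
ExpArc t m S J (pv p _ _ a _) (old u) =
  lay u ≡ m × CycArc (Lsz t m) p (pos u) × a ≡ 2 * t ∸ 6
ExpArc t m S J (pv p _ _ a _) (pv p' _ _ a' _) = p ≡ p' × suc a ≡ a'
ExpArc t m S J (pv p _ _ a _) (qv p' _ _ b _) =
  p ≡ p' × ((a ≡ t ∸ 4 × b ≡ 0) ⊎ (a ≡ t ∸ 2 × b ≡ t ∸ 4))
ExpArc t m S J (qv p _ _ b _) (qv p' _ _ b' _) = p ≡ p' × suc b ≡ b'
ExpArc t m S J _ _ = ⊥

ExpAdj : (t m : ℕ) (S J : ℕ → Bool) → ExpV t m S J → ExpV t m S J → Set
ExpAdj t m S J = Sym (ExpArc t m S J)

-- the new perimeter cycle B = (B_m \ S) ∪ ⋃ R_p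
ExpB : (t m : ℕ) (S J : ℕ → Bool) → ExpV t m S J → Set
ExpB t m S J (old u) = lay u ≡ m × S (pos u) ≡ false
ExpB t m S J (pv p _ _ a _) = ¬ (J p ≡ true × a ≡ t ∸ 3)
ExpB t m S J (qv _ _ _ _ _) = ⊤

ValidExp : (t m : ℕ) (S J : ℕ → Bool) → Set
ValidExp t m S J =
  (∀ p q → p < Lsz t m → q < Lsz t m → CycArc (Lsz t m) p q →
     S p ≡ true → S q ≡ true → ⊥)
  × (∀ p → J p ≡ true → S p ≡ true)

Canonical : (t k : ℕ) → (Fin k → Fin k → Set) → (Fin k → Set) → Set
Canonical t k E B =
  Σ ℕ λ m → Σ (ℕ → Bool) λ S → Σ (ℕ → Bool) λ J →
    ValidExp t m S J ×
    Σ (Fin k ↔ ExpV t m S J) λ φ →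
      (∀ a b → Iff (E a b) (ExpAdj t m S J (Inverse.to φ a) (Inverse.to φ b)))
      × (∀ a → Iff (B a) (ExpB t m S J (Inverse.to φ a)))

ThreeNbrs : {n : ℕ} → (Fin n → Fin n → Set) → Fin n → Set
ThreeNbrs {n} A v = Σ (Fin n) λ a → Σ (Fin n) λ b → Σ (Fin n) λ c →
  a ≢ b × a ≢ c × b ≢ c × A v a × A v b × A v c ×
  (∀ w → A v w → w ≡ a ⊎ w ≡ b ⊎ w ≡ c)

HasCycle : {n : ℕ} → (Fin n → Fin n → Set) → ℕ → Set
HasCycle {n} A k = Σ (Fin k → Fin n) λ f → Inj f × (∀ i j → CycAdjF k i j → A (f i) (f j))

PerfectMatching : {n : ℕ} → (Fin n → Fin n → Set) → (Fin n → Fin n → Set) → Set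
PerfectMatching {n} A M =
  (∀ u v → M u v → A u v) × (∀ u v → M u v → M v u) ×
  (∀ u → Σ (Fin n) λ w → M u w × (∀ w' → M u w' → w' ≡ w))

ΩE : (n : ℕ) → (Fin n → Fin n) → Fin n → Fin n → Set
ΩE n h u v = Σ (Fin n) λ i → Σ (Fin n) λ j → h i ≡ u × h j ≡ v × CycAdjF n i j

Mrel : (n : ℕ) → (Fin n → Fin n → Set) → (Fin n → Fin n) →
       (Fin n → Fin n → Set) → (Fin n → Fin n → Set) → Fin 3 → Fin n → Fin n → Set
Mrel n A h M₁ M₂ Fin.zero = M₁
Mrel n A h M₁ M₂ (Fin.suc Fin.zero) = M₂
Mrel n A h M₁ M₂ (Fin.suc (Fin.suc Fin.zero)) = λ u v → A u v × ¬ ΩE n h u v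

Sub : (n : ℕ) → (Fin n → Fin n → Set) → (Fin n → Fin n) →
      (Fin n → Fin n → Set) → (Fin n → Fin n → Set) → Fin 3 → Fin n → Fin n → Set
Sub n A h M₁ M₂ i u v = A u v × ¬ Mrel n A h M₁ M₂ i u v

-- The construction of G_t, all vertices living in an ambient type U.
-- 𝒦_i is given by a labelling comp i : V(Γ) → Fin (c i) of the components
-- of Γ − M_i; the member K = (i , j) of 𝒦 has vertex set {v | comp i v ≡ j}.
-- T_K = T i j has vertex set Fin (s i j), edges E i j, embedded in U by e i j.

record Construction (t : ℕ) (U : Set) : Set₁ where
  field
    n      : ℕ
    A      : Fin n → Fin n → Set
    A-sym  : ∀ u v → A u v → A v u
    A-irr  : ∀ u → ¬ A u u
    cubic  : ∀ v → ThreeNbrs A v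
    girth  : ∀ k → 3 ≤ k → k < t ^ (5 * t) → ¬ HasCycle A k
    n≥3    : 3 ≤ n
    h      : Fin n → Fin n
    h-inj  : Inj h
    h-cyc  : ∀ i j → CycAdjF n i j → A (h i) (h j)
    M₁ M₂  : Fin n → Fin n → Set
    M₁-pm  : PerfectMatching A M₁
    M₂-pm  : PerfectMatching A M₂
    M-cover : ∀ u v → Iff (ΩE n h u v) (M₁ u v ⊎ M₂ u v)
    M-disj : ∀ u v → M₁ u v → M₂ u v → ⊥
    c         : Fin 3 → ℕ
    comp      : (i : Fin 3) → Fin n → Fin (c i)
    comp-surj : ∀ i j → Σ (Fin n) λ v → comp i v ≡ j
    comp-conn : ∀ i u v → Iff (comp i u ≡ comp i v) (Star (Sub n A h M₁ M₂ i) u v)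
    ι      : Fin n → U
    ι-inj  : Inj ι
    s      : (i : Fin 3) → Fin (c i) → ℕ
    E      : (i : Fin 3) (j : Fin (c i)) → Fin (s i j) → Fin (s i j) → Set
    e      : (i : Fin 3) (j : Fin (c i)) → Fin (s i j) → U
    e-inj  : ∀ i j → Inj (e i j)
    TΓ₁    : ∀ i j a v → e i j a ≡ ι v → comp i v ≡ j
    TΓ₂    : ∀ i j v → comp i v ≡ j → Σ (Fin (s i j)) λ a → e i j a ≡ ι v
    T-ind  : ∀ i j a b v w → e i j a ≡ ι v → e i j b ≡ ι w →
             Iff (E i j a b) (Sub n A h M₁ M₂ i v w)
    T-disj₁ : ∀ i i' j j' a a' → i ≢ i' → e i j a ≡ e i' j' a' →
              Σ (Fin n) λ v → ι v ≡ e i j a × comp i v ≡ j × comp i' v ≡ j'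
    T-disj₂ : ∀ i j j' a a' → j ≢ j' → e i j a ≡ e i j' a' →
              Σ (Fin n) λ v → ι v ≡ e i j a × comp i v ≡ j × comp i v ≡ j'
    T-can  : ∀ i j → Canonical t (s i j) (E i j)
                       (λ a → Σ (Fin n) λ v → e i j a ≡ ι v × comp i v ≡ j)

module _ {t : ℕ} {U : Set} (C : Construction t U) where
  open Construction C

  GV : U → Set
  GV x = (Σ (Fin n) λ v → ι v ≡ x)
         ⊎ (Σ (Fin 3) λ i → Σ (Fin (c i)) λ j → Σ (Fin (s i j)) λ a → e i j a ≡ x)

  GE : U → U → Set
  GE x y = (Σ (Fin n) λ v → Σ (Fin n) λ w → ι v ≡ x × ι w ≡ y × A v w)
           ⊎ (Σ (Fin 3) λ i → Σ (Fin (c i)) λ j → Σ (Fin (s i j)) λ a →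
               Σ (Fin (s i j)) λ b → e i j a ≡ x × e i j b ≡ y × E i j a b)

InducedCycleFree : {U : Set} → ℕ → (U → Set) → (U → U → Set) → Set
InducedCycleFree {U} k V E =
  ¬ (Σ (Fin k → U) λ f → Inj f × (∀ a → V (f a)) ×
       (∀ a b → Iff (E (f a) (f b)) (CycAdjF k a b)))

{-# OPTIONS --safe #-}
module Submission where

-- Every territory is a disc tiled by t-gons.  Reading a cycle of a territory from its outermost layer inwards, the
-- paths of degree-2 vertices force it to run around whole tiles; a cycle around one tile has length t, and one of
-- length 2t - 2 would run around two tiles sharing an edge, which is then a chord.
--
-- Γ is 3-edge-coloured by M₁, M₂, M₃, so walks in Γ are words in three letters and the members of 𝒦 carry the words
-- in two letters.  A cycle of G_t of length 2t - 2 splits into runs, each inside one T_K and with ends on K.  Since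
-- distances grow only by a bounded factor from T_K to K, the product of the words of the runs is shorter than the
-- girth, hence it must cancel completely.  Two members of 𝒦 share at most an edge around a vertex, so neighbouring
-- runs cancel at most one letter, and complete cancellation needs runs whose word has just two letters, both of
-- which cancel.  Such a run has length at least t - 2 because T_K has girth t, and three of them are needed.

open import Defs
open import Data.Bool using (Bool; true; false)
open import Data.Bool.Properties using () renaming (_≟_ to _≟ᵇ_)
open import Data.Empty using (⊥; ⊥-elim)
open import Data.Fin using (Fin; toℕ; fromℕ<)
open import Data.Fin.Patterns using (0F; 1F; 2F)
open import Data.Fin.Properties using (toℕ-injective; toℕ-fromℕ<; toℕ<n) renaming (_≟_ to _≟F_)
open import Data.List using (List; []; _∷_; length; _++_)
open import Data.List.Properties using (length-++)
open import Data.List.Relation.Unary.All using (All; []; _∷_)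
open import Data.List.Relation.Unary.Linked as Linked using (Linked; []; [-]; _∷_)
open import Data.Nat
open import Data.Nat.Properties
open import Data.Nat.Divisibility using (_∣_; n∣m*n)
open import Data.Nat.DivMod
open import Data.Nat.Induction using (<-rec)
open import Data.Nat.Tactic.RingSolver using (solve-∀)
open import Data.Product using (Σ; ∃; _×_; _,_; proj₁; proj₂)
open import Data.Sum using (_⊎_; inj₁; inj₂; [_,_]′)
open import Data.Unit using (⊤; tt)
open import Function.Bundles using (_↔_; Inverse)
open import Relation.Binary.Construct.Closure.ReflexiveTransitive using (ε; _◅_)
open import Relation.Binary.Definitions using (Tri; tri<; tri≈; tri>)
open import Relation.Binary.PropositionalEquality hiding (J)
open import Relation.Nullary using (¬_; Dec; yes; no)
open import Relation.Nullary.Decidable using (recompute; decidable-stable; ¬?; _×-dec_)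

-- Residues

-- An edge of Γ lies in two members of `𝒦`, so the splitting into runs involves a choice. A label
-- `i` stands for `𝒦` with index `i`, whose cycles miss the colour `i`. The choice made in `Labels`
-- puts every one-edge run of colour `c` between two runs labelled `c`, whose words avoid `c`. Hence
-- one-letter words never cancel, and total cancellation has to come from longer runs. Territories
-- can have arbitrarily many layers, and each layer inwards shortens the way round by the factor t -
-- 3. The comparison of distances still depends on t only: a path of s edges that starts on the
-- perimeter reaches depth at most s, and s is at most the length of the cycle. The girth
-- `t ^ (5 * t)` absorbs the resulting power of t - 3. Cycles shorter than t are excluded together
-- with those of length 2t - 2, since the girth of a territory is what makes the cancelling runs
-- long. Throughout, t is `5 + r`, a cycle has length `3 + κ`, and it is a periodic function on ℕ,
-- so that no index has to wrap around.

≤-by : ∀ {m n} d → m + d ≡ n → m ≤ n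
≤-by {m} d eq = subst (m ≤_) eq (m≤m+n m d)

module Residues (L : ℕ) .{{_ : NonZero L}} where

  suc-% : ∀ x → suc x % L ≡ suc (x % L) % L
  suc-% x = trans (cong (λ y → suc y % L) (m≡m%n+[m/n]*n x L))
                  ([m+kn]%n≡m%n (suc (x % L)) (x / L) L)

  arc-% : ∀ x → CycArc L (x % L) (suc x % L)
  arc-% x with suc (x % L) <? L
  ... | yes lt = inj₁ (sym (trans (suc-% x) (m<n⇒m%n≡m lt)))
  ... | no ≥L = inj₂ (eq , trans (suc-% x) (trans (cong (_% L) eq) (n%n≡0 L)))
    where
    eq : suc (x % L) ≡ L
    eq = ≤-antisym (m%n<n x L) (≮⇒≥ ≥L)

  arc-functional : ∀ {p q q′} → q < L → q′ < L → CycArc L p q → CycArc L p q′ → q ≡ q′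
  arc-functional q< q′< (inj₁ a) (inj₁ b) = trans (sym a) b
  arc-functional q< q′< (inj₁ refl) (inj₂ (b , _)) = ⊥-elim (<⇒≢ q< b)
  arc-functional q< q′< (inj₂ (b , _)) (inj₁ refl) = ⊥-elim (<⇒≢ q′< b)
  arc-functional q< q′< (inj₂ (_ , a)) (inj₂ (_ , b)) = trans a (sym b)

  arc-injective : ∀ {p p′ q} → CycArc L p q → CycArc L p′ q → p ≡ p′
  arc-injective (inj₁ a) (inj₁ b) = suc-injective (trans a (sym b))
  arc-injective (inj₁ refl) (inj₂ (_ , ()))
  arc-injective (inj₂ (_ , ())) (inj₁ refl)
  arc-injective (inj₂ (a , _)) (inj₂ (b , _)) = suc-injective (trans a (sym b))

  arc-next : ∀ {x q} → q < L → CycArc L (x % L) q → q ≡ suc x % L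
  arc-next {x} q< a = arc-functional q< (m%n<n (suc x) L) a (arc-% x)

  arc-prev : ∀ {p} x → CycArc L p (suc x % L) → p ≡ x % L
  arc-prev x a = arc-injective a (arc-% x)

  suc-%-injective : ∀ x y → suc x % L ≡ suc y % L → x % L ≡ y % L
  suc-%-injective x y eq = arc-prev y (subst (CycArc L (x % L)) eq (arc-% x))

  %-distinct : ∀ x d → 0 < d → d < L → (d + x) % L ≢ x % L
  %-distinct zero d 0<d d<L eq rewrite +-identityʳ d =
    <⇒≢ 0<d (sym (trans (sym (m<n⇒m%n≡m d<L)) (trans eq (m<n⇒m%n≡m (<-trans 0<d d<L)))))
  %-distinct (suc x) d 0<d d<L eq = %-distinct x d 0<d d<L
    (suc-%-injective (d + x) x (trans (cong (_% L) (sym (+-suc d x))) eq))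

  -- The two spare successors let the two preceding positions be written without subtraction. Two
  -- full turns are added so that taking 2 away is exact already for `L` equal to 1.
  lift : ∀ {p} → p < L → ∃ λ x → suc (suc x) % L ≡ p
  lift {p} p<L = p + (L + L ∸ 2) , trans (cong (_% L) eq)
        (trans ([m+n]%n≡m%n (p + L) L) (trans ([m+n]%n≡m%n p L) (m<n⇒m%n≡m p<L)))
    where
    1≤L : 1 ≤ L
    1≤L = <-≤-trans z<s (≤-trans (s≤s z≤n) p<L)
    eq : suc (suc (p + (L + L ∸ 2))) ≡ p + L + L
    eq = trans (sym (+-suc (suc p) _)) (trans (sym (+-suc p _)) (trans (cong (p +_)
           (m+[n∸m]≡n {2} (+-mono-≤ 1≤L 1≤L))) (sym (+-assoc p L L))))

-- Closed walks and forced paths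

-- f is a closed walk of length 3 + κ, read periodically.  With t = 5 + r the two cases
-- of `size` are length < t and length 2t - 2; chordless is only required in the second.
record Cycle (r : ℕ) {V : Set} (Adj : V → V → Set) (Ok : V → Set) (κ : ℕ) : Set where
  field
    f : ℕ → V
    per : ∀ x → f (3 + κ + x) ≡ f x
    inj : ∀ x d → 0 < d → d < 3 + κ → f (d + x) ≢ f x
    adj : ∀ x → Adj (f x) (f (suc x))
    ok : ∀ x → Ok (f x)
    size : 3 + κ < 5 + r ⊎ κ ≡ 5 + (r + r)
    chordless : κ ≡ 5 + (r + r) → ∀ x d → 2 ≤ d → d + 2 ≤ 3 + κ → ¬ Adj (f x) (f (d + x))

-- The inner vertices of `u` have degree 2 among the `Ok` vertices. Shrinking `Ok` as outer parts
-- are eliminated makes further paths forced.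
Forced : {V : Set} (Adj : V → V → Set) (Ok : V → Set) → (ℕ → V) → ℕ → Set
Forced Adj Ok u q = ∀ j → 2 + j ≤ q → ∀ z → Ok z → Adj (u (suc j)) z → z ≡ u j ⊎ z ≡ u (2 + j)

module CycleOps (r : ℕ) {V : Set} (Adj : V → V → Set) (Adj-sym : ∀ x y → Adj x y → Adj y x)
                (Ok : V → Set) (κ : ℕ) where
  open Cycle

  Cyc : Set
  Cyc = Cycle r Adj Ok κ

  rotate : ℕ → Cyc → Cyc
  rotate y c = record
    { f = λ x → f c (x + y)
    ; per = λ x → trans (cong (f c) (+-assoc (3 + κ) x y)) (per c (x + y))
    ; inj = λ x d 0<d d<k eq → inj c (x + y) d 0<d d<k (trans (cong (f c) (sym (+-assoc d x y))) eq)
    ; adj = λ x → adj c (x + y)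
    ; ok = λ x → ok c (x + y)
    ; size = size c
    ; chordless = λ e x d 2≤d d≤ a → chordless c e (x + y) d 2≤d d≤
                    (subst (Adj _) (cong (f c) (+-assoc d x y)) a)
    }

  per* : (c : Cyc) → ∀ n x → f c (n * (3 + κ) + x) ≡ f c x
  per* c zero x = refl
  per* c (suc n) x = trans (cong (f c) (+-assoc (3 + κ) (n * (3 + κ)) x)) (trans (per c _) (per* c n x))

  -- The multiplier `2 + κ` is -1 modulo the length, so reading `f` at its multiples reverses the
  -- direction without subtraction.
  reverse : Cyc → Cyc
  reverse c = record
    { f = g
    ; per = λ x → trans (cong (f c) (trans (*-distribʳ-+ (2 + κ) (3 + κ) x)
                    (cong (_+ x * (2 + κ)) (*-comm (3 + κ) (2 + κ))))) (per* c (2 + κ) (x * (2 + κ)))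
    ; inj = λ x d 0<d d<k eq → inj c ((d + x) * (2 + κ)) d 0<d d<k (trans (shift d x) (sym eq))
    ; adj = λ x → Adj-sym _ _ (subst (Adj (g (suc x))) (per c (x * (2 + κ))) (adj c _))
    ; ok = λ x → ok c _
    ; size = size c
    ; chordless = λ e x d 2≤d d≤ a → chordless c e ((d + x) * (2 + κ)) d 2≤d d≤
                    (subst (Adj _) (sym (shift d x)) (Adj-sym _ _ a))
    }
    where
    g : ℕ → V
    g x = f c (x * (2 + κ))
    shift : ∀ d x → f c (d + (d + x) * (2 + κ)) ≡ g x
    shift d x = trans (cong (f c) (solve d x κ)) (per* c d (x * (2 + κ)))
      where
      solve : ∀ d x κ → d + (d + x) * (2 + κ) ≡ d * (3 + κ) + x * (2 + κ)
      solve = solve-∀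

  module _ (c : Cyc) where

    -- the index before x, read modulo the length
    before : ℕ → ℕ
    before x = 2 + κ + x

    before-adj : ∀ x → Adj (f c x) (f c (before x))
    before-adj x = Adj-sym _ _ (subst (Adj (f c (before x))) (per c x) (adj c (before x)))

    after : ∀ x {v} → f c x ≡ v → Adj v (f c (suc x))
    after x refl = adj c x

    before-to : ∀ x {v} → f c x ≡ v → Adj v (f c (before x))
    before-to x refl = before-adj x

    chord₀ : κ ≡ 5 + (r + r) → ∀ d → 2 ≤ d → d + 2 ≤ 3 + κ → ¬ Adj (f c 0) (f c d)
    chord₀ e d 2≤d d≤ ad = chordless c e 0 d 2≤d d≤ (subst (λ n → Adj (f c 0) (f c n)) (sym (+-identityʳ d)) ad)

    skip≢ : ∀ x → f c (2 + x) ≢ f c x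
    skip≢ x = inj c x 2 (s≤s z≤n) (s≤s (s≤s (s≤s z≤n)))

    before≢after : ∀ x → f c (before x) ≢ f c (suc x)
    before≢after x eq = skip≢ (before x) (trans (trans (cong (λ n → f c (suc n)) (sym (+-suc (2 + κ) x)))
                          (per c (suc x))) (sym eq))

  module _ {u : ℕ → V} {q : ℕ} (forced : Forced Adj Ok u q) where

    -- A cycle never returns after two steps, so at each inner vertex only the neighbour ahead
    -- remains.
    follow : (c : Cyc) → ∀ x → f c x ≡ u 0 → f c (suc x) ≡ u 1 → ∀ i → i ≤ q → f c (i + x) ≡ u i
    follow c x e₀ e₁ zero _ = e₀
    follow c x e₀ e₁ (suc zero) _ = e₁
    follow c x e₀ e₁ (suc (suc i)) le
      with forced i le _ (ok c (2 + i + x))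
             (after c (suc i + x) (follow c x e₀ e₁ (suc i) (≤-trans (n≤1+n _) le)))
    ... | inj₂ e = e
    ... | inj₁ e = ⊥-elim (skip≢ c (i + x) (trans e
                     (sym (follow c x e₀ e₁ i (≤-trans (m≤n+m i 2) le)))))

    -- The index `y` plays the role of `x` minus `j`; the last component records this up to the
    -- period.
    retreat : (c : Cyc) → ∀ j → suc j ≤ q → ∀ x → f c x ≡ u j → f c (suc x) ≡ u (suc j) →
              ∃ λ y → f c y ≡ u 0 × f c (suc y) ≡ u 1 × (∀ n → f c (n + j + y) ≡ f c (n + x))
    retreat c zero le x e₀ e₁ = x , e₀ , e₁ , λ n → cong (λ n → f c (n + x)) (+-identityʳ n)
    retreat c (suc j) le x e₀ e₁
      with forced j le _ (ok c (before c x)) (before-to c x e₀)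
    ... | inj₂ e = ⊥-elim (before≢after c x (trans e (sym e₁)))
    ... | inj₁ e with retreat c j (≤-trans (n≤1+n _) le) (before c x) e (trans (per c x) e₀)
    ...   | y , e₀′ , e₁′ , back = y , e₀′ , e₁′ , λ n →
            trans (cong (λ n → f c (n + y)) (+-suc n j))
            (trans (back (suc n)) (trans (cong (f c) (shift n κ x)) (per c (n + x))))
      where
      shift : ∀ n κ x → suc n + (2 + κ + x) ≡ 3 + κ + (n + x)
      shift = solve-∀

    traverse : (c : Cyc) → ∀ j → suc j ≤ q → ∀ x → f c x ≡ u j → f c (suc x) ≡ u (suc j) →
               Σ Cyc λ c′ → (∀ i → i ≤ q → f c′ i ≡ u i) × (∀ n → f c′ (n + j) ≡ f c (n + x))
    traverse c j le x e₀ e₁ with retreat c j le x e₀ e₁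
    ... | y , e₀′ , e₁′ , back = rotate y c , (λ i le′ → follow c y e₀′ e₁′ i le′) , back

    private
      forget : {P Q : Cyc → Set} → (Σ Cyc λ c′ → P c′ × Q c′) → Σ Cyc P
      forget (c′ , p , _) = c′ , p

    -- Both cycle neighbours of an inner vertex are its neighbours on the path, so the cycle runs
    -- along the path in one of the two directions; `reverse` handles the second.
    ear : (c : Cyc) → ∀ j → 2 + j ≤ q → ∀ x → f c x ≡ u (suc j) →
          Σ Cyc λ c′ → ∀ i → i ≤ q → f c′ i ≡ u i
    ear c j le x e with next | prev
      where
      next = forced j le _ (ok c (suc x)) (after c x e)
      prev = forced j le _ (ok c (before c x)) (before-to c x e)
    ... | inj₂ e₁ | _ = forget (traverse c (suc j) le x e e₁)
    ... | inj₁ e₁ | inj₁ e₂ = ⊥-elim (before≢after c x (trans e₂ (sym e₁)))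
    ... | inj₁ e₁ | inj₂ e₂ = forget (traverse (reverse (rotate x c)) (suc j) le 0 e
          (trans (cong (λ n → f c (n + x)) (+-identityʳ (2 + κ))) e₂))

-- The layers of T_m

module Layers (r m : ℕ) where
  open Cycle

  t τ : ℕ
  t = 5 + r
  τ = 2 + r

  τ^-pos : ∀ ℓ → 1 ≤ τ ^ ℓ
  τ^-pos zero = ≤-refl
  τ^-pos (suc ℓ) = *-mono-≤ {1} {τ} (s≤s z≤n) (τ^-pos ℓ)

  L : ℕ → ℕ
  L ℓ = Lsz t ℓ

  t≤L : ∀ ℓ → t ≤ L ℓ
  t≤L ℓ = subst (_≤ L ℓ) (*-identityʳ t) (*-monoʳ-≤ t (τ^-pos ℓ))

  5≤L : ∀ ℓ → 5 ≤ L ℓ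
  5≤L ℓ = ≤-trans (m≤m+n 5 r) (t≤L ℓ)

  L-suc : ∀ ℓ → L ℓ * τ ≡ L (suc ℓ)
  L-suc ℓ = solve t (τ ^ ℓ) τ
    where
    solve : ∀ t x τ → t * x * τ ≡ t * (τ * x)
    solve = solve-∀

  5τ≤L : ∀ ℓ → 5 * τ ≤ L (suc ℓ)
  5τ≤L ℓ = subst (5 * τ ≤_) (L-suc ℓ) (*-monoˡ-≤ τ (5≤L ℓ))

  nzL : ∀ ℓ → NonZero (L ℓ)
  nzL ℓ = >-nonZero (≤-trans (s≤s z≤n) (5≤L ℓ))

  module R (ℓ : ℕ) = Residues (L ℓ) {{nzL ℓ}}

  md : ℕ → ℕ → ℕ
  md ℓ x = _%_ x (L ℓ) {{nzL ℓ}}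

  md< : ∀ ℓ x → md ℓ x < L ℓ
  md< ℓ x = m%n<n x (L ℓ) {{nzL ℓ}}

  V : Set
  V = TmV t m

  Adj : V → V → Set
  Adj = TmAdj t m

  at : (ℓ : ℕ) → .(ℓ ≤ m) → ℕ → V
  at ℓ ℓ≤ x = tv ℓ ℓ≤ (md ℓ x) (md< ℓ x)

  tv-≡ : ∀ {ℓ p q} .{a : ℓ ≤ m} .{b : p < L ℓ} .{c : q < L ℓ} → p ≡ q → _≡_ {A = V} (tv ℓ a p b) (tv ℓ a q c)
  tv-≡ refl = refl

  pos<′ : (z : V) → pos z < L (lay z)
  pos<′ (tv ℓ _ p p<) = recompute (p <? L ℓ) p<

  locate : (z : V) → ∃ λ x → .(ℓ≤ : lay z ≤ m) → z ≡ at (lay z) ℓ≤ (2 + x)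
  locate (tv ℓ ℓ≤′ p p<) with R.lift ℓ (recompute (p <? L ℓ) p<)
  ... | x , e = x , λ ℓ≤ → tv-≡ (sym e)

  module Layer (ℓ : ℕ) .(ℓ≤ : ℓ ≤ m) where

    vx : ℕ → V
    vx = at ℓ ℓ≤

    vx-lift : (z : V) → lay z ≡ ℓ → ∃ λ x → z ≡ vx (2 + x)
    vx-lift z refl = proj₁ (locate z) , proj₂ (locate z) ℓ≤

    distinct : ∀ x d → 0 < d → d < L ℓ → vx (d + x) ≢ vx x
    distinct x d 0<d d<L e = R.%-distinct ℓ x d 0<d d<L (cong pos e)

    distinct′ : ∀ {x y} d → 0 < d → d < L ℓ → d + x ≡ y → vx y ≢ vx x
    distinct′ {x} d 0<d d<L refl = distinct x d 0<d d<L

    step : ∀ x → Adj (vx x) (vx (suc x))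
    step x = inj₁ (inj₁ (refl , R.arc-% ℓ x))

    data Neighbour (x : ℕ) (z : V) : Set where
      prev : z ≡ vx x → Neighbour x z
      next : z ≡ vx (2 + x) → Neighbour x z
      child : lay z ≡ suc ℓ → pos z ≡ md ℓ (suc x) * τ → Neighbour x z
      parent : suc (lay z) ≡ ℓ → md ℓ (suc x) ≡ pos z * τ → Neighbour x z

    neighbour : ∀ x z → Adj (vx (suc x)) z → Neighbour x z
    neighbour x z (inj₁ (inj₁ (refl , a))) = next (tv-≡ (R.arc-next ℓ {suc x} (pos<′ z) a))
    neighbour x _ (inj₁ (inj₂ (e , e′))) = child (sym e) e′
    neighbour x _ (inj₂ (inj₁ (refl , a))) = prev (tv-≡ (R.arc-prev ℓ x a))
    neighbour x _ (inj₂ (inj₂ (e , e′))) = parent e e′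

  Adj-sym : ∀ x y → Adj x y → Adj y x
  Adj-sym _ _ (inj₁ a) = inj₂ a
  Adj-sym _ _ (inj₂ a) = inj₁ a

  Below : ℕ → V → Set
  Below M z = lay z ≤ M

  module Zero where
    open Layer 0 z≤n

    forced : ∀ x q → Forced Adj (Below 0) (λ j → vx (j + x)) q
    forced x q j _ z z≤ a with neighbour (j + x) z a
    ... | prev e = inj₁ e
    ... | next e = inj₂ e
    ... | parent () _
    ... | child e _ = ⊥-elim (<⇒≱ (s≤s z≤n) (subst (_≤ 0) e z≤))

    -- Inside a t-cycle a walk without backtracking returns after exactly t steps: a length below t
    -- is too short, and length 2t - 2 would repeat a vertex at index t.
    impossible : ∀ {κ} → Cycle r Adj (Below 0) κ → ⊥
    impossible {κ} c = contra (size c)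
      where
      open CycleOps r Adj Adj-sym (Below 0) κ
      start = vx-lift (f c 0) (n≤0⇒n≡0 (ok c 0))
      x : ℕ
      x = suc (proj₁ start)
      u : ℕ → V
      u j = vx (j + x)
      c∃ = ear (forced x 2) c 0 ≤-refl 0 (proj₂ start)
      c′ = proj₁ c∃
      on : ∀ i → f c′ i ≡ u i
      on i = trans (cong (f c′) (sym (+-identityʳ i)))
               (follow {u} {i} (forced x i) c′ 0 (proj₂ c∃ 0 z≤n) (proj₂ c∃ 1 (s≤s z≤n)) i ≤-refl)
      L0 : L 0 ≡ 5 + r
      L0 = *-identityʳ (5 + r)
      contra : 3 + κ < 5 + r ⊎ κ ≡ 5 + (r + r) → ⊥
      contra (inj₁ k<t) = distinct x (3 + κ) (s≤s z≤n) (subst (3 + κ <_) (sym L0) k<t)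
        (trans (sym (on (3 + κ))) (trans (cong (f c′) (sym (+-identityʳ (3 + κ)))) (trans (per c′ 0) (on 0))))
      contra (inj₂ refl) = inj c′ 0 (5 + r) (s≤s z≤n) (≤-by (2 + r) (solve r))
        (trans (cong (f c′) (+-identityʳ (5 + r))) (trans (on (5 + r)) (trans (tv-≡ turn) (sym (on 0)))))
        where
        solve : ∀ r → suc (5 + r) + (2 + r) ≡ 3 + (5 + (r + r))
        solve = solve-∀
        turn : md 0 (5 + r + x) ≡ md 0 x
        turn = trans (cong (md 0) (trans (+-comm (5 + r) x) (cong (x +_) (sym L0))))
                     ([m+n]%n≡m%n x (L 0) {{nzL 0}})

-- Cycles that meet the outermost layer

module OuterLayer (r m M : ℕ) .(M≤ : suc M ≤ m) where
  open Cycle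
  open Layers r m
  module A = Layer (suc M) M≤
  module B = Layer M (≤-trans (n≤1+n M) M≤)

  a b : ℕ → V
  a = A.vx
  b = B.vx

  branch-md : ∀ i → md (suc M) (i * τ) ≡ md M i * τ
  branch-md i = sym (trans (m%n*o≡m*o%[n*o] i (L M) τ {{nzL M}} {{nz}}) (lem (L-suc M) {{nz}} {{nzL (suc M)}}))
    where
    nz : NonZero (L M * τ)
    nz = subst NonZero (sym (L-suc M)) (nzL (suc M))
    lem : ∀ {p q} → p ≡ q → .{{_ : NonZero p}} .{{_ : NonZero q}} → i * τ % p ≡ i * τ % q
    lem refl = refl

  at-branch : ∀ z i → lay z ≡ suc M → pos z ≡ md M i * τ → z ≡ a (i * τ)
  at-branch (tv _ _ p _) i refl e = tv-≡ (trans e (sym (branch-md i)))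

  parent-of-branch : ∀ z i → suc (lay z) ≡ suc M → md (suc M) (i * τ) ≡ pos z * τ → z ≡ b i
  parent-of-branch (tv _ _ p _) i refl e = tv-≡ (*-cancelʳ-≡ p (md M i) τ (trans (sym e) (branch-md i)))

  -- Since `τ` divides the length of the layer, reduction modulo that length keeps the residue
  -- modulo `τ`; branch vertices have residue 0.
  no-parent : ∀ j i p → 0 < j → j < τ → md (suc M) (j + i * τ) ≡ p * τ → ⊥
  no-parent j i p 0<j j<τ e = <⇒≢ 0<j (sym (begin
    j                            ≡⟨ m<n⇒m%n≡m j<τ ⟨
    j % τ                        ≡⟨ [m+kn]%n≡m%n j i τ ⟨
    (j + i * τ) % τ              ≡⟨ m∣n⇒o%n%m≡o%m τ (L (suc M)) (j + i * τ) {{_}} {{nzL (suc M)}} (subst (τ ∣_) (L-suc M) (n∣m*n (L M))) ⟨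
    md (suc M) (j + i * τ) % τ   ≡⟨ cong (_% τ) e ⟩
    p * τ % τ                    ≡⟨ m*n%n≡0 p τ ⟩
    0                            ∎))
    where open ≡-Reasoning

  Ok : V → Set
  Ok = Below (suc M)

  not-above : ∀ z → Ok z → lay z ≢ suc (suc M)
  not-above z z≤ e = 1+n≰n (subst (_≤ suc M) e z≤)

  a≢b : ∀ {x y} → a x ≢ b y
  a≢b e = <⇒≢ (n<1+n M) (sym (cong lay e))

  nb-inner : ∀ j i → 0 < suc j → suc j < τ → ∀ z → Ok z → Adj (a (suc j + i * τ)) z →
             z ≡ a (j + i * τ) ⊎ z ≡ a (2 + (j + i * τ))
  nb-inner j i 0<j j<τ z z≤ ad with A.neighbour (j + i * τ) z ad
  ... | A.prev e = inj₁ e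
  ... | A.next e = inj₂ e
  ... | A.child e _ = ⊥-elim (not-above z z≤ e)
  ... | A.parent e e′ = ⊥-elim (no-parent (suc j) i (pos z) 0<j j<τ e′)

  nb-branch : ∀ i z → Ok z → Adj (a (suc i * τ)) z →
              z ≡ a (suc r + i * τ) ⊎ z ≡ a (suc (suc i * τ)) ⊎ z ≡ b (suc i)
  nb-branch i z z≤ ad with A.neighbour (suc r + i * τ) z ad
  ... | A.prev e = inj₁ e
  ... | A.next e = inj₂ (inj₁ e)
  ... | A.child e _ = ⊥-elim (not-above z z≤ e)
  ... | A.parent e e′ = inj₂ (inj₂ (parent-of-branch z (suc i) e e′))

  nb-lower : ∀ i z → Adj (b (suc i)) z →
             z ≡ b i ⊎ z ≡ b (2 + i) ⊎ z ≡ a (suc i * τ) ⊎ (suc (lay z) ≡ M × md M (suc i) ≡ pos z * τ)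
  nb-lower i z ad with B.neighbour i z ad
  ... | B.prev e = inj₁ e
  ... | B.next e = inj₂ (inj₁ e)
  ... | B.child e e′ = inj₂ (inj₂ (inj₁ (at-branch z (suc i) e e′)))
  ... | B.parent e e′ = inj₂ (inj₂ (inj₂ (e , e′)))

  lower-a : ∀ i x → Adj (b (suc i)) (a x) → a x ≡ a (suc i * τ)
  lower-a i x ad with nb-lower i (a x) ad
  ... | inj₁ e = ⊥-elim (a≢b e)
  ... | inj₂ (inj₁ e) = ⊥-elim (a≢b e)
  ... | inj₂ (inj₂ (inj₁ e)) = e
  ... | inj₂ (inj₂ (inj₂ (e , _))) = ⊥-elim (<⇒≢ (≤-trans (n<1+n M) (n≤1+n _)) (sym e))

  interval : ℕ → ℕ → V
  interval i j = a (j + i * τ)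

  forced : ∀ i → Forced Adj Ok (interval i) τ
  forced i j le z z≤ ad = nb-inner j i (s≤s z≤n) le z z≤ ad

  τ<L : ∀ d → d ≤ 5 * τ → ∀ {e} → e < d → e < L (suc M)
  τ<L d d≤ e<d = <-≤-trans e<d (≤-trans d≤ (5τ≤L M))

  -- The constant `9 + 5 * r` is `5 * τ` minus 1, and the layer has at least `5 * τ` vertices
  -- because the one below has at least 5. The slack `e` turns the inequality into a ring identity.
  a-distinct : ∀ {x y} d e → suc d + e ≡ 9 + 5 * r → suc d + x ≡ y → a y ≢ a x
  a-distinct d e le = A.distinct′ (suc d) (s≤s z≤n)
    (τ<L (5 * τ) ≤-refl (≤-by e (trans (cong suc le) (solve r))))
    where
    solve : ∀ r → suc (9 + 5 * r) ≡ 5 * (2 + r)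
    solve = solve-∀

  b-distinct : ∀ {x y} d → suc d ≤ 4 → suc d + x ≡ y → b y ≢ b x
  b-distinct d le = B.distinct′ (suc d) (s≤s z≤n) (≤-trans (s≤s le) (5≤L M))

  module _ {κ : ℕ} where
    open CycleOps r Adj Adj-sym Ok κ

    -- An interval has t - 3 edges, so a cycle shorter than t has at most one vertex besides it. The
    -- two ends are not adjacent and no further vertex joins them.
    no-short : 3 + κ < 5 + r → ∀ i (c : Cyc) → (∀ j → j ≤ τ → f c j ≡ interval (suc i) j) → ⊥
    no-short k<t i c on = by (<-cmp (3 + κ) (3 + r))
      where
      closed : ∀ {x} → 3 + κ ≡ x → f c x ≡ a (suc i * τ)
      closed refl = trans (cong (f c) (sym (+-identityʳ (3 + κ)))) (trans (per c 0) (on 0 z≤n))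
      end : f c τ ≡ a (suc (suc i) * τ)
      end = on τ ≤-refl
      s₁ : ∀ r x → suc (1 + r) + x ≡ 2 + r + x
      s₁ = solve-∀
      s₂ : ∀ r → suc r + (8 + 4 * r) ≡ 9 + 5 * r
      s₂ = solve-∀
      s₃ : ∀ r → suc (1 + r) + (7 + 4 * r) ≡ 9 + 5 * r
      s₃ = solve-∀
      s₄ : ∀ r → suc (2 + r) + (6 + 4 * r) ≡ 9 + 5 * r
      s₄ = solve-∀
      s₅ : ∀ r → suc (3 + r) + (5 + 4 * r) ≡ 9 + 5 * r
      s₅ = solve-∀
      by : Tri (3 + κ < 3 + r) (3 + κ ≡ 3 + r) (3 + r < 3 + κ) → ⊥
      by (tri< k≤τ _ _) = A.distinct _ (3 + κ) (s≤s z≤n) (τ<L (3 + r) (≤-by (7 + 4 * r) (sol r)) k≤τ)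
        (trans (sym (on (3 + κ) (≤-pred k≤τ))) (closed refl))
        where
        sol : ∀ r → 3 + r + (7 + 4 * r) ≡ 5 * (2 + r)
        sol = solve-∀
      by (tri≈ _ e _) with nb-branch (suc i) (f c (suc τ)) (ok c (suc τ)) (after c τ end)
      ... | inj₁ e′ = a-distinct r (8 + 4 * r) (s₂ r) refl (trans (sym e′) (closed e))
      ... | inj₂ (inj₁ e′) = a-distinct (2 + r) (6 + 4 * r) (s₄ r) refl (trans (sym e′) (closed e))
      ... | inj₂ (inj₂ e′) = a≢b (trans (sym (closed e)) e′)
      by (tri> _ _ k>) with nb-branch (suc i) (f c (suc τ)) (ok c (suc τ)) (after c τ end)
                     | ≤-antisym k> (≤-pred k<t)
      ... | inj₁ e′ | e = skip≢ c (suc r) (trans e′ (sym (on (suc r) (n≤1+n _))))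
      ... | inj₂ (inj₂ e′) | e = a-distinct (1 + r) (7 + 4 * r) (s₃ r) refl
            (sym (lower-a (suc i) _ (subst₂ Adj e′ (closed (sym e)) (adj c (suc τ)))))
      ... | inj₂ (inj₁ e′) | e with A.neighbour (τ + suc i * τ) _ (subst₂ Adj e′ (closed (sym e)) (adj c (suc τ)))
      ...   | A.prev e″ = a-distinct (1 + r) (7 + 4 * r) (s₃ r) refl (sym e″)
      ...   | A.next e″ = a-distinct (3 + r) (5 + 4 * r) (s₅ r) refl (sym e″)
      ...   | A.child e″ _ = <⇒≢ (n<1+n _) e″
      ...   | A.parent e″ _ = <⇒≢ (n<1+n _) (sym e″)

    -- f runs through two consecutive intervals; three vertices remain.
    two-intervals : κ ≡ 5 + (r + r) → ∀ i (c : Cyc) → (∀ j → j ≤ τ + τ → f c j ≡ interval (suc i) j) → ⊥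
    two-intervals refl i c on = by (nb-branch (2 + i) (f c x₁) (ok c x₁) (after c x₀ at₀)) (nb-branch i (f c x₃) (ok c x₃) (before-to c 0 at₄))
      where
      x₀ x₁ x₂ x₃ : ℕ
      x₀ = τ + τ
      x₁ = suc x₀
      x₂ = suc x₁
      x₃ = before c 0
      eq₃ : suc x₂ ≡ x₃
      eq₃ = s r
        where
        s : ∀ r → 3 + (2 + r + (2 + r)) ≡ 2 + (5 + (r + r)) + 0
        s = solve-∀
      z : V
      z = f c x₂
      at₀ : f c x₀ ≡ a ((3 + i) * τ)
      at₀ = trans (on x₀ ≤-refl) (cong a (+-assoc τ τ (suc i * τ)))
      at₄ : f c 0 ≡ a (suc i * τ)
      at₄ = on 0 z≤n
      z-3 : Adj (f c x₃) z
      z-3 = subst (λ x → Adj (f c x) z) eq₃ (Adj-sym (f c x₂) (f c (suc x₂)) (adj c x₂))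
      z≢0 : z ≢ a ((3 + i) * τ)
      z≢0 e = skip≢ c x₀ (trans e (sym at₀))
      z≢4 : z ≢ a (suc i * τ)
      z≢4 e = skip≢ c x₂ (trans (cong (f c) (cong suc eq₃)) (trans (per c 0) (trans at₄ (sym e))))
      -- With this vertex the cycle would surround the two tiles that share the edge from
      -- `a ((2 + i) * τ)` to `b (2 + i)`, and that edge is a chord between the indices `τ` and
      -- `2 + τ + τ`.
      middle : z ≢ b (2 + i)
      middle e = chordless c refl τ (4 + r) (s≤s (s≤s z≤n)) (≤-by (2 + r) (s r))
        (subst₂ Adj (sym (on τ (m≤m+n τ τ))) (trans (sym e) (cong (f c) (s′ r)))
          (inj₂ (inj₂ (refl , branch-md (2 + i)))))
        where
        s : ∀ r → 4 + r + 2 + (2 + r) ≡ 3 + (5 + (r + r))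
        s = solve-∀
        s′ : ∀ r → 2 + (2 + r + (2 + r)) ≡ 4 + r + (2 + r)
        s′ = solve-∀
      forward : f c x₁ ≡ a (suc ((3 + i) * τ)) → z ≡ a (2 + (3 + i) * τ)
      forward e with nb-inner 0 (3 + i) (s≤s z≤n) (s≤s (s≤s z≤n)) z (ok c x₂) (after c x₁ e)
      ... | inj₁ e′ = ⊥-elim (z≢0 e′)
      ... | inj₂ e′ = e′
      backward : f c x₃ ≡ a (suc r + i * τ) → z ≡ a (r + i * τ)
      backward e with nb-inner r i (s≤s z≤n) ≤-refl z (ok c x₂) (subst (λ v → Adj v z) e z-3)
      ... | inj₁ e′ = e′
      ... | inj₂ e′ = ⊥-elim (z≢4 e′)
      by : f c x₁ ≡ a (suc r + (2 + i) * τ) ⊎ f c x₁ ≡ a (suc ((3 + i) * τ)) ⊎ f c x₁ ≡ b (3 + i) →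
           f c x₃ ≡ a (suc r + i * τ) ⊎ f c x₃ ≡ a (suc (suc i * τ)) ⊎ f c x₃ ≡ b (suc i) → ⊥
      by (inj₁ e) _ = skip≢ c (suc r + τ) (trans e (sym (trans
        (on (suc r + τ) (n≤1+n _)) (cong a (+-assoc (suc r) τ _)))))
      by _ (inj₂ (inj₁ e)) = before≢after c 0 (trans e (sym (on 1 (s≤s z≤n))))
      -- Going on along the layer on both sides would lead around all of it; the two positions found
      -- for `z` differ by `8 + 2 * r`, less than a full turn.
      by (inj₂ (inj₁ e₁)) (inj₁ e₃) = a-distinct (7 + 2 * r) (1 + 3 * r) (s r) (s′ r i)
          (trans (sym (forward e₁)) (backward e₃))
        where
        s : ∀ r → 8 + 2 * r + (1 + 3 * r) ≡ 9 + 5 * r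
        s = solve-∀
        s′ : ∀ r i → 8 + 2 * r + (r + i * (2 + r)) ≡ 2 + (3 + i) * (2 + r)
        s′ = solve-∀
      by (inj₂ (inj₁ e₁)) (inj₂ (inj₂ e₃)) =
        z≢4 (trans (forward e₁) (lower-a i _ (subst₂ Adj e₃ (forward e₁) z-3)))
      by (inj₂ (inj₂ e₁)) (inj₁ e₃) =
        z≢0 (trans (backward e₃) (lower-a (2 + i) _ (subst₂ Adj e₁ (backward e₃) (adj c x₁))))
      by (inj₂ (inj₂ e₁)) (inj₂ (inj₂ e₃))
        with nb-lower i z (subst (λ v → Adj v z) e₃ z-3) | nb-lower (2 + i) z (after c x₁ e₁)
      ... | inj₂ (inj₁ e) | _ = middle e
      ... | inj₂ (inj₂ (inj₁ e)) | _ = z≢4 e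
      ... | _ | inj₁ e = middle e
      ... | _ | inj₂ (inj₂ (inj₁ e)) = z≢0 e
      ... | inj₁ e | inj₂ (inj₁ e′) = b-distinct 3 ≤-refl refl (trans (sym e′) e)
      ... | inj₁ e | inj₂ (inj₂ (inj₂ (e′ , _))) = <⇒≢ (n<1+n M) (trans (sym e′) (cong suc (cong lay e)))
      ... | inj₂ (inj₂ (inj₂ (e , _))) | inj₂ (inj₁ e′) = <⇒≢ (n<1+n M) (trans (sym e) (cong suc (cong lay e′)))
      -- A common parent of `b (suc i)` and `b (3 + i)` would have two children in layer `M`.
      ... | inj₂ (inj₂ (inj₂ (_ , e))) | inj₂ (inj₂ (inj₂ (_ , e′))) =
        b-distinct 1 (s≤s (s≤s z≤n)) refl (tv-≡ (trans e′ (sym e)))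

    glue : ∀ i (c : Cyc) → (∀ j → j ≤ τ → f c j ≡ interval i j) → (∀ j → j ≤ τ → f c (j + τ) ≡ interval (suc i) j) →
           ∀ j → j ≤ τ + τ → f c j ≡ interval i j
    glue i c on beyond j le with j ≤? τ
    ... | yes j≤τ = on j j≤τ
    ... | no j≰τ = trans (cong (f c) (sym e)) (trans (beyond (j ∸ τ) (subst (j ∸ τ ≤_) (m+n∸n≡m τ τ) (∸-monoˡ-≤ τ le)))
            (cong a (trans (sym (+-assoc (j ∸ τ) τ (i * τ))) (cong (_+ i * τ) e))))
      where
      e : j ∸ τ + τ ≡ j
      e = m∸n+n≡m (<⇒≤ (≰⇒> j≰τ))

    -- At either end the cycle goes on into the neighbouring interval, giving two intervals in a
    -- row, or steps down a layer. If it steps down at both ends, the edge between the two lower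
    -- vertices is a chord that cuts off one tile.
    one-interval : ∀ i (c : Cyc) → (∀ j → j ≤ τ → f c j ≡ interval (2 + i) j) → ⊥
    one-interval i c on with size c
    ... | inj₁ k<t = no-short k<t (suc i) c on
    ... | inj₂ refl = by (nb-branch (2 + i) (f c (suc τ)) (ok c (suc τ)) (after c τ end))
                         (nb-branch (suc i) (f c (before c 0)) (ok c (before c 0)) (before-to c 0 (on 0 z≤n)))
      where
      end : f c τ ≡ a ((3 + i) * τ)
      end = on τ ≤-refl
      by : f c (suc τ) ≡ a (suc r + (2 + i) * τ) ⊎ f c (suc τ) ≡ a (suc ((3 + i) * τ)) ⊎ f c (suc τ) ≡ b (3 + i) →
           f c (before c 0) ≡ a (suc r + suc i * τ) ⊎ f c (before c 0) ≡ a (suc ((2 + i) * τ)) ⊎ f c (before c 0) ≡ b (2 + i) → ⊥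
      by (inj₁ e) _ = skip≢ c (suc r) (trans e (sym (on (suc r) (n≤1+n _))))
      by _ (inj₂ (inj₁ e)) = before≢after c 0 (trans e (sym (on 1 (s≤s z≤n))))
      by (inj₂ (inj₁ e)) _ = two-intervals refl (suc i) c (glue (2 + i) c on (follow (forced (3 + i)) c τ end e))
      by (inj₂ (inj₂ e)) (inj₂ (inj₂ e′)) = chordless c refl (suc τ) (4 + r) (s≤s (s≤s z≤n)) (≤-by (2 + r) (s r))
        (subst₂ Adj (sym e) (trans (sym e′) (cong (f c) (s′ r))) (Adj-sym (b (2 + i)) (b (3 + i)) (B.step (2 + i))))
        where
        s : ∀ r → 4 + r + 2 + (2 + r) ≡ 3 + (5 + (r + r))
        s = solve-∀
        s′ : ∀ r → 2 + (5 + (r + r)) + 0 ≡ 4 + r + (3 + r)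
        s′ = solve-∀
      by (inj₂ (inj₂ _)) (inj₁ e′)
        with traverse (forced (suc i)) c (suc r) ≤-refl (before c 0) e′ (trans (per c 0) (on 0 z≤n))
      ... | c′ , on′ , back = two-intervals refl i c′ (glue (suc i) c′ on′ λ j le →
            trans (cong (f c′) (+-suc j (suc r))) (trans (back (suc j)) (trans (cong (f c) (s j r)) (trans (per c j) (on j le)))))
        where
        s : ∀ j r → suc j + (2 + (5 + (r + r)) + 0) ≡ 3 + (5 + (r + r)) + j
        s = solve-∀

    -- A branch vertex has only one `Ok` neighbour off its layer, so a cycle through it also enters
    -- the inside of an interval.
    avoids : (c : Cyc) → ∀ x → lay (f c x) ≢ suc M
    avoids c x e with A.vx-lift (f c x) e
    ... | y , e′ = at-offset (X / τ) (X % τ) (m%n<n X τ) 5≤q (trans e′ (trans (tv-≡ (sym turn)) (cong a (m≡m%n+[m/n]*n X τ))))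
      where
      -- A full turn is added so that the interval has index at least 5 and the intervals before it
      -- have natural numbers as indices.
      X : ℕ
      X = 2 + y + L (suc M)
      turn : md (suc M) X ≡ md (suc M) (2 + y)
      turn = [m+n]%n≡m%n (2 + y) (L (suc M)) {{nzL (suc M)}}
      5≤q : 5 ≤ X / τ
      5≤q = subst (_≤ X / τ) (m*n/n≡m 5 τ) (/-monoˡ-≤ τ (≤-trans (5τ≤L M) (m≤n+m (L (suc M)) (2 + y))))
      enter : ∀ i j → 2 + j ≤ τ → ∀ y → f c y ≡ interval (2 + i) (suc j) → ⊥
      enter i j le y e with ear (forced (2 + i)) c j le y e
      ... | c′ , on = one-interval i c′ on
      at-offset : ∀ q j → j < τ → 5 ≤ q → f c x ≡ a (j + q * τ) → ⊥
      at-offset (suc (suc q)) (suc j) j<τ _ e = enter q j j<τ x e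
      at-offset (suc (suc (suc q))) zero _ _ e
        with nb-branch (2 + q) (f c (suc x)) (ok c (suc x)) (after c x e)
           | nb-branch (2 + q) (f c (before c x)) (ok c (before c x)) (before-to c x e)
      ... | inj₁ e₁ | _ = enter q r ≤-refl _ e₁
      ... | inj₂ (inj₁ e₁) | _ = enter (suc q) 0 (s≤s (s≤s z≤n)) _ e₁
      ... | inj₂ (inj₂ _) | inj₁ e₂ = enter q r ≤-refl _ e₂
      ... | inj₂ (inj₂ _) | inj₂ (inj₁ e₂) = enter (suc q) 0 (s≤s (s≤s z≤n)) _ e₂
      ... | inj₂ (inj₂ e₁) | inj₂ (inj₂ e₂) = before≢after c x (trans e₂ (sym e₁))
      at-offset 0 _ _ () _
      at-offset 1 _ _ (s≤s ()) _
      at-offset 2 zero _ (s≤s (s≤s ())) _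

module _ (r m : ℕ) where
  open Cycle
  open Layers r m

  no-layered-cycle : ∀ M → M ≤ m → ∀ {κ} → Cycle r Adj (Below M) κ → ⊥
  no-layered-cycle zero _ c = Zero.impossible c
  no-layered-cycle (suc M) M≤ c = no-layered-cycle M (≤-trans (n≤1+n M) M≤) record
    { f = f c ; per = per c ; inj = inj c ; adj = adj c ; size = size c ; chordless = chordless c
    ; ok = λ x → ≤-pred (≤∧≢⇒< (ok c x) (OuterLayer.avoids r m M M≤ c x))
    }

-- Expansions

module Expansion (r m : ℕ) (S J : ℕ → Bool) (valid : ValidExp (5 + r) m S J) where
  open Layers r m hiding (V; Adj; Adj-sym)
  open Layer m ≤-refl

  EV : Set
  EV = ExpV t m S J

  EAdj : EV → EV → Set
  EAdj = ExpAdj t m S J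

  EAdj-sym : ∀ x y → EAdj x y → EAdj y x
  EAdj-sym _ _ (inj₁ a) = inj₂ a
  EAdj-sym _ _ (inj₂ a) = inj₁ a

  top : ℕ
  top = 4 + (r + r)

  top≡ : 2 * t ∸ 6 ≡ top
  top≡ = cong (_∸ 6) (solve r)
    where
    solve : ∀ r → 2 * (5 + r) ≡ 6 + (4 + (r + r))
    solve = solve-∀

  IsQ NoQ IsOld : EV → Set
  IsQ (qv _ _ _ _ _) = ⊤
  IsQ _ = ⊥
  NoQ z = ¬ IsQ z
  IsOld (old _) = ⊤
  IsOld _ = ⊥

  -- Separates the vertices of one path `P` from each other and from the vertices of the other
  -- kinds, which all get 0.
  index : EV → ℕ
  index (pv _ _ _ a _) = suc a
  index _ = 0

  old′ : TmV t m → EV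
  old′ = old

  lay≤′ : (w : TmV t m) → lay w ≤ m
  lay≤′ (tv ℓ ℓ≤ _ _) = recompute (ℓ ≤? m) ℓ≤

  module Patch (x : ℕ) .(Sp : S (md m (2 + x)) ≡ true) where

    p : ℕ
    p = md m (2 + x)

    P : (a : ℕ) → .(a ≤ top) → EV
    P a a≤ = pv p (md< m (2 + x)) Sp a (subst (a ≤_) (sym top≡) a≤)

    xₗ xₘ xᵣ : EV
    xₗ = old (vx (1 + x))
    xₘ = old (vx (2 + x))
    xᵣ = old (vx (3 + x))

    -- The path `P` prolonged by its two outer neighbours on the layer. Here y is `u (3 + r)`, with
    -- v⁻ and v⁺ just before and after it, and `xᵣ` is `u (2 + top)`. Each half from an end to y,
    -- closed up through `xₘ`, bounds a t-gon.
    u : ℕ → EV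
    u zero = xₗ
    u (suc a) with a ≤? top
    ... | yes a≤ = P a a≤
    ... | no _ = xᵣ

    u-P : ∀ a .(a≤ : a ≤ top) → u (suc a) ≡ P a a≤
    u-P a a≤ with a ≤? top
    ... | yes _ = refl
    ... | no a≰ = ⊥-elim (a≰ (recompute (a ≤? top) a≤))

    u-end : u (2 + top) ≡ xᵣ
    u-end with suc top ≤? top
    ... | yes le = ⊥-elim (1+n≰n le)
    ... | no _ = refl

    old-at : ∀ {w y} → lay w ≡ m → pos w ≡ md m y → old′ w ≡ old (vx y)
    old-at {tv _ _ _ _} refl e = cong old′ (tv-≡ e)

    old≢ : ∀ {y z} d → 0 < d → d ≤ 4 → d + y ≡ z → old′ (vx z) ≢ old′ (vx y)
    old≢ {y} d 0<d d≤4 refl e = R.%-distinct m y d 0<d (≤-trans (s≤s d≤4) (5≤L m)) (cong place e)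
      where
      place : EV → ℕ
      place (old w) = pos w
      place _ = 0

    index-u : ∀ {a} → a ≤ top → index (u (suc a)) ≡ suc a
    index-u a≤ = cong index (u-P _ a≤)

    u≢xᵣ : ∀ j → j ≤ suc top → u j ≢ xᵣ
    u≢xᵣ zero _ e = old≢ 2 (s≤s z≤n) (s≤s (s≤s z≤n)) refl (sym e)
    u≢xᵣ (suc j) (s≤s le) e = 0≢1+n (trans (sym (cong index e)) (index-u le))

    data NeighbourU (j : ℕ) (z : EV) : Set where
      lo : z ≡ u j → NeighbourU j z
      hi : z ≡ u (2 + j) → NeighbourU j z
      mid : j ≡ 2 + r → z ≡ xₘ → NeighbourU j z
      toQ : ∀ b .p< .Jp .b≤ → z ≡ qv p p< Jp b b≤ → (j ≡ 1 + r × b ≡ 0) ⊎ (j ≡ 3 + r × b ≡ 1 + r) → NeighbourU j z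

    neighbour-P : ∀ j .(j≤ : j ≤ top) z → EAdj (P j j≤) z → NeighbourU j z
    neighbour-P j j≤ (old w) (inj₁ (e , a , refl)) =
      hi (trans (old-at e (R.arc-next m {2 + x} (subst (λ ℓ → pos w < L ℓ) e (pos<′ w)) a)) (sym (trans (cong (λ n → u (2 + n)) top≡) u-end)))
    neighbour-P j j≤ (old w) (inj₂ (e , inj₁ (a , refl))) = lo (old-at e (R.arc-prev m (1 + x) a))
    neighbour-P j j≤ (old w) (inj₂ (e , inj₂ (a , refl))) = mid refl (old-at e a)
    neighbour-P j j≤ (pv _ _ _ a a≤) (inj₁ (refl , refl)) = hi (sym (u-P (suc j) (subst (suc j ≤_) top≡ a≤)))
    neighbour-P j j≤ (pv _ _ _ a a≤) (inj₂ (refl , refl)) = lo (sym (u-P a (subst (a ≤_) top≡ a≤)))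
    neighbour-P j j≤ (qv _ p< Jp b b≤) (inj₁ (refl , e)) = toQ b p< Jp b≤ refl e

    neighbour-u : ∀ j → j ≤ top → ∀ z → EAdj (u (suc j)) z → NeighbourU j z
    neighbour-u j j≤ z ad = neighbour-P j j≤ z (subst (λ v → EAdj v z) (u-P j j≤) ad)

    u≁xᵣ : ∀ j → j ≤ 3 + r → ¬ EAdj (u j) xᵣ
    u≁xᵣ zero _ ad with neighbour x (vx (3 + x)) ad
    ... | prev e = old≢ 3 (s≤s z≤n) (s≤s (s≤s (s≤s z≤n))) refl (cong old′ e)
    ... | next e = old≢ 1 (s≤s z≤n) (s≤s z≤n) refl (cong old′ e)
    ... | child e _ = <⇒≢ (n<1+n m) e
    ... | parent e _ = <⇒≢ (n<1+n m) (sym e)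
    u≁xᵣ (suc j) le ad with neighbour-u j j≤ xᵣ ad
      where
      j≤ : j ≤ top
      j≤ = ≤-trans (≤-pred le) (≤-by (2 + r) (solve r))
        where
        solve : ∀ r → 2 + r + (2 + r) ≡ 4 + (r + r)
        solve = solve-∀
    ... | lo e = u≢xᵣ j (≤-trans (≤-pred le) (≤-by (3 + r) (solve r))) (sym e)
      where
      solve : ∀ r → 2 + r + (3 + r) ≡ 5 + (r + r)
      solve = solve-∀
    ... | hi e = u≢xᵣ (2 + j) (≤-trans (s≤s le) (≤-by (1 + r) (solve r))) (sym e)
      where
      solve : ∀ r → 4 + r + (1 + r) ≡ 5 + (r + r)
      solve = solve-∀
    ... | mid _ e = old≢ 1 (s≤s z≤n) (s≤s z≤n) refl e
    ... | toQ _ _ _ _ () _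

    half≢top : 2 + r ≢ top
    half≢top e = <⇒≢ (≤-by (1 + r) (solve r)) e
      where
      solve : ∀ r → suc (2 + r) + (1 + r) ≡ 4 + (r + r)
      solve = solve-∀

    ends≢ : md m (3 + x) ≢ md m (1 + x)
    ends≢ = R.%-distinct m (1 + x) 2 (s≤s z≤n) (≤-trans (s≤s (s≤s (s≤s z≤n))) (5≤L m))

    -- Another common neighbour on the layer needs a layer of length 4, a common parent would have
    -- two children, layer `m` has no children, and a vertex of a path `P` is adjacent to at most
    -- one vertex of the layer.
    common-neighbour : ∀ z → EAdj xₗ z → EAdj xᵣ z → z ≡ xₘ
    common-neighbour (old w) l ρ with neighbour x w l | neighbour (2 + x) w ρ
    ... | next e | _ = cong old′ e
    ... | _ | prev e = cong old′ e
    ... | child e _ | _ = ⊥-elim (1+n≰n (subst (_≤ m) e (lay≤′ w)))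
    ... | _ | child e _ = ⊥-elim (1+n≰n (subst (_≤ m) e (lay≤′ w)))
    ... | prev e | next e′ = ⊥-elim (old≢ 4 (s≤s z≤n) ≤-refl refl (cong old′ (trans (sym e′) e)))
    ... | prev e | parent e′ _ = ⊥-elim (<⇒≢ (n<1+n m) (trans (sym e′) (cong suc (cong lay e))))
    ... | parent e′ _ | next e = ⊥-elim (<⇒≢ (n<1+n m) (trans (sym e′) (cong suc (cong lay e))))
    ... | parent _ e | parent _ e′ = ⊥-elim (ends≢ (trans e′ (sym e)))
    common-neighbour (pv q q< _ a _) (inj₁ (_ , inj₁ (l , _))) (inj₁ (_ , inj₁ (ρ , _))) =
      ⊥-elim (ends≢ (R.arc-injective m ρ l))
    common-neighbour (pv q q< _ a _) (inj₁ (_ , inj₂ (l , _))) (inj₁ (_ , inj₂ (ρ , _))) =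
      ⊥-elim (ends≢ (trans ρ (sym l)))
    common-neighbour (pv q q< _ a _) (inj₂ (_ , l , _)) (inj₂ (_ , ρ , _)) =
      ⊥-elim (ends≢
        (R.arc-functional m (md< m (3 + x)) (md< m (1 + x)) ρ l))
    common-neighbour (pv q q< _ a _) (inj₁ (_ , inj₁ (_ , refl))) (inj₁ (_ , inj₂ (_ , ())))
    common-neighbour (pv q q< _ a _) (inj₁ (_ , inj₁ (_ , refl))) (inj₂ (_ , _ , e)) = ⊥-elim (0≢1+n (trans e top≡))
    common-neighbour (pv q q< _ a _) (inj₁ (_ , inj₂ (_ , refl))) (inj₁ (_ , inj₁ (_ , ())))
    common-neighbour (pv q q< _ a _) (inj₁ (_ , inj₂ (_ , refl))) (inj₂ (_ , _ , e)) = ⊥-elim (half≢top (trans e top≡))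
    common-neighbour (pv q q< _ a _) (inj₂ (_ , _ , e)) (inj₁ (_ , inj₁ (_ , refl))) = ⊥-elim (0≢1+n (trans e top≡))
    common-neighbour (pv q q< _ a _) (inj₂ (_ , _ , e)) (inj₁ (_ , inj₂ (_ , refl))) = ⊥-elim (half≢top (trans e top≡))
    common-neighbour (qv _ _ _ _ _) (inj₁ ()) _
    common-neighbour (qv _ _ _ _ _) (inj₂ ()) _

-- Cycles that meet the paths added by an expansion

module Elimination (r m : ℕ) (S J : ℕ → Bool) (valid : ValidExp (5 + r) m S J) where
  open Cycle
  open Layers r m hiding (V; Adj; Adj-sym)
  open Layer m ≤-refl using (vx; vx-lift; step)
  open Expansion r m S J valid

  1+r≤top : 1 + r ≤ top
  1+r≤top = ≤-by (3 + r) (solve r)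
    where
    solve : ∀ r → 1 + r + (3 + r) ≡ 4 + (r + r)
    solve = solve-∀

  3+r≤top : 3 + r ≤ top
  3+r≤top = ≤-by (1 + r) (solve r)
    where
    solve : ∀ r → 3 + r + (1 + r) ≡ 4 + (r + r)
    solve = solve-∀

  2+r≤top : 2 + r ≤ top
  2+r≤top = ≤-trans (n≤1+n _) 3+r≤top

  module Mid (x : ℕ) .(Sp : S (md m (2 + x)) ≡ true) where
    open Patch x Sp

    yₗ : EAdj (u (2 + r)) (u (3 + r))
    yₗ = subst₂ EAdj (sym (u-P (1 + r) 1+r≤top)) (sym (u-P (2 + r) 2+r≤top)) (inj₁ (refl , refl))

    yᵣ : EAdj (u (4 + r)) (u (3 + r))
    yᵣ = subst₂ EAdj (sym (u-P (3 + r) 3+r≤top)) (sym (u-P (2 + r) 2+r≤top)) (inj₂ (refl , refl))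

    yₘ : EAdj (u (3 + r)) xₘ
    yₘ = subst (λ v → EAdj v xₘ) (sym (u-P (2 + r) 2+r≤top)) (inj₂ (refl , inj₂ (refl , refl)))

    u-distinct : ∀ {i j} → i ≤ top → j ≤ suc top → i ≢ j → u (suc i) ≢ u (suc j)
    u-distinct i≤ j≤ i≢j e with m≤n⇒m<n∨m≡n j≤
    ... | inj₂ refl = u≢xᵣ _ (s≤s i≤) (trans e u-end)
    ... | inj₁ j≤′ = i≢j (suc-injective (trans (sym (index-u i≤)) (trans (cong index e) (index-u (≤-pred j≤′)))))

  module AvoidQ (x : ℕ) .(Jp : J (md m (2 + x)) ≡ true) where
    open Patch x (proj₂ valid (md m (2 + x)) Jp)
    open Mid x (proj₂ valid (md m (2 + x)) Jp)

    Q : (b : ℕ) → .(b ≤ 1 + r) → EV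
    Q b b≤ = qv p (md< m (2 + x)) Jp b b≤

    -- The path `Q` prolonged by v⁻ and v⁺. Closed up through y it bounds a tile: `(1 + r) + 2 + 2`
    -- is t.
    v : ℕ → EV
    v zero = u (2 + r)
    v (suc b) with b ≤? 1 + r
    ... | yes b≤ = Q b b≤
    ... | no _ = u (4 + r)

    v-Q : ∀ b .(b≤ : b ≤ 1 + r) → v (suc b) ≡ Q b b≤
    v-Q b b≤ with b ≤? 1 + r
    ... | yes _ = refl
    ... | no b≰ = ⊥-elim (b≰ (recompute (b ≤? 1 + r) b≤))

    v-end : v (3 + r) ≡ u (4 + r)
    v-end with 2 + r ≤? 1 + r
    ... | yes le = ⊥-elim (1+n≰n le)
    ... | no _ = refl

    neighbour-Q : ∀ b .(b≤ : b ≤ 1 + r) z → EAdj (Q b b≤) z → z ≡ v b ⊎ z ≡ v (2 + b)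
    neighbour-Q b b≤ (pv _ _ _ a _) (inj₂ (refl , inj₁ (refl , refl))) = inj₁ (sym (u-P (1 + r) 1+r≤top))
    neighbour-Q b b≤ (pv _ _ _ a _) (inj₂ (refl , inj₂ (refl , refl))) = inj₂ (sym (trans v-end (u-P (3 + r) 3+r≤top)))
    neighbour-Q b b≤ (qv _ _ _ c c≤) (inj₁ (refl , refl)) = inj₂ (sym (v-Q (suc b) c≤))
    neighbour-Q b b≤ (qv _ _ _ c c≤) (inj₂ (refl , refl)) = inj₁ (sym (v-Q c c≤))
    neighbour-Q b b≤ (old _) (inj₁ ())
    neighbour-Q b b≤ (old _) (inj₂ ())

    forced-v : Forced EAdj (λ _ → ⊤) v (3 + r)
    forced-v j le z _ ad = neighbour-Q j (≤-pred (≤-pred le)) z (subst (λ w → EAdj w z) (v-Q j (≤-pred (≤-pred le))) ad)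

    u≢Q : ∀ {j b} .(b≤ : b ≤ 1 + r) → j ≤ top → u (suc j) ≢ Q b b≤
    u≢Q b≤ j≤ e = 0≢1+n (trans (sym (cong index e)) (index-u j≤))

    forced-w : Forced EAdj (λ _ → ⊤) (λ j → u (j + (4 + r))) (2 + r)
    forced-w j le z _ ad with neighbour-u (j + (4 + r)) j≤ z ad
      where
      j≤ : j + (4 + r) ≤ top
      j≤ = subst (j + (4 + r) ≤_) (solve r) (+-monoˡ-≤ (4 + r) (≤-pred (≤-pred le)))
        where
        solve : ∀ r → r + (4 + r) ≡ 4 + (r + r)
        solve = solve-∀
    ... | lo e = inj₁ e
    ... | hi e = inj₂ e
    ... | mid e _ = ⊥-elim (<⇒≢ (≤-trans (n≤1+n _) (m≤n+m (4 + r) j)) (sym e))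
    ... | toQ _ _ _ _ _ (inj₁ (e , _)) = ⊥-elim (<⇒≢ (≤-trans (≤-trans (n≤1+n _) (n≤1+n _)) (m≤n+m (4 + r) j)) (sym e))
    ... | toQ _ _ _ _ _ (inj₂ (e , _)) = ⊥-elim (<⇒≢ (m≤n+m (4 + r) j) (sym e))

    module _ {κ : ℕ} where
      open CycleOps r EAdj EAdj-sym (λ _ → ⊤) κ

      -- A cycle shorter than t has no room for a vertex besides those of `v`, whose ends are not
      -- adjacent. At length 2t - 2, turning to y at either end gives a chord to the other end.
      -- Following `P` both ways leads to `xᵣ` with a single vertex left to join it to `u (1 + r)`,
      -- and none fits.
      impossible : (c : Cyc) → (∀ i → i ≤ 3 + r → f c i ≡ v i) → ⊥
      impossible c on = by (size c)
        where
        f₀ : f c 0 ≡ u (2 + r)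
        f₀ = on 0 z≤n
        fₑ : f c (3 + r) ≡ u (4 + r)
        fₑ = trans (on (3 + r) ≤-refl) v-end
        closed : f c (3 + κ) ≡ u (2 + r)
        closed = trans (cong (f c) (sym (+-identityʳ (3 + κ)))) (trans (per c 0) f₀)
        v≢ : ∀ i → suc i ≤ 3 + r → v (suc i) ≢ u (2 + r)
        v≢ i le e with i ≤? 1 + r
        ... | yes i≤ = u≢Q i≤ 1+r≤top (sym e)
        ... | no _ = u-distinct 3+r≤top (m≤n⇒m≤1+n 1+r≤top) (λ ()) e
        by : 3 + κ < 5 + r ⊎ κ ≡ 5 + (r + r) → ⊥
        by (inj₁ k<t) with m≤n⇒m<n∨m≡n (≤-pred k<t)
        ... | inj₁ k≤ = v≢ (2 + κ) (≤-pred k≤) (trans (sym (on (3 + κ) (≤-pred k≤))) closed)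
        ... | inj₂ k≡ with neighbour-u (3 + r) 3+r≤top _ (subst₂ EAdj fₑ (trans (cong (f c) (sym k≡)) closed) (adj c (3 + r)))
        ...   | lo e = u-distinct 1+r≤top (m≤n⇒m≤1+n 2+r≤top) (λ ()) e
        ...   | hi e = u-distinct 1+r≤top (s≤s 3+r≤top) (λ e′ → <⇒≢ (m≤n+m (2 + r) 2) e′) e
        ...   | toQ _ _ _ b≤ e _ = u≢Q b≤ 1+r≤top e
        by (inj₂ refl) = last (neighbour-u (3 + r) 3+r≤top (f c (4 + r)) (after c (3 + r) fₑ))
                              (neighbour-u (1 + r) 1+r≤top (f c (before c 0)) (before-to c 0 f₀))
          where
          chordₑ : f c (before c 0) ≢ u (3 + r)
          chordₑ e = chordless c refl (3 + r) (4 + r) (s≤s (s≤s z≤n)) (≤-by (2 + r) (sol r))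
            (subst₂ EAdj (sym fₑ) (trans (sym e) (cong (f c) (sol′ r))) yᵣ)
            where
            sol : ∀ r → 4 + r + 2 + (2 + r) ≡ 3 + (5 + (r + r))
            sol = solve-∀
            sol′ : ∀ r → 2 + (5 + (r + r)) + 0 ≡ 4 + r + (3 + r)
            sol′ = solve-∀
          last : NeighbourU (3 + r) (f c (4 + r)) → NeighbourU (1 + r) (f c (before c 0)) → ⊥
          last (lo e) _ = chord₀ c refl (4 + r) (s≤s (s≤s z≤n)) (≤-by (2 + r) (sol r)) (subst₂ EAdj (sym f₀) (sym e) yₗ)
            where
            sol : ∀ r → 4 + r + 2 + (2 + r) ≡ 3 + (5 + (r + r))
            sol = solve-∀
          last (toQ _ _ _ _ e (inj₂ (_ , refl))) _ = skip≢ c (2 + r) (trans e (sym (trans (on (2 + r) (n≤1+n _)) (v-Q (1 + r) ≤-refl))))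
          last (hi _) (hi e) = chordₑ e
          last (hi _) (toQ _ _ _ _ e (inj₁ (_ , refl))) = before≢after c 0 (trans e (sym (trans (on 1 (s≤s z≤n)) (v-Q 0 z≤n))))
          last (hi e) (lo e′) = end (neighbour-u r (≤-trans (n≤1+n r) 1+r≤top) z (subst (λ w → EAdj w z) e′ z-3))
            where
            x₁ x₂ : ℕ
            x₁ = 2 + r + (3 + r)
            x₂ = suc x₁
            z : EV
            z = f c x₂
            eq₃ : suc x₂ ≡ before c 0
            eq₃ = sol r
              where
              sol : ∀ r → 2 + (2 + r + (3 + r)) ≡ 2 + (5 + (r + r)) + 0
              sol = solve-∀
            z-3 : EAdj (f c (before c 0)) z
            z-3 = subst (λ n → EAdj (f c n) z) eq₃ (EAdj-sym z (f c (suc x₂)) (adj c x₂))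
            at₁ : f c x₁ ≡ xᵣ
            at₁ = trans (follow forced-w c (3 + r) fₑ e (2 + r) ≤-refl) (trans (cong u (sol r)) u-end)
              where
              sol : ∀ r → 2 + r + (4 + r) ≡ 2 + (4 + (r + r))
              sol = solve-∀
            end : NeighbourU r z → ⊥
            end (lo e) = u≁xᵣ r (m≤n+m r 3) (EAdj-sym xᵣ (u r) (subst (EAdj xᵣ) e (after c x₁ at₁)))
            end (hi e) = skip≢ c x₂ (trans (cong (f c) (cong suc eq₃)) (trans (per c 0) (trans f₀ (sym e))))
            end (mid e _) = <⇒≢ (m≤n+m (suc r) 1) e
            end (toQ _ _ _ _ _ (inj₁ (e , _))) = <⇒≢ ≤-refl e
            end (toQ _ _ _ _ _ (inj₂ (e , _))) = <⇒≢ (m≤n+m (suc r) 2) e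

      avoids : (c : Cyc) → ∀ x b .(b≤ : b ≤ 1 + r) → f c x ≢ Q b b≤
      avoids c y b b≤ e with ear forced-v c b (s≤s (s≤s (recompute (b ≤? 1 + r) b≤))) y (trans e (sym (v-Q b b≤)))
      ... | c′ , on = impossible c′ on

  module AvoidP (x : ℕ) .(Sp : S (md m (2 + x)) ≡ true) where
    open Patch x Sp
    open Mid x Sp

    -- With the paths `Q` gone, y is the only inner vertex of the path with a third neighbour, so
    -- the path splits there into two forced halves.
    forced-l : Forced EAdj NoQ u (3 + r)
    forced-l j le z noq ad with neighbour-u j (≤-trans (≤-pred (≤-pred le)) 1+r≤top) z ad
    ... | lo e = inj₁ e
    ... | hi e = inj₂ e
    ... | mid e _ = ⊥-elim (<⇒≢ (≤-pred le) e)
    ... | toQ _ _ _ _ refl _ = ⊥-elim (noq tt)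

    forced-w : Forced EAdj NoQ (λ j → u (j + (3 + r))) (3 + r)
    forced-w j le z noq ad with neighbour-u (j + (3 + r)) j≤ z ad
      where
      j≤ : j + (3 + r) ≤ top
      j≤ = subst (j + (3 + r) ≤_) (solve r) (+-monoˡ-≤ (3 + r) (≤-pred (≤-pred le)))
        where
        solve : ∀ r → 1 + r + (3 + r) ≡ 4 + (r + r)
        solve = solve-∀
    ... | lo e = inj₁ e
    ... | hi e = inj₂ e
    ... | mid e _ = ⊥-elim (<⇒≢ (m≤n+m (3 + r) j) (sym e))
    ... | toQ _ _ _ _ refl _ = ⊥-elim (noq tt)

    u-reversed : ℕ → EV
    u-reversed j = u (2 + top ∸ j)

    forced-r : Forced EAdj NoQ u-reversed (3 + r)
    forced-r j le z noq ad with neighbour-u (top ∸ j) (m∸n≤m top j) z (subst (λ i → EAdj (u i) z) (+-∸-assoc 1 j≤) ad)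
      where
      j≤ : j ≤ top
      j≤ = ≤-trans (≤-pred (≤-pred le)) 1+r≤top
    ... | lo e = inj₂ e
    ... | hi e = inj₁ (trans e (cong u (sym (+-∸-assoc 2 (≤-trans (≤-pred (≤-pred le)) 1+r≤top)))))
    ... | mid e _ = ⊥-elim (<⇒≢ (subst (_≤ top ∸ j) (trans (cong (_∸ (1 + r)) (solve r)) (m+n∸n≡m (3 + r) (1 + r)))
                      (∸-monoʳ-≤ top (≤-pred (≤-pred le)))) (sym e))
      where
      solve : ∀ r → 4 + (r + r) ≡ 3 + r + (1 + r)
      solve = solve-∀
    ... | toQ _ _ _ _ refl _ = ⊥-elim (noq tt)

    module _ {κ : ℕ} where
      open CycleOps r EAdj EAdj-sym NoQ κ

      -- From y a long cycle either turns to `xₘ`, which is adjacent to `xₗ`, or goes on to `xᵣ`. In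
      -- the latter case its last vertex is a common neighbour of `xₗ` and `xᵣ`, hence `xₘ`, which
      -- is adjacent to y. Both give a chord.
      left-impossible : (c : Cyc) → (∀ i → i ≤ 3 + r → f c i ≡ u i) → ⊥
      left-impossible c on = by (size c) (neighbour-u (2 + r) 2+r≤top (f c (4 + r)) (after c (3 + r) (on (3 + r) ≤-refl)))
        where
        f₀ : f c 0 ≡ xₗ
        f₀ = on 0 z≤n
        closed : f c (3 + κ) ≡ xₗ
        closed = trans (cong (f c) (sym (+-identityʳ (3 + κ)))) (trans (per c 0) f₀)
        by : 3 + κ < 5 + r ⊎ κ ≡ 5 + (r + r) → NeighbourU (2 + r) (f c (4 + r)) → ⊥
        by _ (toQ _ _ _ _ e _) = subst NoQ e (ok c (4 + r)) tt
        by (inj₁ k<t) nb with m≤n⇒m<n∨m≡n (≤-pred k<t)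
        ... | inj₁ k≤ = 0≢1+n (trans (sym (cong index (trans (sym (on (3 + κ) (≤-pred k≤))) closed))) (index-u (≤-trans (≤-pred (≤-pred k≤)) 2+r≤top)))
        by (inj₁ k<t) (toQ _ _ _ _ e _) | inj₂ refl = subst NoQ e (ok c (4 + r)) tt
        by (inj₁ k<t) (lo e) | inj₂ refl = 0≢1+n (trans (cong index (trans (sym closed) e)) (index-u 1+r≤top))
        by (inj₁ k<t) (hi e) | inj₂ refl = 0≢1+n (trans (cong index (trans (sym closed) e)) (index-u 3+r≤top))
        by (inj₁ k<t) (mid _ e) | inj₂ refl = old≢ 1 (s≤s z≤n) (s≤s z≤n) refl (trans (sym e) closed)
        by (inj₂ refl) (lo e) = skip≢ c (2 + r) (trans e (sym (on (2 + r) (n≤1+n _))))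
        by (inj₂ refl) (mid _ e) = chord₀ c refl (4 + r) (s≤s (s≤s z≤n)) (≤-by (2 + r) (sol r))
            (subst₂ EAdj (sym f₀) (sym e) (step (1 + x)))
          where
          sol : ∀ r → 4 + r + 2 + (2 + r) ≡ 3 + (5 + (r + r))
          sol = solve-∀
        by (inj₂ refl) (hi e) = chordless c refl (3 + r) (4 + r) (s≤s (s≤s z≤n)) (≤-by (2 + r) (sol r))
            (subst₂ EAdj (sym (on (3 + r) ≤-refl)) (sym is-xₘ) yₘ)
          where
          sol : ∀ r → 4 + r + 2 + (2 + r) ≡ 3 + (5 + (r + r))
          sol = solve-∀
          sol₁ : ∀ r → 3 + r + (3 + r) ≡ 2 + (4 + (r + r))
          sol₁ = solve-∀
          sol₂ : ∀ r → 5 + r + (3 + r) ≡ 3 + (5 + (r + r))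
          sol₂ = solve-∀
          at₁ : f c (3 + r + (3 + r)) ≡ xᵣ
          at₁ = trans (follow forced-w c (3 + r) (on (3 + r) ≤-refl) e (3 + r) ≤-refl) (trans (cong u (sol₁ r)) u-end)
          is-xₘ : f c (4 + r + (3 + r)) ≡ xₘ
          is-xₘ = common-neighbour _ (EAdj-sym _ xₗ (subst (EAdj _) (trans (cong (f c) (sol₂ r)) closed) (adj c (4 + r + (3 + r)))))
                    (after c (3 + r + (3 + r)) at₁)

      avoids-left : (c : Cyc) → ∀ y j → j ≤ 1 + r → f c y ≢ u (suc j)
      avoids-left c y j le e with ear forced-l c j (s≤s (s≤s le)) y e
      ... | c′ , on = left-impossible c′ on

      -- Passing y into the left half is excluded by `avoids-left`, so only the turn to `xₘ`
      -- remains, and `xₘ` is adjacent to `xᵣ`.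
      right-impossible : (c : Cyc) → (∀ i → i ≤ 3 + r → f c i ≡ u-reversed i) → ⊥
      right-impossible c on = by (size c) (neighbour-u (2 + r) 2+r≤top (f c (4 + r)) (after c (3 + r) fₑ))
        where
        sol : ∀ r → 6 + (r + r) ≡ 3 + r + (3 + r)
        sol = solve-∀
        f₀ : f c 0 ≡ xᵣ
        f₀ = trans (on 0 z≤n) u-end
        fₑ : f c (3 + r) ≡ u (3 + r)
        fₑ = trans (on (3 + r) ≤-refl) (cong u (trans (cong (_∸ (3 + r)) (sol r)) (m+n∸n≡m (3 + r) (3 + r))))
        closed : f c (3 + κ) ≡ xᵣ
        closed = trans (cong (f c) (sym (+-identityʳ (3 + κ)))) (trans (per c 0) f₀)
        by : 3 + κ < 5 + r ⊎ κ ≡ 5 + (r + r) → NeighbourU (2 + r) (f c (4 + r)) → ⊥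
        by _ (toQ _ _ _ _ e _) = subst NoQ e (ok c (4 + r)) tt
        by _ (lo e) = avoids-left c (4 + r) (1 + r) ≤-refl e
        by _ (hi e) = skip≢ c (2 + r) (trans e (sym (trans (on (2 + r) (n≤1+n _))
                        (cong u (trans (cong (_∸ (2 + r)) (sol′ r)) (m+n∸n≡m (4 + r) (2 + r)))))))
          where
          sol′ : ∀ r → 6 + (r + r) ≡ 4 + r + (2 + r)
          sol′ = solve-∀
        by (inj₁ k<t) (mid _ e) with m≤n⇒m<n∨m≡n (≤-pred k<t)
        ... | inj₁ k≤ = u≢xᵣ _ (m∸n≤m (suc top) (2 + κ)) (trans (sym (on (3 + κ) (≤-pred k≤))) closed)
        ... | inj₂ refl = old≢ 1 (s≤s z≤n) (s≤s z≤n) refl (trans (sym closed) e)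
        by (inj₂ refl) (mid _ e) = chord₀ c refl (4 + r) (s≤s (s≤s z≤n)) (≤-by (2 + r) (sol″ r))
            (subst₂ EAdj (sym f₀) (sym e) (EAdj-sym xₘ xᵣ (step (2 + x))))
          where
          sol″ : ∀ r → 4 + r + 2 + (2 + r) ≡ 3 + (5 + (r + r))
          sol″ = solve-∀

      avoids-right : (c : Cyc) → ∀ y j → j ≤ 1 + r → f c y ≢ u-reversed (suc j)
      avoids-right c y j le e with ear forced-r c j (s≤s (s≤s le)) y e
      ... | c′ , on = right-impossible c′ on

      -- With both halves gone, `xₘ` is the only neighbour left to y.
      avoids-middle : (c : Cyc) → ∀ y → f c y ≢ u (3 + r)
      avoids-middle c y e = by (neighbour-u (2 + r) 2+r≤top (f c (suc y)) (after c y e))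
                               (neighbour-u (2 + r) 2+r≤top (f c (before c y)) (before-to c y e))
        where
        right : ∀ z → f c z ≢ u (4 + r)
        right z e = avoids-right c z (1 + r) ≤-refl (trans e (cong u (sym (trans (cong (_∸ (2 + r)) (sol r)) (m+n∸n≡m (4 + r) (2 + r))))))
          where
          sol : ∀ r → 6 + (r + r) ≡ 4 + r + (2 + r)
          sol = solve-∀
        by : NeighbourU (2 + r) (f c (suc y)) → NeighbourU (2 + r) (f c (before c y)) → ⊥
        by (lo e) _ = avoids-left c _ (1 + r) ≤-refl e
        by (hi e) _ = right _ e
        by (toQ _ _ _ _ e _) _ = subst NoQ e (ok c _) tt
        by _ (lo e) = avoids-left c _ (1 + r) ≤-refl e
        by _ (hi e) = right _ e
        by _ (toQ _ _ _ _ e _) = subst NoQ e (ok c _) tt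
        by (mid _ e) (mid _ e′) = before≢after c y (trans e′ (sym e))

      avoids : (c : Cyc) → ∀ y a .(a≤ : a ≤ top) → f c y ≢ P a a≤
      avoids c y a a≤ e with <-cmp a (2 + r)
      ... | tri< lt _ _ = avoids-left c y a (≤-pred lt) (trans e (sym (u-P a a≤)))
      ... | tri≈ _ refl _ = avoids-middle c y (trans e (sym (u-P a a≤)))
      ... | tri> _ _ gt = avoids-right c y (top ∸ a) (subst (top ∸ a ≤_) (trans (cong (_∸ (3 + r)) (sol r)) (m+n∸n≡m (1 + r) (3 + r))) (∸-monoʳ-≤ top gt))
          (trans e (trans (sym (u-P a a≤)) (cong u (sym (trans (+-∸-assoc 1 (m∸n≤m top a)) (cong suc (m∸[m∸n]≡n a≤′)))))))
        where
        a≤′ : a ≤ top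
        a≤′ = recompute (a ≤? top) a≤
        sol : ∀ r → 4 + (r + r) ≡ 1 + r + (3 + r)
        sol = solve-∀

  no-Q : ∀ {κ} (c : Cycle r EAdj (λ _ → ⊤) κ) → ∀ y → NoQ (f c y)
  no-Q c y with f c y in e
  ... | old _ = λ ()
  ... | pv _ _ _ _ _ = λ ()
  ... | qv p p< Jp b b≤ with R.lift m (recompute (p <? L m) p<)
  ...   | x , refl = λ _ → AvoidQ.avoids x Jp c y b b≤ e

  no-P : ∀ {κ} (c : Cycle r EAdj NoQ κ) → ∀ y → IsOld (f c y)
  no-P c y with f c y in e
  ... | old _ = tt
  ... | qv p p< Jp b b≤ = ⊥-elim (subst NoQ e (ok c y) tt)
  ... | pv p p< Sp a a≤ with R.lift m (recompute (p <? L m) p<)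
  ...   | x , refl = ⊥-elim (AvoidP.avoids x Sp c y a (subst (a ≤_) top≡ a≤) e)

  old-part : ∀ z → IsOld z → ∃ λ w → z ≡ old′ w
  old-part (old w) _ = w , refl

  no-territory-cycle : ∀ {κ} → Cycle r EAdj (λ _ → ⊤) κ → ⊥
  no-territory-cycle {κ} c = no-layered-cycle r m m ≤-refl record
    { f = g
    ; per = λ x → old-injective (trans (sym (g≡ (3 + κ + x))) (trans (per c x) (g≡ x)))
    ; inj = λ x d 0<d d<k e → inj c x d 0<d d<k (trans (g≡ (d + x)) (trans (cong old e) (sym (g≡ x))))
    ; adj = λ x → subst₂ EAdj (g≡ x) (g≡ (suc x)) (adj c x)
    ; ok = λ x → lay≤′ (g x)
    ; size = size c
    ; chordless = λ e x d 2≤d d≤ a → chordless c e x d 2≤d d≤ (subst₂ EAdj (sym (g≡ x)) (sym (g≡ (d + x))) a)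
    }
    where
    c′ : Cycle r EAdj NoQ κ
    c′ = record { f = f c ; per = per c ; inj = inj c ; adj = adj c ; size = size c ; chordless = chordless c
                ; ok = no-Q c }
    g : ℕ → TmV t m
    g x = proj₁ (old-part (f c x) (no-P c′ x))
    g≡ : ∀ x → f c x ≡ old′ (g x)
    g≡ x = proj₂ (old-part (f c x) (no-P c′ x))
    old-injective : ∀ {w w′} → old′ w ≡ old′ w′ → w ≡ w′
    old-injective refl = refl

-- Walks along the perimeter

-- The index is only an upper bound for the length.
data Walk {V : Set} (E : V → V → Set) (B : V → Set) : ℕ → V → V → Set where
  stay : ∀ {n x} → B x → Walk E B n x x
  go : ∀ {n x y z} → B x → E x y → Walk E B n y z → Walk E B (suc n) x z

module _ {V : Set} {E : V → V → Set} {B : V → Set} where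

  weaken : ∀ {n n′ x y} → n ≤ n′ → Walk E B n x y → Walk E B n′ x y
  weaken _ (stay b) = stay b
  weaken (s≤s le) (go b e w) = go b e (weaken le w)

  join : ∀ {n n′ x y z} → Walk E B n x y → Walk E B n′ y z → Walk E B (n + n′) x z
  join {n} {n′} (stay _) w = weaken (m≤n+m n′ n) w
  join (go b e w) w′ = go b e (join w w′)

  walk-start : ∀ {n x y} → Walk E B n x y → B x
  walk-start (stay b) = b
  walk-start (go b _ _) = b

  walk-end : ∀ {n x y} → Walk E B n x y → B y
  walk-end (stay b) = b
  walk-end (go _ _ w) = walk-end w

  backwards : (∀ x y → E x y → E y x) → ∀ {n x y} → Walk E B n x y → Walk E B n y x
  backwards sy (stay b) = stay b
  backwards sy {suc n} {x} {z} (go {y = y} b e w) = subst (λ k → Walk E B k z x) (+-comm n 1)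
    (join (backwards sy w) (go (walk-start w) (sy x y e) (stay b)))

module Projection (r m : ℕ) (S J : ℕ → Bool) (valid : ValidExp (5 + r) m S J) where
  open Layers r m hiding (V; Adj; Adj-sym)
  open Layer m ≤-refl using (vx; step)
  open Expansion r m S J valid
  open Elimination r m S J valid

  EB : EV → Set
  EB = ExpB t m S J

  BW : ℕ → EV → EV → Set
  BW = Walk EAdj EB

  -- The length of `R_p` for p in `J`: four connecting edges and three stretches of t - 4 edges. For
  -- the other p in `S` the length is only 2t - 4.
  K : ℕ
  K = 7 + 3 * r

  module Around (x : ℕ) .(Sp : S (md m (2 + x)) ≡ true) where
    open Patch x Sp
    open Mid x Sp

    Sp′ : S (md m (2 + x)) ≡ true
    Sp′ = recompute (S (md m (2 + x)) ≟ᵇ true) Sp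

    sides : S (md m (1 + x)) ≡ false × S (md m (3 + x)) ≡ false
    sides = off _ (λ e → proj₁ valid _ _ (md< m (1 + x)) (md< m (2 + x)) (R.arc-% m (1 + x)) e Sp′) ,
            off _ (λ e → proj₁ valid _ _ (md< m (2 + x)) (md< m (3 + x)) (R.arc-% m (2 + x)) Sp′ e)
      where
      off : ∀ b → (b ≡ true → ⊥) → b ≡ false
      off true h = ⊥-elim (h refl)
      off false _ = refl

    B-u : ∀ j → j ≤ 2 + top → (j ≡ 3 + r → J p ≡ false) → EB (u j)
    B-u zero _ _ = refl , proj₁ sides
    B-u (suc j) (s≤s le) h with m≤n⇒m<n∨m≡n le
    ... | inj₁ j≤ = subst EB (sym (u-P j (≤-pred j≤))) λ { (e , refl) → true≢false (trans (sym e) (h refl)) }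
      where
      true≢false : true ≡ false → ⊥
      true≢false ()
    ... | inj₂ refl = subst EB (sym u-end) (refl , proj₂ sides)

    u-step : ∀ j → j ≤ suc top → EAdj (u j) (u (suc j))
    u-step zero _ = subst (EAdj xₗ) (sym (u-P 0 z≤n)) (inj₁ (refl , inj₁ (R.arc-% m (1 + x) , refl)))
    u-step (suc j) (s≤s le) with m≤n⇒m<n∨m≡n le
    ... | inj₁ j< = subst₂ EAdj (sym (u-P j le)) (sym (u-P (suc j) j<)) (inj₁ (refl , refl))
    ... | inj₂ refl = subst₂ EAdj (sym (u-P j le)) (sym u-end) (inj₁ (refl , R.arc-% m (2 + x) , sym top≡))

    along-u : ∀ n i → n + i ≤ 2 + top → (∀ j → i ≤ j → j ≤ n + i → j ≡ 3 + r → J p ≡ false) → BW n (u i) (u (n + i))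
    along-u zero i le h = stay (B-u i le (h i ≤-refl ≤-refl))
    along-u (suc n) i le h = go (B-u i (≤-trans (m≤n+m i (suc n)) le) (h i ≤-refl (m≤n+m i (suc n))))
      (u-step i (≤-pred (≤-trans (m<n+m i z<s) le)))
      (subst (BW n (u (suc i))) (cong u (+-suc n i)) (along-u n (suc i) (subst (_≤ 2 + top) (sym (+-suc n i)) le)
        λ j i< j≤ → h j (≤-trans (n≤1+n i) i<) (subst (j ≤_) (+-suc n i) j≤)))

    to-left : ∀ j → j ≤ 2 + r → BW K xₗ (u j)
    to-left j le = weaken (≤-trans le (≤-by (5 + 2 * r) (solve r)))
      (subst (λ i → BW j xₗ (u i)) (+-identityʳ j) (along-u j 0 (subst (_≤ 2 + top) (sym (+-identityʳ j)) (≤-trans le (≤-by (4 + r) (solve′ r))))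
        λ { i _ i≤ refl → ⊥-elim (1+n≰n (≤-trans (subst (3 + r ≤_) (+-identityʳ j) i≤) le)) }))
      where
      solve : ∀ r → 2 + r + (5 + 2 * r) ≡ 7 + 3 * r
      solve = solve-∀
      solve′ : ∀ r → 2 + r + (4 + r) ≡ 6 + (r + r)
      solve′ = solve-∀

    module _ (Jp : J p ≡ true) where
      open AvoidQ x Jp hiding (impossible; avoids)

      Q-step : ∀ b → b ≤ 2 + r → EAdj (v b) (v (suc b))
      Q-step zero _ = subst₂ EAdj (sym (u-P (1 + r) 1+r≤top)) (sym (v-Q 0 z≤n)) (inj₁ (refl , inj₁ (refl , refl)))
      Q-step (suc b) (s≤s le) with m≤n⇒m<n∨m≡n le
      ... | inj₁ b< = subst₂ EAdj (sym (v-Q b le)) (sym (v-Q (suc b) b<)) (inj₁ (refl , refl))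
      ... | inj₂ refl = subst₂ EAdj (sym (v-Q b le)) (sym (trans v-end (u-P (3 + r) 3+r≤top))) (inj₂ (refl , inj₂ (refl , refl)))

      B-v : ∀ b → b ≤ 2 + r → EB (v b)
      B-v zero _ = B-u (2 + r) (≤-trans (m≤n⇒m≤1+n 2+r≤top) (n≤1+n _)) λ e → ⊥-elim (<⇒≢ ≤-refl e)
      B-v (suc b) (s≤s le) = subst EB (sym (v-Q b le)) tt

      along-v : ∀ b → b ≤ 3 + r → BW b (v 0) (v b)
      along-v zero _ = stay (B-v 0 z≤n)
      along-v (suc b) (s≤s le) = subst (λ n → BW n (v 0) (v (suc b))) (+-comm b 1)
        (join (along-v b (m≤n⇒m≤1+n le)) (go (B-v b le) (Q-step b le) (stay (last b le))))
        where
        last : ∀ b → b ≤ 2 + r → EB (v (suc b))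
        last b le with m≤n⇒m<n∨m≡n le
        ... | inj₁ b< = B-v (suc b) b<
        ... | inj₂ refl = subst EB (sym v-end) (B-u (4 + r) (s≤s (m≤n⇒m≤1+n 3+r≤top)) λ e → ⊥-elim (<⇒≢ (n<1+n _) (sym e)))

      to-Q : ∀ b → b ≤ 3 + r → BW (5 + 2 * r) xₗ (v b)
      to-Q b le = weaken (≤-trans (+-monoʳ-≤ (2 + r) le) (≤-reflexive (solve r)))
        (join (subst (λ i → BW (2 + r) xₗ (u i)) (+-identityʳ (2 + r)) (along-u (2 + r) 0 (≤-by (4 + r) (solve′ r))
          λ { j _ j≤ refl → ⊥-elim (1+n≰n (subst (3 + r ≤_) (+-identityʳ (2 + r)) j≤)) })) (along-v b le))
        where
        solve : ∀ r → 2 + r + (3 + r) ≡ 5 + 2 * r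
        solve = solve-∀
        solve′ : ∀ r → 2 + r + 0 + (4 + r) ≡ 6 + (r + r)
        solve′ = solve-∀

      to-right : ∀ n → n ≤ 2 + r → BW K xₗ (u (n + (4 + r)))
      to-right n le = weaken (≤-trans (+-monoʳ-≤ (5 + 2 * r) le) (≤-reflexive (solve r)))
        (join (subst (BW (5 + 2 * r) xₗ) v-end (to-Q (3 + r) ≤-refl)) (along-u n (4 + r) (subst (n + (4 + r) ≤_) (solve′ r) (+-monoˡ-≤ (4 + r) le))
          λ { j i≤ _ refl → ⊥-elim (1+n≰n i≤) }))
        where
        solve : ∀ r → 5 + 2 * r + (2 + r) ≡ 7 + 3 * r
        solve = solve-∀
        solve′ : ∀ r → 2 + r + (4 + r) ≡ 6 + (r + r)
        solve′ = solve-∀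

    -- Where p lies in `J`, the perimeter misses y, and the vertices beyond it are reached by the
    -- detour along `Q`.
    reach-u : ∀ j → j ≤ 2 + top → (j ≡ 3 + r → J p ≡ false) → BW K xₗ (u j)
    reach-u j le h with J p in eq
    ... | false = weaken (≤-trans le (≤-by (1 + r) (solve r)))
      (subst (λ i → BW j xₗ (u i)) (+-identityʳ j) (along-u j 0 (subst (_≤ 2 + top) (sym (+-identityʳ j)) le) λ _ _ _ _ → eq))
      where
      solve : ∀ r → 6 + (r + r) + (1 + r) ≡ 7 + 3 * r
      solve = solve-∀
    ... | true with <-cmp j (3 + r)
    ...   | tri< lt _ _ = to-left j (≤-pred lt)
    ...   | tri≈ _ refl _ with h refl
    ...     | ()
    reach-u j le h | true | tri> _ _ gt = subst (λ i → BW K xₗ (u i)) (m∸n+n≡m gt)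
      (to-right eq (j ∸ (4 + r)) (subst (j ∸ (4 + r) ≤_) (trans (cong (_∸ (4 + r)) (solve r)) (m+n∸n≡m (2 + r) (4 + r))) (∸-monoˡ-≤ (4 + r) le)))
      where
      solve : ∀ r → 6 + (r + r) ≡ 2 + r + (4 + r)
      solve = solve-∀

    across : BW K xₗ xᵣ
    across = subst (BW K xₗ) u-end (reach-u (2 + top) ≤-refl λ e → ⊥-elim (<⇒≢ (≤-by (2 + r) (solve r)) (sym e)))
      where
      solve : ∀ r → suc (3 + r) + (2 + r) ≡ 6 + (r + r)
      solve = solve-∀

-- Radial projection onto the perimeter

module Perimeter (r m : ℕ) (S J : ℕ → Bool) (valid : ValidExp (5 + r) m S J) where
  open Layers r m hiding (V; Adj; Adj-sym)
  open Layer m ≤-refl using (vx; step)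
  open Expansion r m S J valid
  open Elimination r m S J valid
  open Projection r m S J valid

  md-+ : ∀ k {n n′} → md m n ≡ md m n′ → md m (n + k) ≡ md m (n′ + k)
  md-+ k {n} {n′} e = trans (%-distribˡ-+ n k (L m) {{nzL m}})
    (trans (cong (λ i → _%_ (i + md m k) (L m) {{nzL m}}) e) (sym (%-distribˡ-+ n′ k (L m) {{nzL m}})))

  1≤L : 1 ≤ L m
  1≤L = ≤-trans (s≤s z≤n) (5≤L m)

  bool-cases : ∀ b → b ≡ true ⊎ b ≡ false
  bool-cases true = inj₁ refl
  bool-cases false = inj₂ refl

  -- the perimeter vertex representing position n of B_m: n itself, or its predecessor when n ∈ S
  β-if : Bool → ℕ → EV
  β-if true n = old (vx (n + (L m ∸ 1)))
  β-if false n = old (vx n)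

  β : ℕ → EV
  β n = β-if (S (md m n)) n

  β-cong : ∀ {n n′} → md m n ≡ md m n′ → β n ≡ β n′
  β-cong {n} {n′} e = trans (cong (λ q → β-if (S q) n) e) (by (S (md m n′)))
    where
    by : ∀ b → β-if b n ≡ β-if b n′
    by true = cong old (tv-≡ (md-+ (L m ∸ 1) e))
    by false = cong old (tv-≡ e)

  β-in : ∀ x → S (md m (2 + x)) ≡ true → β (2 + x) ≡ old (vx (1 + x))
  β-in x e = trans (cong (λ b → β-if b (2 + x)) e) (cong old (tv-≡ (trans (cong (md m) eq) ([m+n]%n≡m%n (1 + x) (L m) {{nzL m}}))))
    where
    eq : 2 + x + (L m ∸ 1) ≡ 1 + x + L m
    eq = trans (sym (+-suc (1 + x) (L m ∸ 1))) (cong (1 + x +_) (m+[n∸m]≡n 1≤L))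

  β-out : ∀ n → S (md m n) ≡ false → β n ≡ old (vx n)
  β-out n e = cong (λ b → β-if b n) e

  -- A position in `S` is represented by its predecessor, so the step onto it is empty and the step
  -- off it traverses all of `R_p`.
  β-step : ∀ x → BW K (β (2 + x)) (β (3 + x))
  β-step x with bool-cases (S (md m (2 + x))) | bool-cases (S (md m (3 + x)))
  ... | inj₁ e | _ = subst₂ (BW K) (sym (β-in x e)) (sym (β-out (3 + x) (proj₂ (Around.sides x e)))) (Around.across x e)
  ... | inj₂ e | inj₁ e′ = subst₂ (BW K) (sym (β-out (2 + x) e)) (sym (β-in (1 + x) e′)) (stay (refl , e))
  ... | inj₂ e | inj₂ e′ = subst₂ (BW K) (sym (β-out (2 + x) e)) (sym (β-out (3 + x) e′))
        (go {y = old (vx (3 + x))} (refl , e) (step (2 + x)) (stay (refl , e′)))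

  β-steps : ∀ d x → BW (d * K) (β (2 + x)) (β (2 + (d + x)))
  β-steps zero x = stay (walk-start (β-step x))
  β-steps (suc d) x = subst (λ n → BW n (β (2 + x)) (β (3 + (d + x)))) (+-comm (d * K) K)
    (join (β-steps d x) (β-step (d + x)))

  β-walk : ∀ {n n′} d → md m n′ ≡ md m (d + n) → BW (d * K) (β n) (β n′)
  β-walk {n} {n′} d e with R.lift m (md< m n)
  ... | x , e′ = subst₂ (BW (d * K)) (β-cong e′) (β-cong (trans (trans (cong (md m) (shift d x)) (md-+ d e′)) (trans (cong (md m) (+-comm n d)) (sym e))))
        (β-steps d x)
    where
    shift : ∀ d x → 2 + (d + x) ≡ 2 + x + d
    shift d x = cong (2 +_) (+-comm d x)

  -- Radial projection to positions of `B_m`: each layer outwards multiplies the position by `τ`,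
  -- and the paths at p are collapsed to p.
  ρ depth : EV → ℕ
  ρ (old u) = pos u * τ ^ (m ∸ lay u)
  ρ (pv p _ _ _ _) = p
  ρ (qv p _ _ _ _) = p
  depth (old u) = m ∸ lay u
  depth _ = 0

  τ^-mono : ∀ {i j} → i ≤ j → τ ^ i ≤ τ ^ j
  τ^-mono le = ^-monoʳ-≤ τ le

  L-top : ∀ ℓ → ℓ ≤ m → L ℓ * τ ^ (m ∸ ℓ) ≡ L m
  L-top ℓ le = trans (*-assoc t (τ ^ ℓ) (τ ^ (m ∸ ℓ))) (cong (t *_) (trans (sym (^-distribˡ-+-* τ ℓ (m ∸ ℓ))) (cong (τ ^_) (m+[n∸m]≡n le))))

  md-0 : md m (L m) ≡ 0
  md-0 = n%n≡0 (L m) {{nzL m}}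

  zero-md : md m 0 ≡ 0
  zero-md = m<n⇒m%n≡m {{nzL m}} 1≤L

  arc-md : ∀ {p q} → q < L m → CycArc (L m) p q → md m q ≡ md m (1 + p)
  arc-md q< (inj₁ refl) = refl
  arc-md q< (inj₂ (e , refl)) = trans zero-md (sym (trans (cong (md m) e) md-0))

  record Close (D n n′ : ℕ) : Set where
    constructor close
    field
      gap : ℕ
      gap≤ : gap ≤ D
      gap≡ : md m n′ ≡ md m (gap + n)

  same : ∀ {D n n′} → n ≡ n′ → Close D n n′
  same e = close 0 z≤n (cong (md m) (sym e))

  unit : ∀ {D n n′} → 1 ≤ D → md m n′ ≡ md m (1 + n) → Close D n n′
  unit 1≤D e = close 1 1≤D e

  ρ-base : (u : TmV t m) → lay u ≡ m → pos u * τ ^ (m ∸ lay u) ≡ pos u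
  ρ-base u refl = trans (cong (λ i → pos u * τ ^ i) (n∸n≡0 m)) (*-identityʳ (pos u))

  -- An edge within a layer spans `τ` to the power of its depth, an edge between layers spans
  -- nothing, and the edges at the added paths span at most one position.
  arc-close : ∀ D z z′ → depth z ≤ D → ExpArc t m S J z z′ → Close (τ ^ D) (ρ z) (ρ z′)
  arc-close D (old u) (old w) le (inj₁ (e , inj₁ e′)) = close (τ ^ (m ∸ lay u)) (τ^-mono le) (
    cong (md m) (cong₂ (λ p ℓ → p * τ ^ (m ∸ ℓ)) (sym e′) (sym e)))
  arc-close D (old u) (old w) le (inj₁ (e , inj₂ (e′ , e″))) = close (τ ^ (m ∸ lay u)) (τ^-mono le) (
    trans (cong (md m) (cong (_* τ ^ (m ∸ lay w)) e″))
      (sym (trans (cong (md m) (trans (cong (_* τ ^ (m ∸ lay u)) e′) (L-top (lay u) (lay≤′ u)))) (trans md-0 (sym zero-md)))))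
  arc-close D (old u) (old w) le (inj₂ (e , e′)) = same (sym (trans (cong (_* τ ^ (m ∸ lay w)) e′)
    (trans (*-assoc (pos u) τ _) (cong (λ i → pos u * τ ^ i)
      (trans (cong (λ ℓ → suc (m ∸ ℓ)) (sym e)) (sym (+-∸-assoc 1 (subst (_≤ m) (sym e) (lay≤′ w)))))))))
  arc-close D (old u) (pv p p< _ a _) le (e , inj₁ (c , _)) =
    unit (τ^-pos D) (trans (arc-md (recompute (p <? L m) p<) c) (cong (λ i → md m (suc i)) (sym (ρ-base u e))))
  arc-close D (old u) (pv p _ _ a _) le (e , inj₂ (e′ , _)) = same (trans (ρ-base u e) e′)
  arc-close D (pv p _ _ a _) (old u) le (e , c , _) = unit (τ^-pos D) (trans (cong (md m) (ρ-base u e)) (arc-md (subst (λ ℓ → pos u < L ℓ) e (pos<′ u)) c))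
  arc-close D (pv p _ _ a _) (pv p′ _ _ a′ _) le (e , _) = same e
  arc-close D (pv p _ _ a _) (qv p′ _ _ b _) le (e , _) = same e
  arc-close D (qv p _ _ a _) (qv p′ _ _ b _) le (e , _) = same e

  depth-arc : ∀ z z′ → ExpArc t m S J z z′ → depth z′ ≤ suc (depth z) × depth z ≤ suc (depth z′)
  depth-arc (old u) (old w) (inj₁ (e , _)) = ≤-trans (≤-reflexive (cong (m ∸_) (sym e))) (n≤1+n _) , ≤-trans (≤-reflexive (cong (m ∸_) e)) (n≤1+n _)
  depth-arc (old u) (old w) (inj₂ (e , _)) =
    ≤-trans (∸-monoʳ-≤ m (≤-trans (n≤1+n _) (≤-reflexive e))) (n≤1+n _) ,
    ≤-trans (m∸n≤m∸sn m (lay u)) (s≤s (≤-reflexive (cong (m ∸_) e)))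
    where
    m∸n≤m∸sn : ∀ m n → m ∸ n ≤ suc (m ∸ suc n)
    m∸n≤m∸sn zero zero = z≤n
    m∸n≤m∸sn zero (suc n) = z≤n
    m∸n≤m∸sn (suc m) zero = ≤-refl
    m∸n≤m∸sn (suc m) (suc n) = m∸n≤m∸sn m n
  depth-arc (old u) (pv _ _ _ _ _) (e , _) = z≤n , ≤-trans (≤-reflexive (trans (cong (m ∸_) e) (n∸n≡0 m))) z≤n
  depth-arc (pv _ _ _ _ _) (old u) (e , _) = ≤-trans (≤-reflexive (trans (cong (m ∸_) e) (n∸n≡0 m))) z≤n , z≤n
  depth-arc (pv _ _ _ _ _) (pv _ _ _ _ _) _ = z≤n , z≤n
  depth-arc (pv _ _ _ _ _) (qv _ _ _ _ _) _ = z≤n , z≤n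
  depth-arc (qv _ _ _ _ _) (qv _ _ _ _ _) _ = z≤n , z≤n

  depth-step : ∀ z z′ → EAdj z z′ → depth z′ ≤ suc (depth z)
  depth-step z z′ (inj₁ a) = proj₁ (depth-arc z z′ a)
  depth-step z z′ (inj₂ a) = proj₂ (depth-arc z′ z a)

  edge-walk : ∀ D z z′ → depth z ≤ D → depth z′ ≤ D → EAdj z z′ → BW (τ ^ D * K) (β (ρ z)) (β (ρ z′))
  edge-walk D z z′ le le′ (inj₁ a) with arc-close D z z′ le a
  ... | close d d≤ e = weaken (*-monoˡ-≤ K d≤) (β-walk d e)
  edge-walk D z z′ le le′ (inj₂ a) with arc-close D z′ z le′ a
  ... | close d d≤ e = weaken (*-monoˡ-≤ K d≤) (backwards EAdj-sym (β-walk d e))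

  to-perimeter : ∀ z → EB z → BW K (β (ρ z)) z
  to-perimeter (old u@(tv _ _ p p<)) (refl , e) =
    subst (λ w → BW K w (old u)) (sym (trans (β-cong (cong (md m) (ρ-base u refl))) (trans (β-out p (trans (cong S p%) e)) (cong old (tv-≡ p%)))))
      (stay (refl , e))
    where
    p% : md m p ≡ p
    p% = m<n⇒m%n≡m {{nzL m}} (recompute (p <? L m) p<)
  to-perimeter (pv p p< Sp a a≤) b with R.lift m (recompute (p <? L m) p<)
  ... | x , refl = subst₂ (BW K) (sym (trans (β-cong (m%n%n≡m%n (2 + x) (L m) {{nzL m}})) (β-in x (Around.Sp′ x Sp))))
        (Patch.u-P x Sp a a≤′)
        (Around.reach-u x Sp (suc a) (s≤s (m≤n⇒m≤1+n a≤′)) λ e → ¬true (λ Jp → b (Jp , suc-injective e)))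
    where
    a≤′ : a ≤ top
    a≤′ = subst (a ≤_) top≡ (recompute (a ≤? _) a≤)
    ¬true : ∀ {b} → (b ≡ true → ⊥) → b ≡ false
    ¬true {true} h = ⊥-elim (h refl)
    ¬true {false} _ = refl
  to-perimeter (qv p p< Jp b b≤) _ with R.lift m (recompute (p <? L m) p<)
  ... | x , refl = subst₂ (BW K) (sym (trans (β-cong (m%n%n≡m%n (2 + x) (L m) {{nzL m}})) (β-in x (Around.Sp′ x Sp))))
        (AvoidQ.v-Q x Jp b b≤)
        (weaken (≤-by (2 + r) (solve r)) (Around.to-Q x Sp (recompute (J (md m (2 + x)) ≟ᵇ true) Jp) (suc b) (s≤s (m≤n⇒m≤1+n (recompute (b ≤? 1 + r) b≤)))))
    where
    Sp = proj₂ valid (md m (2 + x)) (recompute (J (md m (2 + x)) ≟ᵇ true) Jp)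
    solve : ∀ r → 5 + 2 * r + (2 + r) ≡ 7 + 3 * r
    solve = solve-∀

  -- Since the path starts at depth 0 and depth changes by at most 1 per edge, each edge spans at
  -- most `τ ^ s` positions, worth at most `K` steps each. The two outer `K` lead from the
  -- projections to the actual ends. The number `m` of layers does not enter.
  perimeter-walk : (z : ℕ → EV) (s : ℕ) → (∀ i → i < s → EAdj (z i) (z (suc i))) → EB (z 0) → EB (z s) →
                   BW (K + (s * (τ ^ s * K) + K)) (z 0) (z s)
  perimeter-walk z s adj b₀ bₛ = join (backwards EAdj-sym (to-perimeter (z 0) b₀))
    (join (prefix s ≤-refl) (to-perimeter (z s) bₛ))
    where
    depth₀ : ∀ z → EB z → depth z ≡ 0
    depth₀ (old u) (e , _) = trans (cong (m ∸_) e) (n∸n≡0 m)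
    depth₀ (pv _ _ _ _ _) _ = refl
    depth₀ (qv _ _ _ _ _) _ = refl
    depth≤ : ∀ i → i ≤ s → depth (z i) ≤ i
    depth≤ zero _ = ≤-reflexive (depth₀ (z 0) b₀)
    depth≤ (suc i) le = ≤-trans (depth-step (z i) (z (suc i)) (adj i le)) (s≤s (depth≤ i (≤-trans (n≤1+n i) le)))
    prefix : ∀ i → i ≤ s → BW (i * (τ ^ s * K)) (β (ρ (z 0))) (β (ρ (z i)))
    prefix zero _ = stay (walk-start (to-perimeter (z 0) b₀))
    prefix (suc i) le = subst (λ n → BW n (β (ρ (z 0))) (β (ρ (z (suc i))))) (+-comm (i * (τ ^ s * K)) (τ ^ s * K))
      (join (prefix i i≤) (edge-walk s (z i) (z (suc i)) (≤-trans (depth≤ i i≤) i≤) (≤-trans (depth≤ (suc i) le) le) (adj i le)))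
      where
      i≤ : i ≤ s
      i≤ = ≤-trans (n≤1+n i) le

-- The 3-edge-colouring of Γ

-- Kept opaque: at t = 5 + r the power would unfold without end.
abstract
  girth-bound : ℕ → ℕ
  girth-bound t = t ^ (5 * t)

  girth-bound≡ : ∀ t → girth-bound t ≡ t ^ (5 * t)
  girth-bound≡ t = refl

module Colouring {t : ℕ} {U : Set} (C : Construction t U) where
  open Construction C

  M : Fin 3 → Fin n → Fin n → Set
  M = Mrel n A h M₁ M₂

  private
    partner₁ partner₂ : Fin n → Fin n
    partner₁ v = proj₁ (proj₂ (proj₂ M₁-pm) v)
    partner₂ v = proj₁ (proj₂ (proj₂ M₂-pm) v)

    is₁ : ∀ v → M₁ v (partner₁ v)
    is₁ v = proj₁ (proj₂ (proj₂ (proj₂ M₁-pm) v))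
    is₂ : ∀ v → M₂ v (partner₂ v)
    is₂ v = proj₁ (proj₂ (proj₂ (proj₂ M₂-pm) v))

    unique₁ : ∀ {v w} → M₁ v w → w ≡ partner₁ v
    unique₁ {v} = proj₂ (proj₂ (proj₂ (proj₂ M₁-pm) v)) _
    unique₂ : ∀ {v w} → M₂ v w → w ≡ partner₂ v
    unique₂ {v} = proj₂ (proj₂ (proj₂ (proj₂ M₂-pm) v)) _

    Third : Fin n → Set
    Third v = Σ (Fin n) λ w → A v w × w ≢ partner₁ v × w ≢ partner₂ v ×
                (∀ w′ → A v w′ → w′ ≡ partner₁ v ⊎ w′ ≡ partner₂ v ⊎ w′ ≡ w)

    third : ∀ v → Third v
    third v with cubic v
    ... | a , b , c , a≢b , a≢c , b≢c , va , vb , vc , all =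
        by (all (partner₁ v) (proj₁ M₁-pm v _ (is₁ v))) (all (partner₂ v) (proj₁ M₂-pm v _ (is₂ v)))
      where
      p≢q : partner₁ v ≢ partner₂ v
      p≢q e = M-disj v _ (is₁ v) (subst (M₂ v) (sym e) (is₂ v))
      by : partner₁ v ≡ a ⊎ partner₁ v ≡ b ⊎ partner₁ v ≡ c → partner₂ v ≡ a ⊎ partner₂ v ≡ b ⊎ partner₂ v ≡ c → Third v
      by (inj₁ p) (inj₁ q) = ⊥-elim (p≢q (trans p (sym q)))
      by (inj₂ (inj₁ p)) (inj₂ (inj₁ q)) = ⊥-elim (p≢q (trans p (sym q)))
      by (inj₂ (inj₂ p)) (inj₂ (inj₂ q)) = ⊥-elim (p≢q (trans p (sym q)))
      by (inj₁ p) (inj₂ (inj₁ q)) rewrite p | q = c , vc , ≢-sym a≢c , ≢-sym b≢c , all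
      by (inj₂ (inj₁ p)) (inj₁ q) rewrite p | q = c , vc , ≢-sym b≢c , ≢-sym a≢c , λ w vw → swap₁ (all w vw)
        where
        swap₁ : ∀ {w} → w ≡ a ⊎ w ≡ b ⊎ w ≡ c → w ≡ b ⊎ w ≡ a ⊎ w ≡ c
        swap₁ (inj₁ e) = inj₂ (inj₁ e)
        swap₁ (inj₂ (inj₁ e)) = inj₁ e
        swap₁ (inj₂ (inj₂ e)) = inj₂ (inj₂ e)
      by (inj₁ p) (inj₂ (inj₂ q)) rewrite p | q = b , vb , ≢-sym a≢b , b≢c , λ w vw → swap₂ (all w vw)
        where
        swap₂ : ∀ {w} → w ≡ a ⊎ w ≡ b ⊎ w ≡ c → w ≡ a ⊎ w ≡ c ⊎ w ≡ b
        swap₂ (inj₁ e) = inj₁ e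
        swap₂ (inj₂ (inj₁ e)) = inj₂ (inj₂ e)
        swap₂ (inj₂ (inj₂ e)) = inj₂ (inj₁ e)
      by (inj₂ (inj₂ p)) (inj₁ q) rewrite p | q = b , vb , b≢c , ≢-sym a≢b , λ w vw → rot (all w vw)
        where
        rot : ∀ {w} → w ≡ a ⊎ w ≡ b ⊎ w ≡ c → w ≡ c ⊎ w ≡ a ⊎ w ≡ b
        rot (inj₁ e) = inj₂ (inj₁ e)
        rot (inj₂ (inj₁ e)) = inj₂ (inj₂ e)
        rot (inj₂ (inj₂ e)) = inj₁ e
      by (inj₂ (inj₁ p)) (inj₂ (inj₂ q)) rewrite p | q = a , va , a≢b , a≢c , λ w vw → rot (all w vw)
        where
        rot : ∀ {w} → w ≡ a ⊎ w ≡ b ⊎ w ≡ c → w ≡ b ⊎ w ≡ c ⊎ w ≡ a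
        rot (inj₁ e) = inj₂ (inj₂ e)
        rot (inj₂ (inj₁ e)) = inj₁ e
        rot (inj₂ (inj₂ e)) = inj₂ (inj₁ e)
      by (inj₂ (inj₂ p)) (inj₂ (inj₁ q)) rewrite p | q = a , va , a≢c , a≢b , λ w vw → swap₃ (all w vw)
        where
        swap₃ : ∀ {w} → w ≡ a ⊎ w ≡ b ⊎ w ≡ c → w ≡ c ⊎ w ≡ b ⊎ w ≡ a
        swap₃ (inj₁ e) = inj₂ (inj₂ e)
        swap₃ (inj₂ (inj₁ e)) = inj₂ (inj₁ e)
        swap₃ (inj₂ (inj₂ e)) = inj₁ e

    M-partner : ∀ {v w} → ΩE n h v w → w ≡ partner₁ v ⊎ w ≡ partner₂ v
    M-partner {v} {w} o with proj₁ (M-cover v w) o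
    ... | inj₁ a = inj₁ (unique₁ a)
    ... | inj₂ b = inj₂ (unique₂ b)

  -- The other end of the edge of colour `c` at `v`. These three involutions let words in three
  -- letters act on the vertices of Γ; reduced words are walks without backtracking.
  nb : Fin 3 → Fin n → Fin n
  nb 0F v = partner₁ v
  nb 1F v = partner₂ v
  nb 2F v = proj₁ (third v)

  M-nb : ∀ c v → M c v (nb c v)
  M-nb 0F v = is₁ v
  M-nb 1F v = is₂ v
  M-nb 2F v with third v
  ... | w , vw , ≢₁ , ≢₂ , _ = vw , λ o → [ ≢₁ , ≢₂ ]′ (M-partner o)

  M⇒nb : ∀ c {v w} → M c v w → w ≡ nb c v
  M⇒nb 0F m = unique₁ m
  M⇒nb 1F m = unique₂ m
  M⇒nb 2F {v} {w} (vw , ¬o) with third v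
  ... | _ , _ , _ , _ , all with all w vw
  ...   | inj₂ (inj₂ e) = e
  ...   | inj₁ refl = ⊥-elim (¬o (proj₂ (M-cover v w) (inj₁ (is₁ v))))
  ...   | inj₂ (inj₁ refl) = ⊥-elim (¬o (proj₂ (M-cover v w) (inj₂ (is₂ v))))

  M⇒A : ∀ c {v w} → M c v w → A v w
  M⇒A 0F = proj₁ M₁-pm _ _
  M⇒A 1F = proj₁ M₂-pm _ _
  M⇒A 2F = proj₁

  M-sym : ∀ c {v w} → M c v w → M c w v
  M-sym 0F = proj₁ (proj₂ M₁-pm) _ _
  M-sym 1F = proj₁ (proj₂ M₂-pm) _ _
  M-sym 2F {v} {w} (vw , ¬o) = A-sym v w vw , λ o → ¬o (proj₂ (M-cover v w) (flip (proj₁ (M-cover w v) o)))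
    where
    flip : M₁ w v ⊎ M₂ w v → M₁ v w ⊎ M₂ v w
    flip (inj₁ a) = inj₁ (M-sym 0F a)
    flip (inj₂ a) = inj₂ (M-sym 1F a)

  colour : ∀ {v w} → A v w → ∃ λ c → w ≡ nb c v
  colour {v} {w} vw with proj₂ (proj₂ (proj₂ (proj₂ (third v)))) w vw
  ... | inj₁ e = 0F , e
  ... | inj₂ (inj₁ e) = 1F , e
  ... | inj₂ (inj₂ e) = 2F , e

  A-nb : ∀ c v → A v (nb c v)
  A-nb c v = M⇒A c (M-nb c v)

  nb-nb : ∀ c v → nb c (nb c v) ≡ v
  nb-nb c v = sym (M⇒nb c (M-sym c (M-nb c v)))

  nb-colour : ∀ c c′ v → nb c v ≡ nb c′ v → c ≡ c′
  nb-colour 0F 0F v e = refl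
  nb-colour 1F 1F v e = refl
  nb-colour 2F 2F v e = refl
  nb-colour 0F 1F v e = ⊥-elim (M-disj v _ (is₁ v) (subst (M₂ v) (sym e) (is₂ v)))
  nb-colour 1F 0F v e = ⊥-elim (M-disj v _ (is₁ v) (subst (M₂ v) e (is₂ v)))
  nb-colour 0F 2F v e = ⊥-elim (proj₁ (proj₂ (proj₂ (third v))) (sym e))
  nb-colour 2F 0F v e = ⊥-elim (proj₁ (proj₂ (proj₂ (third v))) e)
  nb-colour 1F 2F v e = ⊥-elim (proj₁ (proj₂ (proj₂ (proj₂ (third v)))) (sym e))
  nb-colour 2F 1F v e = ⊥-elim (proj₁ (proj₂ (proj₂ (proj₂ (third v)))) e)

  nb-injective : ∀ c {v w} → nb c v ≡ nb c w → v ≡ w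
  nb-injective c {v} {w} e = trans (sym (nb-nb c v)) (trans (cong (nb c) e) (nb-nb c w))

  Sub-nb : ∀ {i c} v → c ≢ i → Sub n A h M₁ M₂ i v (nb c v)
  Sub-nb {i} {c} v c≢i = A-nb c v , λ m → c≢i (nb-colour c i v (M⇒nb i m))

  Sub-colour : ∀ {i v w} → Sub n A h M₁ M₂ i v w → ∃ λ c → c ≢ i × w ≡ nb c v
  Sub-colour {i} {v} (vw , ¬m) with colour vw
  ... | c , refl = c , (λ { refl → ¬m (M-nb c v) }) , refl

  -- By induction no shorter subwalk closes, so a closed walk has distinct vertices and is a cycle
  -- of Γ below the girth. Length 1 contradicts irreflexivity, and length 2 would be backtracking.
  nonbacktracking-open : ∀ N (p : ℕ → Fin n) (w : ℕ → Fin 3) → (∀ i → i < N → p (suc i) ≡ nb (w i) (p i)) →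
    (∀ i → suc i < N → w i ≢ w (suc i)) → 1 ≤ N → N < girth-bound t → p N ≢ p 0
  nonbacktracking-open = <-rec _ λ N rec p w st red 1≤N N<g → by N rec p w st red 1≤N N<g
    where
    Goal : ℕ → Set
    Goal N = (p : ℕ → Fin n) (w : ℕ → Fin 3) → (∀ i → i < N → p (suc i) ≡ nb (w i) (p i)) →
      (∀ i → suc i < N → w i ≢ w (suc i)) → 1 ≤ N → N < girth-bound t → p N ≢ p 0
    by : ∀ N → (∀ {N′} → N′ < N → Goal N′) → Goal N
    by 1 rec p w st red _ _ e = A-irr _ (subst (A (p 0)) (trans (sym (st 0 (s≤s z≤n))) e) (A-nb (w 0) (p 0)))
    by 2 rec p w st red _ _ e = red 0 (s≤s (s≤s z≤n)) (nb-colour (w 0) (w 1) (p 0) (nb-injective (w 1)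
      (trans (sym (trans (st 1 ≤-refl) (cong (nb (w 1)) (st 0 (s≤s z≤n))))) (trans e (sym (nb-nb (w 1) (p 0)))))))
    by N@(suc (suc (suc N-3))) rec p w st red 1≤N N<g closed =
      girth N (s≤s (s≤s (s≤s z≤n))) (subst (N <_) (girth-bound≡ t) N<g) ((λ a → p (toℕ a)) , inj , adj)
      where
      no-return : ∀ i j → i < j → j < N → p j ≢ p i
      no-return i j i<j j<N e = rec {j ∸ i} (≤-<-trans (m∸n≤m j i) j<N) (λ x → p (x + i)) (λ x → w (x + i))
        (λ x x< → st (x + i) (lt x x<)) (λ x x< → red (x + i) (lt (suc x) x<)) (m<n⇒0<n∸m i<j)
        (≤-<-trans (m∸n≤m j i) (<-trans j<N N<g)) (trans (cong p (m∸n+n≡m (<⇒≤ i<j))) e)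
        where
        lt : ∀ x → x < j ∸ i → x + i < N
        lt x x< = <-trans (subst (x + i <_) (m∸n+n≡m (<⇒≤ i<j)) (+-monoˡ-< i x<)) j<N
      inj : Inj (λ (a : Fin N) → p (toℕ a))
      inj {a} {b} e with <-cmp (toℕ a) (toℕ b)
      ... | tri< lt _ _ = ⊥-elim (no-return (toℕ a) (toℕ b) lt (toℕ<n b) (sym e))
      ... | tri≈ _ a≡b _ = toℕ-injective a≡b
      ... | tri> _ _ gt = ⊥-elim (no-return (toℕ b) (toℕ a) gt (toℕ<n a) e)
      arc : ∀ x y → x < N → CycArc N x y → A (p x) (p y)
      arc x y x< (inj₁ refl) = subst (A (p x)) (sym (st x x<)) (A-nb (w x) (p x))
      arc x y x< (inj₂ (e , refl)) = subst (A (p x)) (trans (sym (st x x<)) (trans (cong p e) closed)) (A-nb (w x) (p x))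
      adj : ∀ a b → CycAdjF N a b → A (p (toℕ a)) (p (toℕ b))
      adj a b (inj₁ x) = arc _ _ (toℕ<n a) x
      adj a b (inj₂ x) = A-sym _ _ (arc _ _ (toℕ<n b) x)

  Reduced : List (Fin 3) → Set
  Reduced = Linked _≢_

  act : Fin n → List (Fin 3) → Fin n
  act v [] = v
  act v (c ∷ w) = act (nb c v) w

  reduced-open : ∀ v c w → Reduced (c ∷ w) → length (c ∷ w) < girth-bound t → act v (c ∷ w) ≢ v
  reduced-open v c w red lt e = nonbacktracking-open (length (c ∷ w)) (vertex v (c ∷ w)) (letter (c ∷ w))
      (vertex-step v (c ∷ w)) (letter-≢ (c ∷ w) red) (s≤s z≤n) lt (trans (vertex-end v (c ∷ w)) e)
    where
    vertex : Fin n → List (Fin 3) → ℕ → Fin n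
    vertex v w zero = v
    vertex v [] (suc i) = v
    vertex v (c ∷ w) (suc i) = vertex (nb c v) w i
    letter : List (Fin 3) → ℕ → Fin 3
    letter [] i = 0F
    letter (c ∷ w) zero = c
    letter (c ∷ w) (suc i) = letter w i
    vertex-step : ∀ v w i → i < length w → vertex v w (suc i) ≡ nb (letter w i) (vertex v w i)
    vertex-step v (c ∷ w) zero _ = refl
    vertex-step v (c ∷ w) (suc i) (s≤s lt) = vertex-step (nb c v) w i lt
    letter-≢ : ∀ w → Reduced w → ∀ i → suc i < length w → letter w i ≢ letter w (suc i)
    letter-≢ (c ∷ d ∷ w) (c≢d ∷ _) zero _ = c≢d
    letter-≢ (c ∷ d ∷ w) (_ ∷ red) (suc i) (s≤s lt) = letter-≢ (d ∷ w) red i lt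
    letter-≢ (c ∷ []) _ _ (s≤s ())
    vertex-end : ∀ v w → vertex v w (length w) ≡ act v w
    vertex-end v [] = refl
    vertex-end v (c ∷ w) = vertex-end (nb c v) w

  record Path (i : Fin 3) (N : ℕ) (v v′ : Fin n) : Set where
    field
      word : List (Fin 3)
      reduced : Reduced word
      avoids : All (_≢ i) word
      bound : length word ≤ N
      ends : act v word ≡ v′

  path-nil : ∀ {i N v} → Path i N v v
  path-nil = record { word = [] ; reduced = [] ; avoids = [] ; bound = z≤n ; ends = refl }

  -- Letters act as involutions, so a new letter equal to the first one cancels it and the word
  -- stays reduced.
  path-cons : ∀ {i N v v′} c → c ≢ i → Path i N (nb c v) v′ → Path i (suc N) v v′
  path-cons {i} {N} {v} {v′} c c≢i p = by (Path.word p) (Path.reduced p) (Path.avoids p) (Path.bound p) (Path.ends p)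
    where
    by : ∀ w → Reduced w → All (_≢ i) w → length w ≤ N → act (nb c v) w ≡ v′ → Path i (suc N) v v′
    by [] _ _ _ e = record { word = c ∷ [] ; reduced = [-] ; avoids = c≢i ∷ [] ; bound = s≤s z≤n ; ends = e }
    by (d ∷ w) red (d≢i ∷ av) bd e with c ≟F d
    ... | yes refl = record { word = w ; reduced = Linked.tail red ; avoids = av
                            ; bound = ≤-trans (≤-trans (n≤1+n _) bd) (n≤1+n _) ; ends = trans (cong (λ x → act x w) (sym (nb-nb c v))) e }
    ... | no c≢d = record { word = c ∷ d ∷ w ; reduced = c≢d ∷ red ; avoids = c≢i ∷ d≢i ∷ av ; bound = s≤s bd ; ends = e }

-- Territories inside the construction

module Territory (r : ℕ) {U : Set} (C : Construction (5 + r) U) where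
  open Construction C
  open Colouring C

  module At (i : Fin 3) (j : Fin (c i)) where

    private
      Ed : Fin (s i j) → Fin (s i j) → Set
      Ed = E i j
      m : ℕ
      m = proj₁ (T-can i j)
      Sₚ Jₚ : ℕ → Bool
      Sₚ = proj₁ (proj₂ (T-can i j))
      Jₚ = proj₁ (proj₂ (proj₂ (T-can i j)))
      valid : ValidExp (5 + r) m Sₚ Jₚ
      valid = proj₁ (proj₂ (proj₂ (proj₂ (T-can i j))))
      φ : Fin (s i j) ↔ ExpV (5 + r) m Sₚ Jₚ
      φ = proj₁ (proj₂ (proj₂ (proj₂ (proj₂ (T-can i j)))))
      to : Fin (s i j) → ExpV (5 + r) m Sₚ Jₚ
      to = Inverse.to φ
      from : ExpV (5 + r) m Sₚ Jₚ → Fin (s i j)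
      from = Inverse.from φ
      from-to : ∀ a → from (to a) ≡ a
      from-to = Inverse.strictlyInverseʳ φ
      to-from : ∀ x → to (from x) ≡ x
      to-from = Inverse.strictlyInverseˡ φ
      edge : ∀ a b → Iff (Ed a b) (ExpAdj (5 + r) m Sₚ Jₚ (to a) (to b))
      edge = proj₁ (proj₂ (proj₂ (proj₂ (proj₂ (proj₂ (T-can i j))))))
      perimeter : ∀ a → Iff (Σ (Fin n) λ v → e i j a ≡ ι v × comp i v ≡ j) (ExpB (5 + r) m Sₚ Jₚ (to a))
      perimeter = proj₂ (proj₂ (proj₂ (proj₂ (proj₂ (proj₂ (T-can i j))))))

    open Expansion r m Sₚ Jₚ valid using (EV; EAdj; EAdj-sym)
    open Elimination r m Sₚ Jₚ valid using (no-territory-cycle)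
    open Projection r m Sₚ Jₚ valid using (EB; BW; K)
    open Perimeter r m Sₚ Jₚ valid using (perimeter-walk)

    E-sym : ∀ {a b} → Ed a b → Ed b a
    E-sym {a} {b} ab = proj₂ (edge b a) (EAdj-sym (to a) (to b) (proj₁ (edge a b) ab))

    -- `U` comes without decidable equality; membership in K is decided in the model territory,
    -- where it is a question about numbers and Booleans.
    dec-gamma : ∀ a → Dec (∃ λ v → e i j a ≡ ι v × comp i v ≡ j)
    dec-gamma a with dec-EB (to a)
      where
      dec-EB : ∀ x → Dec (EB x)
      dec-EB (old u) = (lay u ≟ m) ×-dec (Sₚ (pos u) ≟ᵇ false)
      dec-EB (pv p _ _ a _) = ¬? ((Jₚ p ≟ᵇ true) ×-dec (a ≟ 2 + r))
      dec-EB (qv _ _ _ _ _) = yes tt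
    ... | yes b = yes (proj₂ (perimeter a) b)
    ... | no ¬b = no λ g → ¬b (proj₁ (perimeter a) g)

    -- Restates the exclusion of cycles for a list of `3 + κ` vertices. The first and the last index
    -- are exempt from the chord condition because they form the closing edge.
    no-cycle : ∀ κ (z : ℕ → Fin (s i j)) → (∀ x y → x < y → y < 3 + κ → z x ≢ z y) →
      (∀ x → suc x < 3 + κ → Ed (z x) (z (suc x))) → Ed (z (2 + κ)) (z 0) →
      (3 + κ < 5 + r ⊎ κ ≡ 5 + (r + r)) →
      (κ ≡ 5 + (r + r) → ∀ x y → 2 + x ≤ y → y < 3 + κ → ¬ (x ≡ 0 × y ≡ 2 + κ) → ¬ Ed (z x) (z y)) → ⊥
    no-cycle κ z distinct adj closing size chordless = no-territory-cycle record
      { f = λ x → to (z (x % k))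
      ; per = λ x → cong (λ q → to (z q)) (trans (cong (_% k) (+-comm k x)) ([m+n]%n≡m%n x k))
      ; inj = λ x d 0<d d<k eq → Rk.%-distinct x d 0<d d<k (z-injective (m%n<n (d + x) k) (m%n<n x k) (to-injective eq))
      ; adj = λ x → proj₁ (edge _ _) (arc-adj (m%n<n (suc x) k) (Rk.arc-% x))
      ; ok = λ _ → tt
      ; size = size
      ; chordless = λ κ≡ x d 2≤d d≤ ad → far κ≡ x d 2≤d d≤ (proj₂ (edge _ _) ad)
      }
      where
      k : ℕ
      k = 3 + κ
      module Rk = Residues k
      to-injective : ∀ {a b} → to a ≡ to b → a ≡ b
      to-injective {a} {b} eq = trans (sym (from-to a)) (trans (cong from eq) (from-to b))
      z-injective : ∀ {p q} → p < k → q < k → z p ≡ z q → p ≡ q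
      z-injective {p} {q} p<k q<k eq with <-cmp p q
      ... | tri< lt _ _ = ⊥-elim (distinct p q lt q<k eq)
      ... | tri≈ _ p≡q _ = p≡q
      ... | tri> _ _ gt = ⊥-elim (distinct q p gt p<k (sym eq))
      arc-adj : ∀ {p q} → q < k → CycArc k p q → Ed (z p) (z q)
      arc-adj {p} q<k (inj₁ refl) = adj p q<k
      arc-adj q<k (inj₂ (eq , refl)) = subst (λ p → Ed (z p) (z 0)) (sym (suc-injective eq)) closing
      far : κ ≡ 5 + (r + r) → ∀ x d → 2 ≤ d → d + 2 ≤ 3 + κ → ¬ Ed (z (x % k)) (z ((d + x) % k))
      far κ≡ x (suc d) (s≤s 1≤d) d≤ ad = by (<-cmp P Q)
        where
        P Q : ℕ
        P = x % k
        Q = (suc d + x) % k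
        2+d<k : 2 + d < k
        2+d<k = ≤-trans (≤-reflexive (+-comm 2 (suc d))) d≤
        1+d<k : suc d < k
        1+d<k = <-trans (n<1+n _) 2+d<k
        ¬PQ : ¬ CycArc k P Q
        ¬PQ arc = Rk.%-distinct (suc x) d 1≤d (<-trans (n<1+n _) 1+d<k)
          (trans (cong (_% k) (+-suc d x)) (Rk.arc-next {x} (m%n<n (suc d + x) k) arc))
        ¬QP : ¬ CycArc k Q P
        ¬QP arc = Rk.%-distinct x (2 + d) (s≤s z≤n) 2+d<k (sym (Rk.arc-next {suc d + x} (m%n<n x k) arc))
        by : Tri (P < Q) (P ≡ Q) (Q < P) → ⊥
        by (tri≈ _ eq _) = Rk.%-distinct x (suc d) (s≤s z≤n) 1+d<k (sym eq)
        by (tri< lt _ _) = chordless κ≡ P Q (≤∧≢⇒< lt λ eq → ¬PQ (inj₁ eq)) (m%n<n (suc d + x) k)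
          (λ { (p , q) → ¬QP (inj₂ (cong suc q , p)) }) ad
        by (tri> _ _ gt) = chordless κ≡ Q P (≤∧≢⇒< gt λ eq → ¬QP (inj₁ eq)) (m%n<n x k)
          (λ { (q , p) → ¬PQ (inj₂ (cong suc p , q)) }) (E-sym ad)

    bound : ℕ → ℕ
    bound l = K + (l * ((2 + r) ^ l * K) + K)

    -- Perimeter edges are edges of K, each of a colour other than `i`, so the perimeter walk spells
    -- a word avoiding `i`.
    run-path : ∀ l (z : ℕ → Fin (s i j)) → (∀ x → x < l → Ed (z x) (z (suc x))) →
      ∀ {v v′} → e i j (z 0) ≡ ι v → e i j (z l) ≡ ι v′ → Path i (bound l) v v′
    run-path l z adj {v} {v′} z₀ zₗ = convert (perimeter-walk (λ x → to (z x)) l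
        (λ x x<l → proj₁ (edge _ _) (adj x x<l))
        (proj₁ (perimeter _) (v , z₀ , TΓ₁ i j _ v z₀)) (proj₁ (perimeter _) (v′ , zₗ , TΓ₁ i j _ v′ zₗ)))
        (trans (cong (e i j) (from-to _)) z₀) (trans (cong (e i j) (from-to _)) zₗ)
      where
      convert : ∀ {N x y v v′} → BW N x y → e i j (from x) ≡ ι v → e i j (from y) ≡ ι v′ → Path i N v v′
      convert (stay _) p q = subst (Path i _ _) (ι-inj (trans (sym p) q)) path-nil
      convert {x = x} (go {y = y} _ ad w) p q with proj₂ (perimeter (from y)) (subst EB (sym (to-from y)) (walk-start w))
      ... | v₁ , p₁ , _ with Sub-colour (proj₁ (T-ind i j (from x) (from y) _ v₁ p p₁)
                               (proj₂ (edge (from x) (from y)) (subst₂ EAdj (sym (to-from x)) (sym (to-from y)) ad)))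
      ...   | c , c≢i , refl = path-cons c c≢i (convert w p₁ q)

-- Labelling the edges of an induced cycle

another : Fin 3 → Fin 3 → Fin 3
another 0F 0F = 1F
another 0F 1F = 2F
another 0F 2F = 1F
another 1F 0F = 2F
another 1F 1F = 0F
another 1F 2F = 0F
another 2F 0F = 1F
another 2F 1F = 0F
another 2F 2F = 0F

another≢ˡ : ∀ a b → another a b ≢ a
another≢ˡ 0F 0F ()
another≢ˡ 0F 1F ()
another≢ˡ 0F 2F ()
another≢ˡ 1F 0F ()
another≢ˡ 1F 1F ()
another≢ˡ 1F 2F ()
another≢ˡ 2F 0F ()
another≢ˡ 2F 1F ()
another≢ˡ 2F 2F ()

another≢ʳ : ∀ a b → a ≢ b → another a b ≢ b
another≢ʳ 0F 0F ne _ = ne refl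
another≢ʳ 1F 1F ne _ = ne refl
another≢ʳ 2F 2F ne _ = ne refl
another≢ʳ 0F 1F _ ()
another≢ʳ 0F 2F _ ()
another≢ʳ 1F 0F _ ()
another≢ʳ 1F 2F _ ()
another≢ʳ 2F 0F _ ()
another≢ʳ 2F 1F _ ()

only-three : ∀ {a b c d : Fin 3} → a ≢ b → a ≢ c → b ≢ c → d ≢ a → d ≢ b → d ≡ c
only-three {a} {b} {c} {d} = table a b c d
  where
  table : ∀ a b c d → a ≢ b → a ≢ c → b ≢ c → d ≢ a → d ≢ b → d ≡ c
  table 0F 0F _ _ n _ _ _ _ = ⊥-elim (n refl)
  table 1F 1F _ _ n _ _ _ _ = ⊥-elim (n refl)
  table 2F 2F _ _ n _ _ _ _ = ⊥-elim (n refl)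
  table 0F _ 0F _ _ n _ _ _ = ⊥-elim (n refl)
  table 1F _ 1F _ _ n _ _ _ = ⊥-elim (n refl)
  table 2F _ 2F _ _ n _ _ _ = ⊥-elim (n refl)
  table _ 0F 0F _ _ _ n _ _ = ⊥-elim (n refl)
  table _ 1F 1F _ _ _ n _ _ = ⊥-elim (n refl)
  table _ 2F 2F _ _ _ n _ _ = ⊥-elim (n refl)
  table 0F _ _ 0F _ _ _ n _ = ⊥-elim (n refl)
  table 1F _ _ 1F _ _ _ n _ = ⊥-elim (n refl)
  table 2F _ _ 2F _ _ _ n _ = ⊥-elim (n refl)
  table _ 0F _ 0F _ _ _ _ n = ⊥-elim (n refl)
  table _ 1F _ 1F _ _ _ _ n = ⊥-elim (n refl)
  table _ 2F _ 2F _ _ _ _ n = ⊥-elim (n refl)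
  table 0F 1F 2F 2F _ _ _ _ _ = refl
  table 0F 2F 1F 1F _ _ _ _ _ = refl
  table 1F 0F 2F 2F _ _ _ _ _ = refl
  table 1F 2F 0F 0F _ _ _ _ _ = refl
  table 2F 0F 1F 1F _ _ _ _ _ = refl
  table 2F 1F 0F 0F _ _ _ _ _ = refl

record InducedCycle {t : ℕ} {U : Set} (C : Construction t U) (κ : ℕ) : Set where
  field
    F : ℕ → U
    per : ∀ x → F (3 + κ + x) ≡ F x
    inj : ∀ x d → 0 < d → d < 3 + κ → F (d + x) ≢ F x
    edge : ∀ x → GE C (F x) (F (suc x))
    chord : ∀ x d → 0 < d → d < 3 + κ → GE C (F x) (F (d + x)) → d ≡ 1 ⊎ suc d ≡ 3 + κ

periodic : ∀ {t U} {C : Construction t U} {κ} (f : Fin (3 + κ) → U) → Inj f →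
  (∀ a b → Iff (GE C (f a) (f b)) (CycAdjF (3 + κ) a b)) → InducedCycle C κ
periodic {U = U} {C} {κ} f f-inj adj = record
  { F = λ x → f (fin x)
  ; per = λ x → cong f (fin-cong (k + x) x (trans (cong (_% k) (+-comm k x)) ([m+n]%n≡m%n x k)))
  ; inj = λ x d 0<d d<k e → Rk.%-distinct x d 0<d d<k (trans (sym (toℕ-fin (d + x))) (trans (cong toℕ (f-inj e)) (toℕ-fin x)))
  ; edge = λ x → proj₂ (adj _ _) (inj₁ (subst₂ (CycArc k) (sym (toℕ-fin x)) (sym (toℕ-fin (suc x))) (Rk.arc-% x)))
  ; chord = λ x d 0<d d<k ge → by x d 0<d d<k (proj₁ (adj _ _) ge)
  }
  where
  k : ℕ
  k = 3 + κ
  module Rk = Residues k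
  fin : ℕ → Fin k
  fin x = fromℕ< (m%n<n x k)
  toℕ-fin : ∀ x → toℕ (fin x) ≡ x % k
  toℕ-fin x = toℕ-fromℕ< (m%n<n x k)
  fin-cong : ∀ x y → x % k ≡ y % k → fin x ≡ fin y
  fin-cong x y e = toℕ-injective (trans (toℕ-fin x) (trans e (sym (toℕ-fin y))))
  by : ∀ x d → 0 < d → d < k → CycAdjF k (fin x) (fin (d + x)) → d ≡ 1 ⊎ suc d ≡ k
  by x 1 _ _ _ = inj₁ refl
  by x (suc (suc d)) _ d<k (inj₁ arc) = ⊥-elim (Rk.%-distinct (suc x) (suc d) (s≤s z≤n) (<-trans (n<1+n _) d<k)
    (trans (cong (_% k) (+-suc (suc d) x)) (Rk.arc-next {x} (m%n<n (2 + d + x) k) (subst₂ (CycArc k) (toℕ-fin x) (toℕ-fin (2 + d + x)) arc))))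
  by x d@(suc (suc _)) _ d<k (inj₂ arc) with m≤n⇒m<n∨m≡n d<k
  ... | inj₂ e = inj₂ e
  ... | inj₁ lt = ⊥-elim (Rk.%-distinct x (suc d) (s≤s z≤n) lt
        (sym (Rk.arc-next {d + x} (m%n<n x k) (subst₂ (CycArc k) (toℕ-fin (d + x)) (toℕ-fin x) arc))))

module Labelling (r : ℕ) {U : Set} (C : Construction (5 + r) U) where
  open Construction C
  open Colouring C
  open Territory r C

  shift : ∀ {κ} → ℕ → InducedCycle C κ → InducedCycle C κ
  shift {κ} y H = record
    { F = λ x → F (x + y)
    ; per = λ x → trans (cong F (+-assoc (3 + κ) x y)) (per (x + y))
    ; inj = λ x d 0<d d<k e → inj (x + y) d 0<d d<k (trans (cong F (sym (+-assoc d x y))) e)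
    ; edge = λ x → edge (x + y)
    ; chord = λ x d 0<d d<k ge → chord (x + y) d 0<d d<k (subst (GE C _) (cong F (+-assoc d x y)) ge)
    }
    where open InducedCycle H

  same-component : ∀ {i j j′ a a′} → e i j a ≡ e i j′ a′ → j ≡ j′
  same-component {i} {j} {j′} eq with j ≟F j′
  ... | yes p = p
  ... | no ne with T-disj₂ i j j′ _ _ ne eq
  ...   | _ , _ , p , q = trans (sym p) q

  module Kinds {κ : ℕ} (H : InducedCycle C κ) where
    open InducedCycle H

    record InT (i : Fin 3) (x : ℕ) : Set where
      constructor inT
      field
        {j} : Fin (c i)
        {a b} : Fin (s i j)
        a-at : e i j a ≡ F x
        b-at : e i j b ≡ F (suc x)
        ab : E i j a b

    InΓ : ℕ → Set
    InΓ x = ∃ λ v → ι v ≡ F x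

    -- An edge of a territory with both ends on Γ is itself an edge of Γ, by `T-ind`; what remains
    -- for `pure` are the edges with an end off Γ.
    data Kind (x : ℕ) : Fin 3 ⊎ Fin 3 → Set where
      gamma : ∀ {c v} → ι v ≡ F x → ι (nb c v) ≡ F (suc x) → Kind x (inj₁ c)
      pure : ∀ {i} → InT i x → ¬ (InΓ x × InΓ (suc x)) → Kind x (inj₂ i)

    abstract
      kind∃ : ∀ x → ∃ (Kind x)
      kind∃ x with edge x
      ... | inj₁ (v , w , p , q , vw) with colour vw
      ...   | d , refl = inj₁ d , gamma p q
      kind∃ x | inj₂ (i , j , a , b , p , q , ab) with At.dec-gamma i j a | At.dec-gamma i j b
      ... | no ¬g | _ = inj₂ i , pure (inT p q ab) λ { ((v , v≡) , _) → ¬g (v , trans p (sym v≡) , TΓ₁ i j a v (trans p (sym v≡))) }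
      ... | _ | no ¬g = inj₂ i , pure (inT p q ab) λ { (_ , (v , v≡)) → ¬g (v , trans q (sym v≡) , TΓ₁ i j b v (trans q (sym v≡))) }
      ... | yes (v , v≡ , _) | yes (w , w≡ , _) with Sub-colour {i} (proj₁ (T-ind i j a b v w v≡ w≡) ab)
      ...   | d , _ , refl = inj₁ d , gamma (trans (sym v≡) p) (trans (sym w≡) q)

    kd : ℕ → Fin 3 ⊎ Fin 3
    kd x = proj₁ (kind∃ x)

    kind : ∀ x → Kind x (kd x)
    kind x = proj₂ (kind∃ x)

    -- Territories of different classes meet only in Γ, so a pure edge determines its class. This
    -- gives periodicity and independence of the starting point.
    kind-unique : ∀ {x y κ₁ κ₂} → F x ≡ F y → F (suc x) ≡ F (suc y) → Kind x κ₁ → Kind y κ₂ → κ₁ ≡ κ₂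
    kind-unique p q (gamma {c} {v} a b) (gamma {c′} {v′} a′ b′) with ι-inj (trans a (trans p (sym a′)))
    ... | refl = cong inj₁ (nb-colour c c′ v (ι-inj (trans b (trans q (sym b′)))))
    kind-unique p q (gamma a b) (pure _ ¬γ) = ⊥-elim (¬γ ((_ , trans a p) , (_ , trans b q)))
    kind-unique p q (pure _ ¬γ) (gamma a b) = ⊥-elim (¬γ ((_ , trans a (sym p)) , (_ , trans b (sym q))))
    kind-unique p q (pure {i} (inT a-at b-at _) ¬γ) (pure {i′} (inT a-at′ b-at′ _) _) with i ≟F i′
    ... | yes refl = refl
    ... | no ne with T-disj₁ i i′ _ _ _ _ ne (trans a-at (trans p (sym a-at′))) | T-disj₁ i i′ _ _ _ _ ne (trans b-at (trans q (sym b-at′)))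
    ...   | v , v≡ , _ | w , w≡ , _ = ⊥-elim (¬γ ((v , trans v≡ a-at) , (w , trans w≡ b-at)))

    kd-gamma : ∀ {x c v} → ι v ≡ F x → ι (nb c v) ≡ F (suc x) → kd x ≡ inj₁ c
    kd-gamma p q = kind-unique refl refl (kind _) (gamma p q)

    kd-per : ∀ x → kd (3 + κ + x) ≡ kd x
    kd-per x = kind-unique (per x) (trans (cong F (sym (+-suc (3 + κ) x))) (per (suc x))) (kind (3 + κ + x)) (kind x)

    gamma-inv : ∀ {x c} → kd x ≡ inj₁ c → ∃ λ v → ι v ≡ F x × ι (nb c v) ≡ F (suc x)
    gamma-inv {x} eq with kd x | kind x | eq
    ... | _ | gamma p q | refl = _ , p , q

    pure-inv : ∀ {x i} → kd x ≡ inj₂ i → InT i x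
    pure-inv {x} eq with kd x | kind x | eq
    ... | _ | pure T _ | refl = T

    kd-cases : ∀ x → (∃ λ c → kd x ≡ inj₁ c) ⊎ (∃ λ i → kd x ≡ inj₂ i)
    kd-cases x with kd x
    ... | inj₁ c = inj₁ (c , refl)
    ... | inj₂ i = inj₂ (i , refl)

    gamma-InT : ∀ {i x v} c → c ≢ i → ι v ≡ F x → ι (nb c v) ≡ F (suc x) → InT i x
    gamma-InT {i} {x} {v} c c≢i p q with TΓ₂ i (comp i v) v refl
      | TΓ₂ i (comp i v) (nb c v) (sym (proj₂ (comp-conn i v (nb c v)) (Sub-nb v c≢i ◅ ε)))
    ... | a , a≡ | b , b≡ = inT (trans a≡ p) (trans b≡ q) (proj₂ (T-ind i _ a b _ _ a≡ b≡) (Sub-nb v c≢i))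

    no-backtrack : ∀ x {c} → kd x ≡ inj₁ c → kd (suc x) ≢ inj₁ c
    no-backtrack x {c} eq eq′ with gamma-inv {x} eq | gamma-inv {suc x} eq′
    ... | v , p , q | w , p′ , q′ with ι-inj (trans p′ (sym q))
    ...   | refl = inj x 2 (s≤s z≤n) (s≤s (s≤s (s≤s z≤n))) (trans (sym q′) (trans (cong ι (nb-nb c v)) p))

    kd-per* : ∀ q x → kd (q * (3 + κ) + x) ≡ kd x
    kd-per* zero x = refl
    kd-per* (suc q) x = trans (cong kd (+-assoc (3 + κ) (q * (3 + κ)) x)) (trans (kd-per _) (kd-per* q x))

    -- Otherwise the whole cycle would be a closed walk in Γ without backtracking, shorter than the
    -- girth. The labelling needs a pure edge to begin with.
    some-pure : 3 + κ < girth-bound (5 + r) → ∃ λ x → ∃ λ i → kd x ≡ inj₂ i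
    some-pure k<g with anyUpTo? pure? (3 + κ)
      where
      pure? : ∀ x → Dec (∃ λ i → kd x ≡ inj₂ i)
      pure? x with kd x
      ... | inj₁ c = no λ ()
      ... | inj₂ i = yes (i , refl)
    ... | yes (x , _ , p) = x , p
    ... | no none = ⊥-elim (nonbacktracking-open (3 + κ) p w st red (s≤s z≤n) k<g
                      (trans (cong p (sym (+-identityʳ (3 + κ)))) (ι-inj (trans (p≡ (3 + κ + 0)) (trans (per 0) (sym (p≡ 0)))))))
      where
      all-gamma : ∀ x → ∃ λ c → kd x ≡ inj₁ c
      all-gamma x with kd-cases x
      ... | inj₁ g = g
      ... | inj₂ (i , eq) = ⊥-elim (none (x % (3 + κ) , m%n<n x (3 + κ) , i ,
              trans (sym (kd-per* (x / (3 + κ)) (x % (3 + κ)))) (trans (cong kd (trans (+-comm _ (x % (3 + κ))) (sym (m≡m%n+[m/n]*n x (3 + κ))))) eq)))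
      w : ℕ → Fin 3
      w x = proj₁ (all-gamma x)
      p : ℕ → Fin n
      p x = proj₁ (gamma-inv {x} (proj₂ (all-gamma x)))
      p≡ : ∀ x → ι (p x) ≡ F x
      p≡ x = proj₁ (proj₂ (gamma-inv {x} (proj₂ (all-gamma x))))
      st : ∀ x → x < 3 + κ → p (suc x) ≡ nb (w x) (p x)
      st x _ = ι-inj (trans (p≡ (suc x)) (sym (proj₂ (proj₂ (gamma-inv {x} (proj₂ (all-gamma x)))))))
      red : ∀ x → suc x < 3 + κ → w x ≢ w (suc x)
      red x _ eq = no-backtrack x (proj₂ (all-gamma x)) (trans (proj₂ (all-gamma (suc x))) (cong inj₁ (sym eq)))

  shift-kd : ∀ {κ} (H : InducedCycle C κ) x → Kinds.kd (shift x H) 0 ≡ Kinds.kd H x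
  shift-kd H x = kind-unique refl refl (convert (Kinds.kind (shift x H) 0)) (kind x)
    where
    open Kinds H
    convert : ∀ {l} → Kinds.Kind (shift x H) 0 l → Kind x l
    convert (Kinds.gamma p q) = gamma p q
    convert (Kinds.pure (Kinds.inT a-at b-at ab) ¬γ) = pure (inT a-at b-at ab) ¬γ

  -- An edge of Γ admits every label other than its colour, a pure edge only its own class.
  choose : Fin 3 → Fin 3 ⊎ Fin 3 → Fin 3
  choose c (inj₁ c′) = another c c′
  choose c (inj₂ i) with i ≟F c
  ... | yes _ = another c c
  ... | no _ = i

  relabel : Fin 3 → Fin 3 ⊎ Fin 3 → Fin 3 ⊎ Fin 3 → Fin 3
  relabel p (inj₂ i) _ = i
  relabel p (inj₁ c) next with p ≟F c
  ... | yes _ = choose c next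
  ... | no _ = p

  choose≢ : ∀ c next → choose c next ≢ c
  choose≢ c (inj₁ c′) = another≢ˡ c c′
  choose≢ c (inj₂ i) with i ≟F c
  ... | yes _ = another≢ˡ c c
  ... | no ne = ne

  relabel≢ : ∀ p c next → relabel p (inj₁ c) next ≢ c
  relabel≢ p c next with p ≟F c
  ... | yes _ = choose≢ c next
  ... | no ne = ne

  relabel-change : ∀ p c next → p ≢ relabel p (inj₁ c) next → p ≡ c
  relabel-change p c next ne with p ≟F c
  ... | yes p≡c = p≡c
  ... | no _ = ⊥-elim (ne refl)

  relabel-choose : ∀ p c next → p ≡ c → relabel p (inj₁ c) next ≡ choose c next
  relabel-choose p c next eq with p ≟F c
  ... | yes _ = refl
  ... | no ne = ⊥-elim (ne eq)

  -- An edge of Γ of colour c lies in one member of 𝒦 i for each i ≢ c.  It keeps the label of the preceding edge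
  -- if it can; otherwise it takes, if it can, a label that the next edge also admits.
  module Labels {κ : ℕ} (H : InducedCycle C κ) (i₀ : Fin 3) (start : Kinds.kd H 0 ≡ inj₂ i₀) where
    open InducedCycle H
    open Kinds H

    abstract
      lab : ℕ → Fin 3
      lab zero = i₀
      lab (suc x) = relabel (lab x) (kd (suc x)) (kd (2 + x))

      lab-pure : ∀ x {i} → kd x ≡ inj₂ i → lab x ≡ i
      lab-pure zero eq with trans (sym start) eq
      ... | refl = refl
      lab-pure (suc x) eq rewrite eq = refl

      lab-gamma : ∀ x {c} → kd x ≡ inj₁ c → lab x ≢ c
      lab-gamma zero eq with trans (sym start) eq
      ... | ()
      lab-gamma (suc x) {c} eq rewrite eq = relabel≢ (lab x) c (kd (2 + x))

      -- The recursion starts at a pure edge, whose label is forced, so it returns to the same value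
      -- after one turn.
      lab-per : ∀ x → lab (3 + κ + x) ≡ lab x
      lab-per zero = lab-pure (3 + κ + 0) (trans (kd-per 0) start)
      lab-per (suc x) = trans (cong lab (+-suc (3 + κ) x))
        (trans (cong₂ (λ l k → relabel l k (kd (2 + (3 + κ + x)))) (lab-per x) (kd-shift 1))
               (cong (relabel (lab x) (kd (suc x))) (kd-shift 2)))
        where
        kd-shift : ∀ d → kd (d + (3 + κ + x)) ≡ kd (d + x)
        kd-shift d = trans (cong kd (trans (sym (+-assoc d (3 + κ) x)) (trans (cong (_+ x) (+-comm d (3 + κ))) (+-assoc (3 + κ) d x)))) (kd-per (d + x))

      lab-InT : ∀ x → InT (lab x) x
      lab-InT x with kd-cases x
      ... | inj₂ (i , eq) = subst (λ i → InT i x) (sym (lab-pure x eq)) (pure-inv eq)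
      ... | inj₁ (c , eq) with gamma-inv {x} eq
      ...   | v , p , q = gamma-InT c (≢-sym (lab-gamma x eq)) p q

      change-before : ∀ x {c} → kd (suc x) ≡ inj₁ c → lab x ≢ lab (suc x) → lab x ≡ c
      change-before x {c} eq ne = relabel-change (lab x) c (kd (2 + x))
        (λ e → ne (trans e (cong (λ k → relabel (lab x) k (kd (2 + x))) (sym eq))))

      -- The new label suits the next edge whenever a label other than `c` can. A second change
      -- therefore means that the next edge is pure of class `c`.
      change-after : ∀ x {c} → kd (suc x) ≡ inj₁ c → lab x ≢ lab (suc x) → lab (suc x) ≢ lab (2 + x) → lab (2 + x) ≡ c
      change-after x {c} eq ne ne′ with kd-cases (2 + x)
      ... | inj₁ (c′ , eq′) = ⊥-elim (ne′ (sym (trans (cong (λ k → relabel (lab (suc x)) k (kd (3 + x))) eq′) (keep (lab (suc x)) _ l≢c′))))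
        where
        c≢c′ : c ≢ c′
        c≢c′ refl = no-backtrack (suc x) eq eq′
        l≡ : lab (suc x) ≡ another c c′
        l≡ = trans (cong₂ (relabel (lab x)) eq eq′) (relabel-choose (lab x) c (inj₁ c′) (change-before x eq ne))
        l≢c′ : lab (suc x) ≢ c′
        l≢c′ e = another≢ʳ c c′ c≢c′ (trans (sym l≡) e)
        keep : ∀ p next → p ≢ c′ → relabel p (inj₁ c′) next ≡ p
        keep p next p≢ with p ≟F c′
        ... | yes e = ⊥-elim (p≢ e)
        ... | no _ = refl
      ... | inj₂ (i , eq′) with i ≟F c
      ...   | yes refl = lab-pure (2 + x) eq′
      ...   | no i≢c = ⊥-elim (ne′ (trans l≡ (sym (lab-pure (2 + x) eq′))))
        where
        chosen : ∀ i → i ≢ c → choose c (inj₂ i) ≡ i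
        chosen i ne with i ≟F c
        ... | yes e = ⊥-elim (ne e)
        ... | no _ = refl
        l≡ : lab (suc x) ≡ i
        l≡ = trans (cong₂ (relabel (lab x)) eq eq′) (trans (relabel-choose (lab x) c (inj₂ i) (change-before x eq ne)) (chosen i i≢c))

-- Runs and special runs

module Runs (r : ℕ) {U : Set} (C : Construction (5 + r) U) {κ : ℕ} (κ≡ : κ ≡ 5 + (r + r))
            (H : InducedCycle C κ) (i₀ : Fin 3) (start : Labelling.Kinds.kd r C H 0 ≡ inj₂ i₀) where
  open Construction C
  open Colouring C
  open Territory r C
  open Labelling r C
  open InducedCycle H
  open Kinds H
  open Labels H i₀ start

  k : ℕ
  k = 3 + κ

  record Trace (i : Fin 3) (x l : ℕ) : Set where
    field
      {j} : Fin (c i)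
      z : ℕ → Fin (s i j)
      z-at : ∀ p → p ≤ l → e i j (z p) ≡ F (p + x)
      z-edge : ∀ p → p < l → E i j (z p) (z (suc p))

  -- Consecutive edges share a vertex and two territories of one class are disjoint, so equal labels
  -- keep the cycle in the same territory.
  trace : ∀ i x l → 1 ≤ l → (∀ p → p < l → lab (p + x) ≡ i) → Trace i x l
  trace i x l 1≤l same = record { z = z ; z-at = z-at ; z-edge = z-edge }
    where
    T : ∀ p → p < l → InT i (p + x)
    T p p< = subst (λ i → InT i (p + x)) (same p p<) (lab-InT (p + x))
    j : Fin (c i)
    j = InT.j (T 0 1≤l)
    on : ∀ p → p ≤ l → ∃ λ a → e i j a ≡ F (p + x)
    on zero _ = InT.a (T 0 1≤l) , InT.a-at (T 0 1≤l)
    on (suc p) le with T p le | on p (≤-trans (n≤1+n p) le)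
    ... | inT {j = j′} {b = b} a-at b-at _ | a , a≡ with same-component {i} {j} {j′} (trans a≡ (sym a-at))
    ...   | refl = b , b-at
    z : ℕ → Fin (s i j)
    z p with p ≤? l
    ... | yes le = proj₁ (on p le)
    ... | no _ = InT.a (T 0 1≤l)
    z-at : ∀ p → p ≤ l → e i j (z p) ≡ F (p + x)
    z-at p le with p ≤? l
    ... | yes le′ = proj₂ (on p le′)
    ... | no ¬le = ⊥-elim (¬le le)
    z-edge : ∀ p → p < l → E i j (z p) (z (suc p))
    z-edge p p< = by (z-at p (<⇒≤ p<)) (z-at (suc p) p<) (T p p<)
      where
      by : ∀ {a b} → e i j a ≡ F (p + x) → e i j b ≡ F (suc p + x) → InT i (p + x) → E i j a b
      by a≡ b≡ (inT {j = j′} a-at b-at ab) with same-component {i} {j} {j′} (trans a≡ (sym a-at))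
      ... | refl = subst₂ (E i j) (e-inj i j (trans a-at (sym a≡))) (e-inj i j (trans b-at (sym b≡))) ab

  F-distinct : ∀ x {p q} → p < q → q < p + k → F (p + x) ≢ F (q + x)
  F-distinct x {p} {q} p<q q< eq = inj (p + x) (q ∸ p) (m<n⇒0<n∸m p<q)
    (subst (q ∸ p <_) (m+n∸m≡n p k) (∸-monoˡ-< q< (<⇒≤ p<q)))
    (trans (cong F (trans (sym (+-assoc (q ∸ p) p x)) (cong (_+ x) (m∸n+n≡m (<⇒≤ p<q))))) (sym eq))

  F-chord : ∀ x {p q} → p < q → q < p + k → GE C (F (p + x)) (F (q + x)) → q ≡ suc p ⊎ suc q ≡ p + k
  F-chord x {p} {q} p<q q< ge = [ (λ e → inj₁ (trans (sym e≡) (cong (_+ p) e))) ,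
                                (λ e → inj₂ (trans (cong suc (sym e≡)) (trans (cong (_+ p) e) (+-comm k p)))) ]′
    (chord (p + x) (q ∸ p) (m<n⇒0<n∸m p<q) (subst (q ∸ p <_) (m+n∸m≡n p k) (∸-monoˡ-< q< (<⇒≤ p<q)))
      (subst (λ y → GE C (F (p + x)) (F y)) (trans (cong (_+ x) (sym e≡)) (+-assoc (q ∸ p) p x)) ge))
    where
    e≡ : q ∸ p + p ≡ q
    e≡ = m∸n+n≡m (<⇒≤ p<q)

  -- Every edge of a territory is an edge of the whole graph, so the induced cycle has no chord
  -- inside the territory either, and `no-cycle` applies.
  not-inside : ∀ {i x} (t : Trace i x (2 + κ)) → ¬ E i (Trace.j t) (Trace.z t (2 + κ)) (Trace.z t 0)
  not-inside {i} {x} t closing = At.no-cycle i j κ z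
      (λ p q p<q q<k eq → F-distinct x p<q (<-≤-trans q<k (m≤n+m k p)) (trans (sym (z-at p (≤-pred (<-trans p<q q<k)))) (trans (cong (e i j) eq) (z-at q (≤-pred q<k)))))
      (λ p p< → z-edge p (≤-pred p<)) closing (inj₂ κ≡)
      λ _ p q p+2≤q q<k not-ends ab → [ (λ { refl → 1+n≰n p+2≤q }) , (λ eq → not-ends (ends p q q<k eq)) ]′
        (F-chord x (≤-trans (n≤1+n _) p+2≤q) (<-≤-trans q<k (m≤n+m k p))
          (inj₂ (i , j , z p , z q , z-at p (≤-trans (≤-trans (n≤1+n _) (≤-trans (n≤1+n _) p+2≤q)) (≤-pred q<k)) , z-at q (≤-pred q<k) , ab)))
    where
    open Trace t
    ends : ∀ p q → q < k → suc q ≡ p + k → p ≡ 0 × q ≡ 2 + κ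
    ends zero q _ eq = refl , suc-injective eq
    ends (suc p) q q<k eq = ⊥-elim (1+n≰n (≤-trans (s≤s (m≤n+m k p)) (subst (_≤ k) eq q<k)))

  Junction : ℕ → Set
  Junction x = lab x ≢ lab (suc x)

  junction-per : ∀ {x} → Junction x → Junction (k + x)
  junction-per {x} jx eq = jx (trans (sym (lab-per x)) (trans eq (trans (cong lab (sym (+-suc k x))) (lab-per (suc x)))))

  junction-vertex : ∀ x → Junction x → ∃ λ v → ι v ≡ F (suc x)
  junction-vertex x jx with lab-InT x | lab-InT (suc x)
  ... | inT _ b-at _ | inT a-at _ _ with T-disj₁ (lab x) (lab (suc x)) _ _ _ _ jx (trans b-at (sym a-at))
  ...   | v , v≡ , _ = v , trans v≡ b-at

  -- With a constant label the whole cycle would lie in one territory.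
  some-junction : ∃ Junction
  some-junction with anyUpTo? (λ x → ¬? (lab x ≟F lab (suc x))) k
  ... | yes (x , _ , jx) = x , jx
  ... | no none = ⊥-elim (not-inside t closing)
    where
    constant : ∀ p → p ≤ k → lab p ≡ lab 0
    constant zero _ = refl
    constant (suc p) le = trans (sym (decidable-stable (lab p ≟F lab (suc p)) (λ ne → none (p , le , ne)))) (constant p (<⇒≤ le))
    tk : Trace (lab 0) 0 k
    tk = trace (lab 0) 0 k (s≤s z≤n) λ p p< → trans (cong lab (+-identityʳ p)) (constant p (<⇒≤ p<))
    open Trace tk
    t : Trace (lab 0) 0 (2 + κ)
    t = record { z = z ; z-at = λ p le → z-at p (m≤n⇒m≤1+n le) ; z-edge = λ p p< → z-edge p (m≤n⇒m≤1+n p<) }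
    closing : E (lab 0) j (z (2 + κ)) (z 0)
    closing = subst (E (lab 0) j (z (2 + κ))) (e-inj (lab 0) j (trans (z-at k ≤-refl) (trans (per 0) (sym (z-at 0 z≤n))))) (z-edge (2 + κ) ≤-refl)

  -- A run (x , y): the edges x + 1, …, y carry one label, and their neighbours x and y + 1 other labels.
  record Run (x y : ℕ) : Set where
    field
      x<y : x < y
      left : Junction x
      right : Junction y
      constant : ∀ z → x < z → z ≤ y → lab z ≡ lab (suc x)

  next-run : ∀ x e → x < e → Junction x → Junction e → ∃ λ y → Run x y × y ≤ e
  next-run x e x<e jx je = scan (e ∸ suc x) (suc x) ≤-refl (m∸n+n≡m x<e)
      (λ z x<z z≤ → cong lab (≤-antisym z≤ x<z))
    where
    scan : ∀ d y → x < y → d + y ≡ e → (∀ z → x < z → z ≤ y → lab z ≡ lab (suc x)) → ∃ λ y → Run x y × y ≤ e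
    scan zero y x<y refl con = y , record { x<y = x<y ; left = jx ; right = je ; constant = con } , ≤-refl
    scan (suc d) y x<y eq con with lab y ≟F lab (suc y)
    ... | no jy = y , record { x<y = x<y ; left = jx ; right = jy ; constant = con } , subst (y ≤_) eq (m≤n+m y (suc d))
    ... | yes same = scan d (suc y) (m≤n⇒m≤1+n x<y) (trans (+-suc d y) eq) λ z x<z z≤ →
            [ (λ z< → con z x<z (≤-pred z<)) , (λ { refl → trans (sym same) (con y x<y ≤-refl) }) ]′ (m≤n⇒m<n∨m≡n z≤)

  inside-run : ∀ {x y z} → Run x y → x < z → Junction z → y ≤ z
  inside-run {x} {y} {z} run x<z jz = ≮⇒≥ λ z<y → jz (trans (constant z x<z (<⇒≤ z<y)) (sym (constant (suc z) (m≤n⇒m≤1+n x<z) z<y)))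
    where open Run run

  -- The edges `x` and `k + x` coincide, and the label of edge `x` differs from that of the run.
  run-short : ∀ {x y} → Run x y → y ≤ k + x → y < k + x
  run-short {x} run y≤ with m≤n⇒m<n∨m≡n y≤
  ... | inj₁ lt = lt
  ... | inj₂ refl = ⊥-elim (Run.left run (trans (sym (lab-per x)) (Run.constant run (k + x) (Run.x<y run) ≤-refl)))

  run-trace : ∀ {x y} → Run x y → Trace (lab (suc x)) (suc x) (y ∸ x)
  run-trace {x} {y} run = trace _ (suc x) (y ∸ x) (m<n⇒0<n∸m x<y)
    λ p p< → constant (p + suc x) (m≤n+m (suc x) p) (subst (_≤ y) (sym (+-suc p x)) (subst (suc (p + x) ≤_) (m∸n+n≡m (<⇒≤ x<y)) (+-monoˡ-≤ x p<)))
    where open Run run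

-- The girth exceeds the length of every product of run words

rate-< : ∀ t k K Y X → k ≤ 2 * t → K ≤ 3 * t → Y ≤ X → 5 ≤ t → 1 ≤ X → k * (K + (Y * K + K)) < t * (t * (t * (t * X)))
rate-< t k K Y X k≤ K≤ Y≤X 5≤t 1≤X = begin-strict
  k * (K + (Y * K + K))                      ≤⟨ *-mono-≤ k≤ (+-mono-≤ K≤ (+-mono-≤ (*-mono-≤ Y≤X K≤) K≤)) ⟩
  2 * t * (3 * t + (X * (3 * t) + 3 * t))    ≡⟨ s₁ t X ⟩
  6 * (t * t) * (X + 2)                      ≤⟨ *-monoʳ-≤ (6 * (t * t)) (+-monoʳ-≤ X (+-mono-≤ 1≤X (≤-trans 1≤X (m≤m+n X 0)))) ⟩
  6 * (t * t) * (3 * X)                      ≡⟨ s₂ t X ⟩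
  -- The accumulated constant 18 is absorbed by 25, which is at most the square of t.
  18 * (t * t * X)                           <⟨ *-monoˡ-< (t * t * X) {{>-nonZero positive}} {18} {25} (≤-by 6 refl) ⟩
  25 * (t * t * X)                           ≤⟨ *-monoˡ-≤ (t * t * X) {25} {t * t} (*-mono-≤ 5≤t 5≤t) ⟩
  t * t * (t * t * X)                        ≡⟨ s₃ t X ⟩
  t * (t * (t * (t * X)))                    ∎
  where
  open ≤-Reasoning
  1≤t : 1 ≤ t
  1≤t = ≤-trans (s≤s z≤n) 5≤t
  positive : 1 ≤ t * t * X
  positive = *-mono-≤ {1} {t * t} {1} {X} (*-mono-≤ 1≤t 1≤t) 1≤X
  s₁ : ∀ t X → 2 * t * (3 * t + (X * (3 * t) + 3 * t)) ≡ 6 * (t * t) * (X + 2)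
  s₁ = solve-∀
  s₂ : ∀ t X → 6 * (t * t) * (3 * X) ≡ 18 * (t * t * X)
  s₂ = solve-∀
  s₃ : ∀ t X → t * t * (t * t * X) ≡ t * (t * (t * (t * X)))
  s₃ = solve-∀

module Bounds (r κ : ℕ) (κ≡ : κ ≡ 5 + (r + r)) where
  K : ℕ
  K = 7 + 3 * r
  -- perimeter steps per edge of the cycle
  rate : ℕ
  rate = K + ((2 + r) ^ (3 + κ) * K + K)

  -- A uniform charge per edge lets the bounds of consecutive runs add up to one for the whole
  -- cycle.
  path-bound : ∀ l → 1 ≤ l → l ≤ 3 + κ → K + (l * ((2 + r) ^ l * K) + K) ≤ l * rate
  path-bound l@(suc l-1) _ l≤ = begin
    K + (l * ((2 + r) ^ l * K) + K)                     ≤⟨ +-mono-≤ (m≤m+n K (l-1 * K)) (+-mono-≤ (*-monoʳ-≤ l (*-monoˡ-≤ K (^-monoʳ-≤ (2 + r) l≤))) (m≤m+n K (l-1 * K))) ⟩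
    l * K + (l * Y + l * K)                             ≡⟨ cong (l * K +_) (*-distribˡ-+ l Y K) ⟨
    l * K + l * (Y + K)                                 ≡⟨ *-distribˡ-+ l K (Y + K) ⟨
    l * rate                                            ∎
    where
    open ≤-Reasoning
    Y : ℕ
    Y = (2 + r) ^ (3 + κ) * K

  -- With length 2t - 2, the estimate `rate-<` gives the exponent 2t + 2, which is at most 5t.
  total-bound : (3 + κ) * rate < girth-bound (5 + r)
  total-bound = subst ((3 + κ) * rate <_) (sym (girth-bound≡ (5 + r))) (<-≤-trans
    (rate-< (5 + r) (3 + κ) K ((2 + r) ^ (3 + κ)) ((5 + r) ^ (3 + κ))
      (≤-by 2 (trans (cong (λ κ → 3 + κ + 2) κ≡) (s₁ r))) (≤-by 8 (s₂ r))
      (^-monoˡ-≤ (3 + κ) {2 + r} {5 + r} (+-monoˡ-≤ r {2} {5} (s≤s (s≤s z≤n)))) (m≤m+n 5 r) (m^n>0 (5 + r) (3 + κ)))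
    (^-monoʳ-≤ (5 + r) {7 + κ} {5 * (5 + r)} (≤-by (13 + 3 * r) (trans (cong (λ κ → 7 + κ + (13 + 3 * r)) κ≡) (s₃ r)))))
    where
    s₁ : ∀ r → 3 + (5 + (r + r)) + 2 ≡ 2 * (5 + r)
    s₁ = solve-∀
    s₂ : ∀ r → 7 + 3 * r + 8 ≡ 3 * (5 + r)
    s₂ = solve-∀
    s₃ : ∀ r → 7 + (5 + (r + r)) + (13 + 3 * r) ≡ 5 * (5 + r)
    s₃ = solve-∀

  length< : 3 + κ < girth-bound (5 + r)
  length< = ≤-<-trans (m≤m*n (3 + κ) rate) total-bound

-- Concatenation and cancellation of words

module Words {t : ℕ} {U : Set} (C : Construction t U) where
  open Construction C using (n)
  open Colouring C

  last : Fin 3 → List (Fin 3) → Fin 3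
  last a [] = a
  last a (b ∷ bs) = last b bs

  init : Fin 3 → List (Fin 3) → List (Fin 3)
  init a [] = []
  init a (b ∷ bs) = a ∷ init b bs

  last≢ : ∀ {i} a as → All (_≢ i) (a ∷ as) → last a as ≢ i
  last≢ a [] (a≢ ∷ _) = a≢
  last≢ a (b ∷ bs) (_ ∷ all) = last≢ b bs all

  reduced-++ : ∀ a as {c W} → Reduced (a ∷ as) → Reduced (c ∷ W) → last a as ≢ c → Reduced (a ∷ as ++ c ∷ W)
  reduced-++ a [] _ red ne = ne ∷ red
  reduced-++ a (b ∷ bs) (a≢b ∷ red) red′ ne = a≢b ∷ reduced-++ b bs red red′ ne

  -- Once the last letter `c` is removed, the letter before it differs from `c` by reducedness and
  -- from `i` by avoidance; the last hypothesis turns this into a difference from `d`.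
  reduced-cancel : ∀ {i c d W} a b bs → Reduced (a ∷ b ∷ bs) → All (_≢ i) (a ∷ b ∷ bs) → last b bs ≡ c →
    Reduced (d ∷ W) → (∀ p → p ≢ i → p ≢ c → p ≢ d) → Reduced (a ∷ init b bs ++ d ∷ W)
  reduced-cancel a b [] (a≢b ∷ _) (a≢i ∷ _) refl red ne = ne a a≢i a≢b ∷ red
  reduced-cancel a b (b′ ∷ bs) (a≢b ∷ red′) (_ ∷ all) eq red ne = a≢b ∷ reduced-cancel b b′ bs red′ all eq red ne

  act-++ : ∀ v as bs → act v (as ++ bs) ≡ act (act v as) bs
  act-++ v [] bs = refl
  act-++ v (a ∷ as) bs = act-++ (nb a v) as bs

  act-cancel : ∀ v a as W → act v (init a as ++ W) ≡ act (act v (a ∷ as)) (last a as ∷ W)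
  act-cancel v a [] W = cong (λ x → act x W) (sym (nb-nb a v))
  act-cancel v a (b ∷ bs) W = act-cancel (nb a v) b bs W

  length-init : ∀ a as → length (init a as) ≤ length (a ∷ as)
  length-init a [] = z≤n
  length-init a (b ∷ bs) = s≤s (length-init b bs)

-- Total cancellation around the cycle

module Reduction (r : ℕ) {U : Set} (C : Construction (5 + r) U) {κ : ℕ} (κ≡ : κ ≡ 5 + (r + r))
                 (H : InducedCycle C κ) (i₀ : Fin 3) (start : Labelling.Kinds.kd r C H 0 ≡ inj₂ i₀)
                 (rate : ℕ) (1≤rate : 1 ≤ rate)
                 (path-bound : ∀ l → 1 ≤ l → l ≤ 3 + κ →
                    7 + 3 * r + (l * ((2 + r) ^ l * (7 + 3 * r)) + (7 + 3 * r)) ≤ l * rate)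
                 (total-bound : (3 + κ) * rate < girth-bound (5 + r)) where
  open Construction C
  open Colouring C
  open Words C
  open Territory r C
  open Labelling r C
  open InducedCycle H
  open Kinds H
  open Labels H i₀ start
  open Runs r C κ≡ H i₀ start

  Represents : Fin n → ℕ → Set
  Represents v x = ι v ≡ F (suc x)

  -- `bound` is stated so that consecutive runs telescope. The last two fields bar cancellation at
  -- one-edge runs: their letter is the label of either neighbouring run, and a run word avoids its
  -- own label.
  record RunWord (x y : ℕ) (v w : Fin n) : Set where
    field
      head : Fin 3
      tail : List (Fin 3)
      reduced : Reduced (head ∷ tail)
      avoids : All (_≢ lab (suc x)) (head ∷ tail)
      ends : act v (head ∷ tail) ≡ w
      bound : length (head ∷ tail) + x * rate ≤ y * rate
      one-edge : y ≡ suc x → lab x ≡ head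
      one-letter : tail ≡ [] → y ≡ suc x × lab (suc y) ≡ head

  edge-word : ∀ {x v w} → Run x (suc x) → Represents v x → Represents w (suc x) → RunWord x (suc x) v w
  edge-word {x} {v} {w} run v≡ w≡ with kd (suc x) in eq | kind (suc x)
  ... | inj₂ _ | pure _ ¬γ = ⊥-elim (¬γ ((v , v≡) , (w , w≡)))
  ... | inj₁ c | gamma {v = v′} p q with ι-inj (trans v≡ (sym p))
  ...   | refl = record
          { head = c ; tail = [] ; reduced = [-] ; avoids = ≢-sym (lab-gamma (suc x) eq) ∷ []
          ; ends = ι-inj (trans q (sym w≡)) ; bound = +-monoˡ-≤ (x * rate) 1≤rate
          ; one-edge = λ _ → change-before x eq (Run.left run)
          ; one-letter = λ _ → refl , change-after x eq (Run.left run) (Run.right run)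
          }

  run-length : ∀ {x y} → Run x y → y ≤ k + x → 1 ≤ y ∸ x × y ∸ x < k × y ∸ x + x ≡ y
  run-length {x} {y} run y≤ = m<n⇒0<n∸m x<y ,
    subst (y ∸ x <_) (m+n∸n≡m k x) (∸-monoˡ-< (run-short run y≤) (<⇒≤ x<y)) , m∸n+n≡m (<⇒≤ x<y)
    where open Run run

  -- With the empty word two vertices of the cycle would coincide. With one letter the ends are
  -- adjacent in Γ, so in an induced cycle the run is everything but one edge, and the whole cycle
  -- lies in the territory.
  long-word : ∀ {x y v w} → Run x y → Trace (lab (suc x)) (suc x) (y ∸ x) → 2 + x ≤ y → y ≤ k + x → Represents v x → Represents w y → RunWord x y v w
  long-word {x} {y} {v} {w} run tr 2+x≤y y≤ v≡ w≡ =
    by (Path.word path) (Path.reduced path) (Path.avoids path) (Path.bound path) (Path.ends path)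
    where
    open Trace tr
    i : Fin 3
    i = lab (suc x)
    l : ℕ
    l = y ∸ x
    1≤l = proj₁ (run-length run y≤)
    l<k = proj₁ (proj₂ (run-length run y≤))
    l+x≡y = proj₂ (proj₂ (run-length run y≤))
    l+≡ : l + suc x ≡ suc y
    l+≡ = trans (+-suc l x) (cong suc l+x≡y)
    z₀ : e i j (z 0) ≡ ι v
    z₀ = trans (z-at 0 z≤n) (sym v≡)
    zₗ : e i j (z l) ≡ ι w
    zₗ = trans (z-at l ≤-refl) (trans (cong F l+≡) (sym w≡))
    path : Path i (At.bound i j l) v w
    path = At.run-path i j l z z-edge z₀ zₗ
    not-short : ∀ d ds → ds ≡ [] → act v (d ∷ ds) ≡ w → d ≢ i → ⊥
    not-short d [] _ refl d≢i
      with chord (suc x) l 1≤l l<k (inj₁ (v , nb d v , v≡ , trans w≡ (sym (cong F l+≡)) , A-nb d v))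
    ... | inj₁ l≡1 = 1+n≰n (subst (2 + x ≤_) (sym (trans (cong (_+ x) (sym l≡1)) l+x≡y)) 2+x≤y)
    ... | inj₂ l+1≡k = not-inside (record { z = z ; z-at = λ p p≤ → z-at p (subst (p ≤_) (sym l≡) p≤)
                                          ; z-edge = λ p p< → z-edge p (subst (p <_) (sym l≡) p<) })
            (subst (λ l → E i j (z l) (z 0)) l≡ (proj₂ (T-ind i j (z l) (z 0) (nb d v) v zₗ z₀)
              (subst (Sub n A h M₁ M₂ i (nb d v)) (nb-nb d v) (Sub-nb (nb d v) d≢i))))
      where
      l≡ : l ≡ 2 + κ
      l≡ = suc-injective l+1≡k
    by : ∀ ds → Reduced ds → All (_≢ i) ds → length ds ≤ At.bound i j l → act v ds ≡ w → RunWord x y v w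
    by [] _ _ _ eq = ⊥-elim (inj (suc x) l 1≤l l<k (trans (cong F l+≡) (trans (sym w≡) (trans (cong ι (sym eq)) v≡))))
    by (d ∷ ds) red (d≢i ∷ av) bd eq = record
      { head = d ; tail = ds ; reduced = red ; avoids = d≢i ∷ av ; ends = eq
      ; bound = subst (length (d ∷ ds) + x * rate ≤_) (trans (sym (*-distribʳ-+ rate l x)) (cong (_* rate) l+x≡y))
                  (+-monoˡ-≤ (x * rate) (≤-trans bd (path-bound l 1≤l (<⇒≤ l<k))))
      ; one-edge = λ { refl → ⊥-elim (1+n≰n 2+x≤y) }
      ; one-letter = λ ds≡ → ⊥-elim (not-short d ds ds≡ eq d≢i)
      }

  run-word : ∀ {x y v w} → Run x y → y ≤ k + x → Represents v x → Represents w y → RunWord x y v w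
  run-word run y≤ v≡ w≡ with m≤n⇒m<n∨m≡n (Run.x<y run)
  ... | inj₁ 2+x≤y = long-word run (run-trace run) 2+x≤y y≤ v≡ w≡
  ... | inj₂ refl = edge-word run v≡ w≡

  -- The run closes up through the vertex between its two ends on K to a cycle of T_K, whose girth is t.
  wide : ∀ {x y v w a b} → Run x y → Trace (lab (suc x)) (suc x) (y ∸ x) → y ≤ k + x → Represents v x → Represents w y →
         a ≢ lab (suc x) → b ≢ lab (suc x) → act v (a ∷ b ∷ []) ≡ w → lab x ≢ a → 3 + r + x ≤ y
  wide {x} {y} {v} {w} {a} {b} run tr y≤ v≡ w≡ a≢i b≢i ab≡ lab≢a with y <? 3 + r + x
  ... | no ≮ = ≮⇒≥ ≮
  ... | yes narrow = ⊥-elim contra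
    where
    open Trace tr
    i : Fin 3
    i = lab (suc x)
    l : ℕ
    l = y ∸ x
    1≤l = proj₁ (run-length run y≤)
    l<k = proj₁ (proj₂ (run-length run y≤))
    l+x≡y = proj₂ (proj₂ (run-length run y≤))
    l+≡ : l + suc x ≡ suc y
    l+≡ = trans (+-suc l x) (cong suc l+x≡y)
    z₀ : e i j (z 0) ≡ ι v
    z₀ = trans (z-at 0 z≤n) (sym v≡)
    zₗ : e i j (z l) ≡ ι w
    zₗ = trans (z-at l ≤-refl) (trans (cong F l+≡) (sym w≡))
    u : Fin n
    u = nb a v
    vu : Sub n A h M₁ M₂ i v u
    vu = Sub-nb v a≢i
    uv : Sub n A h M₁ M₂ i u v
    uv = subst (Sub n A h M₁ M₂ i u) (nb-nb a v) (Sub-nb u a≢i)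
    wu : Sub n A h M₁ M₂ i w u
    wu = subst (λ w → Sub n A h M₁ M₂ i w u) ab≡ (subst (Sub n A h M₁ M₂ i (nb b u)) (nb-nb b u) (Sub-nb (nb b u) b≢i))
    u-in : comp i u ≡ j
    u-in = trans (sym (proj₂ (comp-conn i v u) (vu ◅ ε))) (TΓ₁ i j (z 0) v z₀)
    q : Fin (s i j)
    q = proj₁ (TΓ₂ i j u u-in)
    q≡ : e i j q ≡ ι u
    q≡ = proj₂ (TΓ₂ i j u u-in)
    off : ∀ p → p ≤ l → z p ≢ q
    off zero _ eq = A-irr v (subst (A v) (ι-inj (trans (sym q≡) (trans (cong (e i j) (sym eq)) z₀))) (proj₁ vu))
    off (suc p) p≤ eq = by (m≤n⇒m<n∨m≡n p≤)
      where
      u≡ : ι u ≡ F (suc p + suc x)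
      u≡ = trans (sym q≡) (trans (cong (e i j) (sym eq)) (z-at (suc p) p≤))
      by : suc p < l ⊎ suc p ≡ l → ⊥
      by (inj₂ p≡l) = A-irr w (subst (A w) (ι-inj (trans u≡ (trans (cong (λ p → F (p + suc x)) p≡l) (trans (sym (z-at l ≤-refl)) zₗ)))) (proj₁ wu))
      -- If `u` lay inside the run, the edge from `v` to `u` would be the first edge of the run, and
      -- its colour `a` would be the label before the run.
      by (inj₁ p<l) with chord (suc x) (suc p) (s≤s z≤n) (<-trans p<l l<k) (inj₁ (v , u , v≡ , u≡ , proj₁ vu))
      ... | inj₁ p+1≡1 = lab≢a (change-before x (kd-gamma v≡ (trans u≡ (cong (λ p → F (p + suc x)) p+1≡1))) (Run.left run))
      ... | inj₂ p+2≡k = <⇒≱ (≤-<-trans p<l l<k) (≤-reflexive (sym p+2≡k))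
    z′ : ℕ → Fin (s i j)
    z′ p with p ≤? l
    ... | yes _ = z p
    ... | no _ = q
    z′-in : ∀ p → p ≤ l → z′ p ≡ z p
    z′-in p le with p ≤? l
    ... | yes _ = refl
    ... | no ¬le = ⊥-elim (¬le le)
    z′-out : z′ (suc l) ≡ q
    z′-out with suc l ≤? l
    ... | yes le = ⊥-elim (1+n≰n le)
    ... | no _ = refl
    len : 3 + pred l ≡ 2 + l
    len = cong (2 +_) (suc-pred l {{>-nonZero 1≤l}})
    l<3+r : l < 3 + r
    l<3+r = subst (l <_) (m+n∸n≡m (3 + r) x) (∸-monoˡ-< narrow (<⇒≤ (Run.x<y run)))
    short : 3 + pred l < 5 + r
    short = subst (_< 5 + r) (sym len) (s≤s (s≤s l<3+r))
    distinct : ∀ p p′ → p < p′ → p′ < 3 + pred l → z′ p ≢ z′ p′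
    distinct p p′ p<p′ p′< eq with m≤n⇒m<n∨m≡n (≤-pred (subst (p′ <_) len p′<))
    ... | inj₂ refl = off p (≤-pred p<p′) (trans (sym (z′-in p (≤-pred p<p′))) (trans eq z′-out))
    ... | inj₁ p′≤ = F-distinct (suc x) p<p′ (<-≤-trans (≤-<-trans (≤-pred p′≤) l<k) (m≤n+m k p))
          (trans (sym (z-at p p≤)) (trans (cong (e i j) (trans (sym (z′-in p p≤)) (trans eq (z′-in p′ (≤-pred p′≤))))) (z-at p′ (≤-pred p′≤))))
      where
      p≤ : p ≤ l
      p≤ = ≤-trans (<⇒≤ p<p′) (≤-pred p′≤)
    adjacent : ∀ p → suc p < 3 + pred l → E i j (z′ p) (z′ (suc p))
    adjacent p p< with m≤n⇒m<n∨m≡n (≤-pred (subst (suc p <_) len p<))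
    ... | inj₂ p≡l = subst₂ (E i j) (sym (trans (cong z′ (suc-injective p≡l)) (z′-in l ≤-refl))) (sym (trans (cong z′ p≡l) z′-out))
                      (proj₂ (T-ind i j (z l) q w u zₗ q≡) wu)
    ... | inj₁ p≤ = subst₂ (E i j) (sym (z′-in p (<⇒≤ (≤-pred p≤)))) (sym (z′-in (suc p) (≤-pred p≤))) (z-edge p (≤-pred p≤))
    contra : ⊥
    contra = At.no-cycle i j (pred l) z′ distinct adjacent
      (subst₂ (E i j) (sym (trans (cong z′ (suc-injective len)) z′-out)) (sym (z′-in 0 z≤n)) (proj₂ (T-ind i j q (z 0) u v q≡ z₀) uv))
      (inj₁ short)
      λ eq → ⊥-elim (<⇒≱ short (≤-trans (≤-by (3 + r) (sol r)) (≤-reflexive (cong (3 +_) (sym eq)))))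
      where
      sol : ∀ r → 5 + r + (3 + r) ≡ 3 + (5 + (r + r))
      sol = solve-∀

  -- A run whose word has two letters, both cancelling against the words of the neighbouring runs.
  record Special (x₀ e : ℕ) : Set where
    field
      {x y} : ℕ
      later : x₀ < x
      run : Run x y
      long : 3 + r + x ≤ y
      room : 2 + y ≤ e

  -- The second letter of the word of the runs from x to e: it decides how far a cancellation at x can go.
  data Shape (x y e : ℕ) (v : Fin n) (a : Fin 3) : List (Fin 3) → Set where
    normal : ∀ {b W} → b ≢ lab (suc x) → Shape x y e v a (b ∷ W)
    cancelled : ∀ {W} b → b ≢ lab (suc x) → Represents (act v (a ∷ b ∷ [])) y → 2 + y ≤ e → Shape x y e v a W
    single : ∀ {W} → y ≡ suc x → Shape x y e v a W

  -- The head is still the first letter of the first run's word, so it avoids that run's label;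
  -- cancellation affects only later letters.
  record Reduct (x e : ℕ) (v v′ : Fin n) : Set where
    field
      {y} : ℕ
      run : Run x y
      y≤e : y ≤ e
      head : Fin 3
      tail : List (Fin 3)
      reduced : Reduced (head ∷ tail)
      ends : act v (head ∷ tail) ≡ v′
      bound : length (head ∷ tail) + x * rate ≤ e * rate
      head≢ : head ≢ lab (suc x)
      one-edge : y ≡ suc x → lab x ≡ head
      shape : Shape x y e v head tail

  last-run : ∀ {x e v v′} → Run x e → RunWord x e v v′ → Reduct x e v v′
  last-run {x} {e} {v} run rw = by (RunWord.tail rw) (RunWord.reduced rw) (RunWord.avoids rw) (RunWord.ends rw) (RunWord.bound rw) (RunWord.one-letter rw)
    where
    a : Fin 3
    a = RunWord.head rw
    by : ∀ as {v′} → Reduced (a ∷ as) → All (_≢ lab (suc x)) (a ∷ as) → act v (a ∷ as) ≡ v′ →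
         length (a ∷ as) + x * rate ≤ e * rate → (as ≡ [] → e ≡ suc x × lab (suc e) ≡ a) → Reduct x e v v′
    by [] red (a≢ ∷ _) eq bd one = record { run = run ; y≤e = ≤-refl ; head = a ; tail = [] ; reduced = red ; ends = eq ; bound = bd
      ; head≢ = a≢ ; one-edge = RunWord.one-edge rw ; shape = single (proj₁ (one refl)) }
    by (b ∷ bs) red (a≢ ∷ b≢ ∷ _) eq bd one = record { run = run ; y≤e = ≤-refl ; head = a ; tail = b ∷ bs ; reduced = red ; ends = eq ; bound = bd
      ; head≢ = a≢ ; one-edge = RunWord.one-edge rw ; shape = normal b≢ }

  -- At most one letter cancels in the `normal` case: it avoids the labels `i` and `i′`, so the next
  -- letter, which differs from it and from `i′`, is `i`, and the word on the left avoids `i`.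
  -- Cancellation could go on only if the next run had already lost its second and last letter, and
  -- then that run is special.
  prepend : ∀ {x y e v u v′} → Run x y → e ≤ k + x → Represents v x → Represents u y → RunWord x y v u → Reduct y e u v′ →
            Special x e ⊎ Reduct x e v v′
  prepend {x} {y} {e} {v} {u} {v′} run e≤ v≡ u≡ rw rd =
      by (RunWord.tail rw) (RunWord.reduced rw) (RunWord.avoids rw) (RunWord.ends rw) (RunWord.bound rw) (RunWord.one-letter rw)
    where
    a c′ : Fin 3
    a = RunWord.head rw
    c′ = Reduct.head rd
    W : List (Fin 3)
    W = Reduct.tail rd
    i i′ : Fin 3
    i = lab (suc x)
    i′ = lab (suc y)
    lab-y : lab y ≡ i
    lab-y = Run.constant run y (Run.x<y run) ≤-refl
    i≢i′ : i ≢ i′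
    i≢i′ eq = Run.right run (trans lab-y eq)
    y≤e : y ≤ e
    y≤e = ≤-trans (<⇒≤ (Run.x<y (Reduct.run rd))) (Reduct.y≤e rd)
    sum : ∀ p q s → p ≤ q → q + x * rate ≤ y * rate → s + y * rate ≤ e * rate → p + s + x * rate ≤ e * rate
    sum p q s p≤q q≤ s≤ = begin
      p + s + x * rate    ≡⟨ cong (_+ x * rate) (+-comm p s) ⟩
      s + p + x * rate    ≡⟨ +-assoc s p (x * rate) ⟩
      s + (p + x * rate)  ≤⟨ +-monoʳ-≤ s (≤-trans (+-monoˡ-≤ (x * rate) p≤q) q≤) ⟩
      s + y * rate        ≤⟨ s≤ ⟩
      e * rate            ∎
      where open ≤-Reasoning
    by : ∀ as → Reduced (a ∷ as) → All (_≢ i) (a ∷ as) → act v (a ∷ as) ≡ u →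
         length (a ∷ as) + x * rate ≤ y * rate → (as ≡ [] → y ≡ suc x × lab (suc y) ≡ a) → Special x e ⊎ Reduct x e v v′
    by as red all eq bd one with last a as ≟F c′
    ... | no last≢c = inj₂ (record { run = run ; y≤e = y≤e ; head = a ; tail = as ++ c′ ∷ W
          ; reduced = reduced-++ a as red (Reduct.reduced rd) last≢c
          ; ends = trans (act-++ v (a ∷ as) (c′ ∷ W)) (trans (cong (λ z → act z (c′ ∷ W)) eq) (Reduct.ends rd))
          ; bound = subst (λ l → l + x * rate ≤ e * rate) (sym (length-++ (a ∷ as)))
              (sum (length (a ∷ as)) _ (length (c′ ∷ W)) ≤-refl bd (Reduct.bound rd))
          ; head≢ = first all ; one-edge = RunWord.one-edge rw ; shape = shaped as all one })
      where
      first : ∀ {as} → All (_≢ i) (a ∷ as) → a ≢ i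
      first (a≢ ∷ _) = a≢
      shaped : ∀ as → All (_≢ i) (a ∷ as) → (as ≡ [] → y ≡ suc x × lab (suc y) ≡ a) → Shape x y e v a (as ++ c′ ∷ W)
      shaped [] _ one = single (proj₁ (one refl))
      shaped (b ∷ bs) (_ ∷ b≢ ∷ _) _ = normal b≢
    ... | yes last≡c′ = cancel as red all eq bd one last≡c′ W refl (Reduct.shape rd)
      where
      c′≢i : c′ ≢ i
      c′≢i = subst (_≢ i) last≡c′ (last≢ a as all)
      -- The letter of a one-edge run is the label before it, which the present word avoids.
      not-one : Reduct.y rd ≢ suc y
      not-one y′≡ = c′≢i (trans (sym (Reduct.one-edge rd y′≡)) lab-y)
      2+y≤ : 2 + y ≤ Reduct.y rd
      2+y≤ = ≤∧≢⇒< (Run.x<y (Reduct.run rd)) (≢-sym not-one)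
      cancel : ∀ as → Reduced (a ∷ as) → All (_≢ i) (a ∷ as) → act v (a ∷ as) ≡ u →
               length (a ∷ as) + x * rate ≤ y * rate → (as ≡ [] → y ≡ suc x × lab (suc y) ≡ a) → last a as ≡ c′ →
               ∀ W′ → W′ ≡ W → Shape y (Reduct.y rd) e u c′ W′ → Special x e ⊎ Reduct x e v v′
      -- A single letter is the label after its run, which the head of the next word avoids.
      cancel [] _ _ _ _ one refl _ _ _ = ⊥-elim (Reduct.head≢ rd (sym (proj₂ (one refl))))
      cancel (_ ∷ _) _ _ _ _ _ _ _ _ (single y′≡) = ⊥-elim (not-one y′≡)
      cancel (_ ∷ _) _ _ _ _ _ _ _ _ (cancelled b b≢ u′≡ room) = inj₁ (record { later = Run.x<y run ; run = Reduct.run rd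
        ; long = wide (Reduct.run rd) (run-trace (Reduct.run rd)) (≤-trans (Reduct.y≤e rd) (≤-trans e≤ (+-monoʳ-≤ k (<⇒≤ (Run.x<y run)))))
                   u≡ u′≡ (Reduct.head≢ rd) b≢ refl (λ eq → c′≢i (trans (sym eq) lab-y))
        ; room = room })
      cancel (b ∷ bs) red all@(a≢ ∷ b≢ ∷ _) eq bd one last≡c′ (d ∷ W′) refl (normal d≢i′) = inj₂ (record { run = run ; y≤e = y≤e ; head = a ; tail = init b bs ++ d ∷ W′
        ; reduced = reduced-cancel a b bs red all last≡c′ (Linked.tail (Reduct.reduced rd)) fresh
        ; ends = trans (act-cancel v a (b ∷ bs) (d ∷ W′)) (trans (cong₂ (λ z l → act z (l ∷ d ∷ W′)) eq last≡c′) (Reduct.ends rd))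
        ; bound = subst (λ l → suc l + x * rate ≤ e * rate) (sym (length-++ (init b bs)))
              (sum (suc (length (init b bs))) _ (length (d ∷ W′)) (s≤s (length-init b bs)) bd (≤-trans (n≤1+n _) (Reduct.bound rd)))
        ; head≢ = a≢ ; one-edge = RunWord.one-edge rw ; shape = shaped bs last≡c′ eq })
        where
        d≢c : d ≢ c′
        d≢c eq = Linked.head (Reduct.reduced rd) (sym eq)
        fresh : ∀ p → p ≢ i → p ≢ c′ → p ≢ d
        fresh p p≢i _ p≡d = p≢i (trans p≡d (only-three (Reduct.head≢ rd) c′≢i (≢-sym i≢i′) d≢c d≢i′))
        shaped : ∀ bs → last b bs ≡ c′ → act v (a ∷ b ∷ bs) ≡ u → Shape x y e v a (init b bs ++ d ∷ W′)
        -- The word was `a`, `b` and has now lost `b`; the next run has at least two edges, whence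
        -- the room before `e`.
        shaped [] _ eq = cancelled b b≢ (trans (cong ι eq) u≡) (≤-trans 2+y≤ (Reduct.y≤e rd))
        shaped (_ ∷ _) _ _ = normal b≢

  -- Works backwards from the last run, so that each step meets a remainder already reduced; `fuel`
  -- bounds the number of edges left.
  reduce : ∀ fuel {x e v v′} → e ≤ fuel + x → x < e → e ≤ k + x → Junction x → Junction e → Represents v x → Represents v′ e →
           Special x e ⊎ Reduct x e v v′
  reduce zero e≤ x<e _ _ _ _ _ = ⊥-elim (<⇒≱ x<e e≤)
  reduce (suc fuel) {x} {e} {v} {v′} e≤ x<e e≤k jx je v≡ v′≡ with next-run x e x<e jx je
  ... | y , run , y≤e with m≤n⇒m<n∨m≡n y≤e
  ...   | inj₂ refl = inj₂ (last-run run (run-word run e≤k v≡ v′≡))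
  ...   | inj₁ y<e with junction-vertex y (Run.right run)
  ...     | u , u≡ with reduce fuel (≤-trans e≤ (≤-trans (≤-reflexive (sym (+-suc fuel x))) (+-monoʳ-≤ fuel x<y))) y<e
                          (≤-trans e≤k (+-monoʳ-≤ k (<⇒≤ x<y))) (Run.right run) je u≡ v′≡
    where
    x<y = Run.x<y run
  ...       | inj₁ sp = inj₁ (record { later = <-trans (Run.x<y run) (Special.later sp) ; run = Special.run sp
                                     ; long = Special.long sp ; room = Special.room sp })
  ...       | inj₂ rd = prepend run e≤k v≡ u≡ (run-word run (≤-trans y≤e e≤k) v≡ u≡) rd

  -- One full turn fixes the vertex at `x`, which a non-empty reduced word below the girth cannot
  -- do.
  special : ∀ x → Junction x → Special x (k + x)
  special x jx = at-vertex (junction-vertex x jx)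
    where
    not-reduct : ∀ {v} → Reduct x (k + x) v v → ⊥
    not-reduct {v} rd = reduced-open v (Reduct.head rd) (Reduct.tail rd) (Reduct.reduced rd)
      (≤-<-trans (+-cancelʳ-≤ (x * rate) (length (Reduct.head rd ∷ Reduct.tail rd)) (k * rate)
        (subst (length (Reduct.head rd ∷ Reduct.tail rd) + x * rate ≤_) (*-distribʳ-+ rate k x) (Reduct.bound rd))) total-bound) (Reduct.ends rd)
    at-vertex : (∃ λ v → Represents v x) → Special x (k + x)
    at-vertex (v , v≡) = [ (λ sp → sp) , (λ rd → ⊥-elim (not-reduct rd)) ]′
      (reduce k ≤-refl (m<n+m x (s≤s z≤n)) ≤-refl jx (junction-per jx) v≡
        (trans v≡ (trans (sym (per (suc x))) (cong F (+-suc k x)))))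

  -- Three special runs of length at least t - 2 do not fit into 2t - 2 edges.
  three-specials : ∀ {x₀} (s₁ : Special x₀ (k + x₀)) (s₂ : Special (Special.x s₁) (k + Special.x s₁))
                   (s₃ : Special (Special.x s₂) (k + Special.x s₂)) → ⊥
  -- The third run would straddle the junction one turn after the start of the first.
  three-specials s₁ s₂ s₃ = <⇒≱ end<y₃ (inside-run S₃.run x₃<end (junction-per (Run.left S₁.run)))
    where
    open ≤-Reasoning
    module S₁ = Special s₁
    module S₂ = Special s₂
    module S₃ = Special s₃
    y₁≤x₂ : S₁.y ≤ S₂.x
    y₁≤x₂ = inside-run S₁.run S₂.later (Run.left S₂.run)
    y₂≤x₃ : S₂.y ≤ S₃.x
    y₂≤x₃ = inside-run S₂.run S₃.later (Run.left S₃.run)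
    w : ℕ
    w = 3 + r
    k+≡ : ∀ a → k + a ≡ 2 + (w + (w + a))
    k+≡ a = trans (cong (λ κ → 3 + κ + a) κ≡) (sol r a)
      where
      sol : ∀ r a → 3 + (5 + (r + r)) + a ≡ 2 + (3 + r + (3 + r + a))
      sol = solve-∀
    -- The length is `2 + (w + w)`: the room of 2 and the second run's own length `w` leave at most
    -- `w` between the two starts.
    x₂≤ : S₂.x ≤ w + S₁.x
    x₂≤ = +-cancelˡ-≤ w _ _ (≤-trans S₂.long (≤-pred (≤-pred (subst (2 + S₂.y ≤_) (k+≡ S₁.x) S₂.room))))
    x₃≤ : S₃.x ≤ w + S₂.x
    x₃≤ = +-cancelˡ-≤ w _ _ (≤-trans S₃.long (≤-pred (≤-pred (subst (2 + S₃.y ≤_) (k+≡ S₂.x) S₃.room))))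
    x₃<end : S₃.x < k + S₁.x
    x₃<end = begin-strict
      S₃.x                  ≤⟨ x₃≤ ⟩
      w + S₂.x              ≤⟨ +-monoʳ-≤ w x₂≤ ⟩
      w + (w + S₁.x)        <⟨ m<n+m (w + (w + S₁.x)) {2} (s≤s z≤n) ⟩
      2 + (w + (w + S₁.x))  ≡⟨ k+≡ S₁.x ⟨
      k + S₁.x              ∎
    end<y₃ : k + S₁.x < S₃.y
    end<y₃ = begin-strict
      k + S₁.x              ≡⟨ k+≡ S₁.x ⟩
      2 + (w + (w + S₁.x))  <⟨ ≤-refl ⟩
      3 + (w + (w + S₁.x))  ≤⟨ +-monoˡ-≤ (w + (w + S₁.x)) {3} {w} (m≤m+n 3 r) ⟩
      w + (w + (w + S₁.x))  ≤⟨ +-monoʳ-≤ w (+-monoʳ-≤ w (≤-trans S₁.long y₁≤x₂)) ⟩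
      w + (w + S₂.x)        ≤⟨ +-monoʳ-≤ w (≤-trans S₂.long y₂≤x₃) ⟩
      w + S₃.x              ≤⟨ S₃.long ⟩
      S₃.y                  ∎

  contradiction : ⊥
  contradiction = by some-junction
    where
    by : ∃ Junction → ⊥
    by (x₀ , j₀) = three-specials s₁ s₂ (special (Special.x s₂) (Run.left (Special.run s₂)))
      where
      s₁ : Special x₀ (k + x₀)
      s₁ = special x₀ j₀
      s₂ : Special (Special.x s₁) (k + Special.x s₁)
      s₂ = special (Special.x s₁) (Run.left (Special.run s₁))

theorem4p4 : (t : ℕ) → 5 ≤ t → (U : Set) → (C : Construction t U) →
    InducedCycleFree (2 * t ∸ 2) (GV C) (GE C)
theorem4p4 (suc (suc (suc (suc (suc r))))) (s≤s (s≤s (s≤s (s≤s (s≤s z≤n))))) U C =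
  subst (λ k → InducedCycleFree k (GV C) (GE C)) (sym (cong (_∸ 2) (length≡ r))) (free (5 + (r + r)) refl)
  where
  length≡ : ∀ r → 2 * (5 + r) ≡ 2 + (3 + (5 + (r + r)))
  length≡ = solve-∀
  free : ∀ κ → κ ≡ 5 + (r + r) → InducedCycleFree (3 + κ) (GV C) (GE C)
  free κ κ≡ (f , f-inj , _ , adj) = at-pure (Kinds.some-pure H length<)
    where
    open Bounds r κ κ≡
    open Labelling r C using (shift; shift-kd; module Kinds)
    H : InducedCycle C κ
    H = periodic f f-inj adj
    at-pure : (∃ λ x → ∃ λ i → Kinds.kd H x ≡ inj₂ i) → ⊥
    -- The cycle is re-indexed to begin with a pure edge, as `Labels` requires.
    at-pure (x , i , eq) = Reduction.contradiction r C κ≡ (shift x H) i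
      (trans (shift-kd H x) eq) rate (s≤s z≤n) path-bound total-bound
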